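{- If $P$ is a monotone irreducible pattern that is solvable by SAC (i.e. SAC-solvable), then $P$ occurs in at least one of the twelve patterns Q1, Q2, R1, R2, R3, R4, R5, R6, R7, R8, R9, R10 defined in the context.
   Context: **Binary CSP.** A binary CSP instance is $I=(X,D,C)$ with $X$ a finite set of variables, $D$ a finite domain, each $x\in X$ having its own domain $D(x)\subseteq D$, and $C=\{R(x,y): x,y\in X, x\ne y\}$ with $R(x,y)\subseteq D^2$ and $(a,b)\in R(x,y)\iff (b,a)\in R(y,x)$. Every pair of distinct variables carries exactly one constraint. A solution is an assignment $s$ with $s(x)\in D(x)$ and $(s(x),s(y))\in R(x,y)$ for all $x\neq y$. A point is a pair $(x,a)$ with $a\in D(x)$ (written $a$, domains being regarded as disjoint). For $a\in D(x)$, $b\in D(y)$, $x\ne y$, $ab$ is a positive edge if $(a,b)\in R(x,y)$, and a negative edge otherwise. A constraint $R(x,y)$ is trivial if $D(x)\times D(y)\subseteq R(x,y)$; deleting a constraint means replacing it with a trivial one. **Consistency.** A value $a\in D(x)$ is arc consistent if for every other variable $y$ there is $b\in D(y)$ with $ab$ positive. A value $a\in D(x)$ is singleton arc consistent if the instance obtained by setting $D(x)=\{a\}$ can be made arc consistent (by repeatedly removing values that are not arc consistent) without emptying any domain. Establishing singleton arc consistency means repeatedly removing values that are not singleton arc consistent until none remains (the result is unique). SAC decides an instance if, after establishing singleton arc consistency, non-emptiness of all domains guarantees the existence of a solution. **Patterns.** A pattern consists of a finite set of points, each belonging to a variable, and a partial function assigning to some pairs of points at distinct variables the label positive or negative. An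 instance is a pattern in which this function is total. A pattern $P$ occurs in a pattern (or instance) $Q$ if there is a (not necessarily injective) map from the points of $P$ to the points of $Q$ such that two points are mapped to points of the same variable of $Q$ if and only if they belong to the same variable of $P$, positive edges are mapped to positive edges and negative edges to negative edges. $\mathrm{CSP}(\overline P)$ is the set of binary CSP instances in which $P$ does not occur. $P$ is SAC-solvable if SAC decides every instance of $\mathrm{CSP}(\overline P)$. $P$ is monotone if $\mathrm{CSP}(\overline P)$ is closed under deleting constraints. (Equivalently: in $P$, any two variables joined by a positive edge are also joined by a negative edge.) Two distinct points $a,b$ at the same variable of a pattern are mergeable if there is no point $c$ such that one of $ac,bc$ is positive and the other negative. A point $a$ is dangling if there is at most one $b$ such that $ab$ is positive and no $c$ such that $ac$ is negative. A pattern is irreducible if it has no dangling points and no mergeable points. **The patterns** (all pairs not listed have unspecified compatibility). - Q1: variables $A,B,C,M$; points $p\in A$, $q\in B$, $r\in C$, $u,v,w\in M$. Negative: $pv,qw,ru$. Positive: $pw,qu,rv$. - Q2: variables $A,B,C,M$; points $p\in A$, $q\in B$, $r\in C$, $v,w\in M$. Negative: $pw,qw,rv$. Positive: $pv,rw$. The patterns R1–R10 have four variables $x_1,x_2,x_3,x_4$; points named $a,a_i$ are at $x_1$, $b,b_i$ at $x_2$, $c_i$ at $x_3$, $d,d_i$ at $x_4$. - R1: points $a;b_1,b_2;c_1,c_2;d$. Negative: $ab_2,b_2c_2,c_1d$. Positive: $ab_1,b_2c_1,b_1c_1,c_2d$. - R2: points $a_1,a_2;b_1,b_2;c_1,c_2;d$.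 Negative: $a_2b_2,b_2c_2,c_1d$. Positive: $a_1b_1,a_1b_2,b_2c_1,b_1c_2,c_2d$. - R3: points $a;b;c_1,c_2;d_1,d_2$. Negative: $ab,bc_2,c_1d_1$. Positive: $bc_1,c_1d_2,c_2d_2$. - R4: points $a;b_1,b_2;c_1,c_2;d$. Negative: $ab_2,b_2c_2,c_1d$. Positive: $b_1c_1,b_1c_2,c_2d$. - R5: points $a;b_1,b_2;c_1,c_2;d$. Negative: $ab_2,b_1c_1,c_2d$. Positive: $ab_1,b_2c_1,b_1c_2,c_1d$. - R6: points $a_1,a_2;b_1,b_2;c_1,c_2;d$. Negative: $a_2b_2,b_1c_1,c_2d$. Positive: $a_1b_1,a_1b_2,b_2c_1,b_1c_2,c_1d$. - R7: points $a;b_1,b_2,b_3;c_1,c_2;d$. Negative: $ab_2,b_1c_1,c_2d$. Positive: $ab_3,b_3c_1,b_2c_1,b_1c_2,c_1d$. - R8: points $a;b_1,b_2,b_3;c_1,c_2;d$. Negative: $ab_2,b_1c_1,c_2d$. Positive: $ab_3,ab_1,b_3c_1,b_1c_2,c_1d$. - R9: points $a;b_1,b_2,b_3;c_1,c_2;d$. Negative: $ab_2,b_1c_1,c_2d$. Positive: $ab_3,ab_1,b_3c_1,b_2c_2,c_1d$. - R10: points $a;b_1,b_2;c_1,c_2;d$. Negative: $ab_2,b_1c_1,c_2d$. Positive: $ab_1,b_2c_2,b_1c_2,c_1d$. -}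

module Defs where

open import Data.Bool.Base using (Bool; true; false; if_then_else_; _∧_; _∨_)
open import Data.Bool.Properties using (∨-comm)
open import Data.Fin using (Fin; #_)
open import Data.Fin.Properties using (_≟_; all?)
open import Data.Fin.Subset using (Subset; ⁅_⁆; _∈_; _-_; Nonempty)
open import Data.List.Base using (List; []; _∷_)
open import Data.Maybe.Base using (Maybe; just; nothing)
import Data.Maybe.Properties as Maybe
open import Data.Nat.Base using (ℕ)
open import Data.Product.Base using (∃-syntax; Σ-syntax; _×_; _,_; proj₁; proj₂)
import Data.Product.Properties as Product
open import Data.Sign.Base using (Sign) renaming (+ to positive; - to negative)
import Data.Sign.Properties as Sign
open import Data.Sum.Base using (_⊎_)
open import Data.Vec.Base using (Vec; []; _∷_; lookup; _[_]≔_; _[_]%=_)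
open import Function.Bundles using (_⇔_)
open import Relation.Binary.Construct.Closure.ReflexiveTransitive using (Star)
open import Relation.Binary.PropositionalEquality
  using (_≡_; _≢_; refl; sym; cong; cong₂)
open import Relation.Nullary using (¬_; Dec; yes; no; does; contradiction)
open import Relation.Nullary.Decidable using (True; toWitness; _→-dec_)

-- The points need not be finite in number here, so that instances can be
-- viewed as patterns whose points are dependent pairs; a pattern proper is
-- an element of Pattern (Fin m) (Fin k).

record Pattern (Var Point : Set) : Set where
  field
    var            : Point → Var
    label          : Point → Point → Maybe Sign
    label-sym      : ∀ a b → label a b ≡ label b a
    label-distinct : ∀ a b → var a ≡ var b → label a b ≡ nothing

  Positive Negative : Point → Point → Set
  Positive a b = label a b ≡ just positive
  Negative a b = label a b ≡ just negative

open Pattern public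

module _ {V A W B : Set} where

  infix 4 _occursIn_

  _occursIn_ : Pattern V A → Pattern W B → Set
  P occursIn Q = Σ[ f ∈ (A → B) ]
    (∀ a b → var P a ≡ var P b ⇔ var Q (f a) ≡ var Q (f b)) ×
    (∀ a b → Positive P a b → Positive Q (f a) (f b)) ×
    (∀ a b → Negative P a b → Negative Q (f a) (f b))

module _ {V A : Set} (P : Pattern V A) where

  Mergeable : A → A → Set
  Mergeable a b = a ≢ b × var P a ≡ var P b ×
    ¬ (∃[ c ] ((Positive P a c × Negative P b c) ⊎ (Negative P a c × Positive P b c)))

  Dangling : A → Set
  Dangling a = (∀ b b′ → Positive P a b → Positive P a b′ → b ≡ b′) ×
               ¬ (∃[ c ] Negative P a c)

  Irreducible : Set
  Irreducible = (∀ a → ¬ Dangling a) × (∀ a b → ¬ Mergeable a b)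

-- X is Fin n and D is Fin d. The constraint rel x x is junk: nothing below
-- depends on it.

record Instance (n d : ℕ) : Set where
  field
    domains : Vec (Subset d) n
    rel     : Fin n → Fin n → Fin d → Fin d → Bool
    rel-sym : ∀ {x y} → x ≢ y → ∀ a b → rel x y a b ≡ rel y x b a

  dom : Fin n → Subset d
  dom = lookup domains

  Value : Set
  Value = Σ[ x ∈ Fin n ] Σ[ a ∈ Fin d ] a ∈ dom x

open Instance public

module _ {n d : ℕ} (I : Instance n d) where

  Solution : Set
  Solution = Σ[ s ∈ (Fin n → Fin d) ]
    (∀ x → s x ∈ dom I x) ×
    (∀ x y → x ≢ y → rel I x y (s x) (s y) ≡ true)

  edge : Fin n × Fin d → Fin n × Fin d → Maybe Sign
  edge (x , a) (y , b) with x ≟ y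
  ... | yes _ = nothing
  ... | no  _ = just (if rel I x y a b then positive else negative)

  edge-sym : ∀ p q → edge p q ≡ edge q p
  edge-sym (x , a) (y , b) with x ≟ y | y ≟ x
  ... | yes _   | yes _   = refl
  ... | yes x≡y | no  y≢x = contradiction (sym x≡y) y≢x
  ... | no  x≢y | yes y≡x = contradiction (sym y≡x) x≢y
  ... | no  x≢y | no  _   =
    cong (λ r → just (if r then positive else negative)) (rel-sym I x≢y a b)

  edge-distinct : ∀ p q → proj₁ p ≡ proj₁ q → edge p q ≡ nothing
  edge-distinct (x , a) (y , b) x≡y with x ≟ y
  ... | yes _   = refl
  ... | no  x≢y = contradiction x≡y x≢y

  asPattern : Pattern (Fin n) (Value I)
  asPattern = record
    { var            = proj₁
    ; label          = λ (x , a , _) (y , b , _) → edge (x , a) (y , b)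
    ; label-sym      = λ (x , a , _) (y , b , _) → edge-sym (x , a) (y , b)
    ; label-distinct = λ (x , a , _) (y , b , _) → edge-distinct (x , a) (y , b)
    }

  withDomains : Vec (Subset d) n → Instance n d
  withDomains D = record { domains = D ; rel = rel I ; rel-sym = rel-sym I }

  assign : Fin n → Fin d → Instance n d
  assign x a = withDomains (domains I [ x ]≔ ⁅ a ⁆)

  removeValue : Fin n → Fin d → Instance n d
  removeValue x a = withDomains (domains I [ x ]%= (_- a))

  same : Fin n → Fin n → Fin n → Fin n → Bool
  same x y u v = (does (u ≟ x) ∧ does (v ≟ y)) ∨ (does (v ≟ x) ∧ does (u ≟ y))

  deleteConstraint : Fin n → Fin n → Instance n d
  deleteConstraint x y = record
    { domains = domains I
    ; rel     = λ u v a b → same x y u v ∨ rel I u v a b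
    ; rel-sym = λ {u} {v} u≢v a b →
        cong₂ _∨_ (∨-comm (does (u ≟ x) ∧ does (v ≟ y)) _) (rel-sym I u≢v a b)
    }

module _ {n d : ℕ} (Good : Instance n d → Fin n → Fin d → Set) where

  data Prune (I : Instance n d) : Instance n d → Set where
    prune : ∀ {x a} → a ∈ dom I x → ¬ Good I x a → Prune I (removeValue I x a)

  AllValues : Instance n d → Set
  AllValues I = ∀ x a → a ∈ dom I x → Good I x a

  -- J results from I by removing values that are not Good until none remains.
  Establishes : Instance n d → Instance n d → Set
  Establishes I J = Star Prune I J × AllValues J

module _ {n d : ℕ} where

  NonemptyDomains : Instance n d → Set
  NonemptyDomains I = ∀ x → Nonempty (dom I x)

  ArcConsistent : Instance n d → Fin n → Fin d → Set
  ArcConsistent I x a = ∀ y → x ≢ y → ∃[ b ] (b ∈ dom I y × rel I x y a b ≡ true)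

  SingletonArcConsistent : Instance n d → Fin n → Fin d → Set
  SingletonArcConsistent I x a =
    ∃[ J ] (Establishes ArcConsistent (assign I x a) J × NonemptyDomains J)

  SACDecides : Instance n d → Set
  SACDecides I = ∀ J → Establishes SingletonArcConsistent I J → NonemptyDomains J → Solution I

module _ {V A : Set} (P : Pattern V A) where

  CSP-avoiding : ∀ {n d} → Instance n d → Set
  CSP-avoiding I = ¬ (P occursIn asPattern I)

  SACSolvable : Set
  SACSolvable = ∀ {n d} (I : Instance n d) → CSP-avoiding I → SACDecides I

  Monotone : Set
  Monotone = ∀ {n d} (I : Instance n d) {x y} → x ≢ y →
    CSP-avoiding I → CSP-avoiding (deleteConstraint I x y)

module _ {k : ℕ} where

  Edges : Set
  Edges = List (Fin k × Fin k)

  open import Data.List.Membership.DecPropositional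
    (Product.≡-dec (_≟_ {k}) (_≟_ {k})) using (_∈?_)

  joined : Edges → Fin k → Fin k → Bool
  joined es a b = does ((a , b) ∈? es) ∨ does ((b , a) ∈? es)

  joined-sym : ∀ es a b → joined es a b ≡ joined es b a
  joined-sym es a b = ∨-comm (does ((a , b) ∈? es)) _

  labelFrom : Edges → Edges → Fin k → Fin k → Maybe Sign
  labelFrom neg pos a b =
    if joined neg a b then just negative else
    if joined pos a b then just positive else nothing

  labelFrom-sym : ∀ neg pos a b → labelFrom neg pos a b ≡ labelFrom neg pos b a
  labelFrom-sym neg pos a b = cong₂
    (λ i j → if i then just negative else if j then just positive else nothing)
    (joined-sym neg a b) (joined-sym pos a b)

module _ {m k : ℕ} where

  distinct? : (vars : Vec (Fin m) k) (neg pos : Edges {k}) →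
    Dec (∀ a b → lookup vars a ≡ lookup vars b → labelFrom neg pos a b ≡ nothing)
  distinct? vars neg pos = all? λ a → all? λ b →
    (lookup vars a ≟ lookup vars b) →-dec
    Maybe.≡-dec Sign._≟_ (labelFrom neg pos a b) nothing

  -- vars lists the variable of each point; neg and pos list each edge in one
  -- of its two orientations.
  fromEdges : (vars : Vec (Fin m) k) (neg pos : Edges {k}) →
    {True (distinct? vars neg pos)} → Pattern (Fin m) (Fin k)
  fromEdges vars neg pos {distinct} = record
    { var            = lookup vars
    ; label          = labelFrom neg pos
    ; label-sym      = labelFrom-sym neg pos
    ; label-distinct = toWitness distinct
    }

private
  A B C M x₁ x₂ x₃ x₄ : Fin 4
  A = # 0 ; B = # 1 ; C = # 2 ; M = # 3
  x₁ = # 0 ; x₂ = # 1 ; x₃ = # 2 ; x₄ = # 3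

Q1 : Pattern (Fin 4) (Fin 6)
Q1 = fromEdges
  (A ∷ B ∷ C ∷ M ∷ M ∷ M ∷ [])
  ((p , v) ∷ (q , w) ∷ (r , u) ∷ [])
  ((p , w) ∷ (q , u) ∷ (r , v) ∷ [])
  where
  p q r u v w : Fin 6
  p = # 0 ; q = # 1 ; r = # 2 ; u = # 3 ; v = # 4 ; w = # 5

Q2 : Pattern (Fin 4) (Fin 5)
Q2 = fromEdges
  (A ∷ B ∷ C ∷ M ∷ M ∷ [])
  ((p , w) ∷ (q , w) ∷ (r , v) ∷ [])
  ((p , v) ∷ (r , w) ∷ [])
  where
  p q r v w : Fin 5
  p = # 0 ; q = # 1 ; r = # 2 ; v = # 3 ; w = # 4

R1 : Pattern (Fin 4) (Fin 6)
R1 = fromEdges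
  (x₁ ∷ x₂ ∷ x₂ ∷ x₃ ∷ x₃ ∷ x₄ ∷ [])
  ((a , b₂) ∷ (b₂ , c₂) ∷ (c₁ , d) ∷ [])
  ((a , b₁) ∷ (b₂ , c₁) ∷ (b₁ , c₁) ∷ (c₂ , d) ∷ [])
  where
  a b₁ b₂ c₁ c₂ d : Fin 6
  a = # 0 ; b₁ = # 1 ; b₂ = # 2 ; c₁ = # 3 ; c₂ = # 4 ; d = # 5

R2 : Pattern (Fin 4) (Fin 7)
R2 = fromEdges
  (x₁ ∷ x₁ ∷ x₂ ∷ x₂ ∷ x₃ ∷ x₃ ∷ x₄ ∷ [])
  ((a₂ , b₂) ∷ (b₂ , c₂) ∷ (c₁ , d) ∷ [])
  ((a₁ , b₁) ∷ (a₁ , b₂) ∷ (b₂ , c₁) ∷ (b₁ , c₂) ∷ (c₂ , d) ∷ [])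
  where
  a₁ a₂ b₁ b₂ c₁ c₂ d : Fin 7
  a₁ = # 0 ; a₂ = # 1 ; b₁ = # 2 ; b₂ = # 3 ; c₁ = # 4 ; c₂ = # 5 ; d = # 6

R3 : Pattern (Fin 4) (Fin 6)
R3 = fromEdges
  (x₁ ∷ x₂ ∷ x₃ ∷ x₃ ∷ x₄ ∷ x₄ ∷ [])
  ((a , b) ∷ (b , c₂) ∷ (c₁ , d₁) ∷ [])
  ((b , c₁) ∷ (c₁ , d₂) ∷ (c₂ , d₂) ∷ [])
  where
  a b c₁ c₂ d₁ d₂ : Fin 6
  a = # 0 ; b = # 1 ; c₁ = # 2 ; c₂ = # 3 ; d₁ = # 4 ; d₂ = # 5

R4 : Pattern (Fin 4) (Fin 6)
R4 = fromEdges
  (x₁ ∷ x₂ ∷ x₂ ∷ x₃ ∷ x₃ ∷ x₄ ∷ [])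
  ((a , b₂) ∷ (b₂ , c₂) ∷ (c₁ , d) ∷ [])
  ((b₁ , c₁) ∷ (b₁ , c₂) ∷ (c₂ , d) ∷ [])
  where
  a b₁ b₂ c₁ c₂ d : Fin 6
  a = # 0 ; b₁ = # 1 ; b₂ = # 2 ; c₁ = # 3 ; c₂ = # 4 ; d = # 5

R5 : Pattern (Fin 4) (Fin 6)
R5 = fromEdges
  (x₁ ∷ x₂ ∷ x₂ ∷ x₃ ∷ x₃ ∷ x₄ ∷ [])
  ((a , b₂) ∷ (b₁ , c₁) ∷ (c₂ , d) ∷ [])
  ((a , b₁) ∷ (b₂ , c₁) ∷ (b₁ , c₂) ∷ (c₁ , d) ∷ [])
  where
  a b₁ b₂ c₁ c₂ d : Fin 6
  a = # 0 ; b₁ = # 1 ; b₂ = # 2 ; c₁ = # 3 ; c₂ = # 4 ; d = # 5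

R6 : Pattern (Fin 4) (Fin 7)
R6 = fromEdges
  (x₁ ∷ x₁ ∷ x₂ ∷ x₂ ∷ x₃ ∷ x₃ ∷ x₄ ∷ [])
  ((a₂ , b₂) ∷ (b₁ , c₁) ∷ (c₂ , d) ∷ [])
  ((a₁ , b₁) ∷ (a₁ , b₂) ∷ (b₂ , c₁) ∷ (b₁ , c₂) ∷ (c₁ , d) ∷ [])
  where
  a₁ a₂ b₁ b₂ c₁ c₂ d : Fin 7
  a₁ = # 0 ; a₂ = # 1 ; b₁ = # 2 ; b₂ = # 3 ; c₁ = # 4 ; c₂ = # 5 ; d = # 6

R7 : Pattern (Fin 4) (Fin 7)
R7 = fromEdges
  (x₁ ∷ x₂ ∷ x₂ ∷ x₂ ∷ x₃ ∷ x₃ ∷ x₄ ∷ [])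
  ((a , b₂) ∷ (b₁ , c₁) ∷ (c₂ , d) ∷ [])
  ((a , b₃) ∷ (b₃ , c₁) ∷ (b₂ , c₁) ∷ (b₁ , c₂) ∷ (c₁ , d) ∷ [])
  where
  a b₁ b₂ b₃ c₁ c₂ d : Fin 7
  a = # 0 ; b₁ = # 1 ; b₂ = # 2 ; b₃ = # 3 ; c₁ = # 4 ; c₂ = # 5 ; d = # 6

R8 : Pattern (Fin 4) (Fin 7)
R8 = fromEdges
  (x₁ ∷ x₂ ∷ x₂ ∷ x₂ ∷ x₃ ∷ x₃ ∷ x₄ ∷ [])
  ((a , b₂) ∷ (b₁ , c₁) ∷ (c₂ , d) ∷ [])
  ((a , b₃) ∷ (a , b₁) ∷ (b₃ , c₁) ∷ (b₁ , c₂) ∷ (c₁ , d) ∷ [])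
  where
  a b₁ b₂ b₃ c₁ c₂ d : Fin 7
  a = # 0 ; b₁ = # 1 ; b₂ = # 2 ; b₃ = # 3 ; c₁ = # 4 ; c₂ = # 5 ; d = # 6

R9 : Pattern (Fin 4) (Fin 7)
R9 = fromEdges
  (x₁ ∷ x₂ ∷ x₂ ∷ x₂ ∷ x₃ ∷ x₃ ∷ x₄ ∷ [])
  ((a , b₂) ∷ (b₁ , c₁) ∷ (c₂ , d) ∷ [])
  ((a , b₃) ∷ (a , b₁) ∷ (b₃ , c₁) ∷ (b₂ , c₂) ∷ (c₁ , d) ∷ [])
  where
  a b₁ b₂ b₃ c₁ c₂ d : Fin 7
  a = # 0 ; b₁ = # 1 ; b₂ = # 2 ; b₃ = # 3 ; c₁ = # 4 ; c₂ = # 5 ; d = # 6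

R10 : Pattern (Fin 4) (Fin 6)
R10 = fromEdges
  (x₁ ∷ x₂ ∷ x₂ ∷ x₃ ∷ x₃ ∷ x₄ ∷ [])
  ((a , b₂) ∷ (b₁ , c₁) ∷ (c₂ , d) ∷ [])
  ((a , b₁) ∷ (b₂ , c₂) ∷ (b₁ , c₂) ∷ (c₁ , d) ∷ [])
  where
  a b₁ b₂ c₁ c₂ d : Fin 6
  a = # 0 ; b₁ = # 1 ; b₂ = # 2 ; c₁ = # 3 ; c₂ = # 4 ; d = # 5

{-# OPTIONS --safe #-}

-- An occurrence that identifies two points of a pattern shows them to be
-- mergeable, so an irreducible pattern P that is solvable by SAC occurs injectively
-- in every instance on which SAC fails. Four such instances confine P:
-- * 3-colouring K₄: P has at most four variables;
-- * a subdivided 3-SAT instance, in which every constraint has one negative edge: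
--   the variables of P are joined by at most one negative edge each, without cycles,
--   and the negative edges of P hardly share points;
-- * the pigeonhole principle: if b has negative edges to a and c at different
--   variables, then no other point at the variable of b has positive edges to both;
-- * the parity equations of the magic square: every constraint of P is functional
--   in at least one direction, and rarely fails to be so in the other.
-- A monotone P has positive edges only along its negative edges, which form one or
-- two disjoint edges, a path or a star. At every variable there is at most one point
-- without negative edges, and what remains is to see which positive edges fit.

module Submission where

open import Defs
open import Data.Bool.Base using (true; false; not; if_then_else_; _∨_; T)
open import Data.Bool.Properties using (∨-zeroʳ) renaming (_≟_ to _≟ᵇ_)
open import Data.Empty using (⊥; ⊥-elim)
open import Data.Fin.Base
  using (Fin; zero; suc; toℕ; combine; finToFun; funToFin; splitAt; _↑ˡ_; _↑ʳ_)
open import Data.Fin.Patterns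
open import Data.Fin.Properties
  using (_≟_; all?; any?; pigeonhole; <⇒≢; combine-injective; finToFun-funToFin; +↔⊎; *↔×;
    ↑ˡ-injective; ↑ʳ-injective; splitAt-↑ˡ; splitAt-↑ʳ)
open import Data.Fin.Subset using (Subset; _-_; ⁅_⁆; ∣_∣) renaming (_∈_ to _∈ˢ_)
open import Data.Fin.Subset.Properties
  using (x∈p∧x≢y⇒x∈p-y; x∈p⇒∣p-x∣<∣p∣; x∈⁅x⁆)
  renaming (_∈?_ to _∈ˢ?_)
open import Data.List.Base using (List; []; _∷_; map; filter; allFin; null)
import Data.List.Membership.DecPropositional as DecMembership
open import Data.List.Membership.Propositional using (_∈_; lose)
open import Data.List.Membership.Propositional.Properties
  using (∈-filter⁺; ∈-allFin; ∈-map⁺; ∈-map⁻)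
open import Data.List.Relation.Unary.All as All using (All; []; _∷_)
open import Data.List.Relation.Unary.Any as Any using (Any; here; there)
open import Data.Maybe.Base using (just)
import Data.Maybe.Properties as Maybe
open import Data.Nat.Base using (ℕ; zero; suc; _+_; _*_; _^_; _<_)
open import Data.Nat.Induction using (Acc; acc; <-wellFounded)
open import Data.Nat.Properties using (≤-refl; +-monoˡ-<; +-monoʳ-<; +-suc; m≤n⇒∃[o]m+o≡n)
open import Data.Product.Base using (∃; ∃-syntax; ∃₂; _×_; _,_; proj₁; proj₂; swap)
open import Data.Product.Function.NonDependent.Propositional using (_×-↔_)
open import Data.Product.Properties using () renaming (≡-dec to ×-≡-dec)
open import Data.Sign.Base using () renaming (+ to positive; - to negative)
import Data.Sign.Properties as Sign
open import Data.Sum.Base as Sum using (_⊎_; inj₁; inj₂; [_,_]′)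
open import Data.Sum.Function.Propositional using (_⊎-↔_)
open import Data.Sum.Properties using (inj₁-injective; inj₂-injective) renaming (≡-dec to ⊎-≡-dec)
open import Data.Vec.Base as Vec using (Vec; []; _∷_; lookup; tabulate; _++_; _[_]%=_)
open import Data.Vec.Properties
  using (lookup∘tabulate; lookup⇒[]=; []=⇒lookup; lookup∘updateAt; lookup∘updateAt′;
    lookup∘update; lookup∘update′; lookup-map; lookup-allFin; lookup-++ˡ; lookup-++ʳ)
open import Data.Vec.Relation.Unary.All using ([]; _∷_)
import Data.Vec.Relation.Unary.AllPairs as VAP
open import Data.Vec.Relation.Unary.Unique.Propositional using (Unique)
open import Data.Vec.Relation.Unary.Unique.Propositional.Properties using (lookup-injective)
open import Function.Base using (_∘_; id; case_of_)
open import Function.Bundles using (_↔_; mk⇔; module Equivalence; module Inverse)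
open import Function.Construct.Composition using (_↔-∘_)
open import Function.Construct.Identity using (↔-id)
open import Relation.Binary.Construct.Closure.ReflexiveTransitive using (ε; _◅_)
open import Relation.Binary.Definitions using (DecidableEquality)
open import Relation.Binary.PropositionalEquality
  using (_≡_; _≢_; _≗_; refl; sym; trans; cong; cong₂; subst; subst₂)
open import Relation.Nullary using (¬_; Dec; yes; no; does; contradiction)
open import Relation.Nullary.Decidable
  using (True; toWitness; from-yes; map′; ¬?; _×-dec_; _⊎-dec_; _→-dec_; does-⇔;
    decidable-stable; dec-true; dec-false)

-- An instance on which SAC is wrong cannot avoid `P`, so whatever an injective occurrence carries
-- over and the instance lacks is lacking in `P` as well. No propagation is ever run: each instance
-- comes with a certificate, which gives for every value `p` a family of subdomains, reduced to `p`
-- at its own variable, in which every value has support. The difficulty is to make the instances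
-- sparse while SAC still fails. Subdividing the clashes of the 3-SAT instance leaves one negative
-- edge per constraint and a bipartite constraint graph without 4-cycles; separate copies of the
-- propositional variables for each clause bound the number of clashes at a point. Parity of three
-- bits is not a binary constraint, so each line of the magic square is a variable whose values are
-- the four admissible triples. The copies placed between a line and its cells keep any two cells at
-- distance at least four. Hence a path of four variables meets only one cell, and every failure of
-- functionality along the path starts there.

infixr 1 _⊎ᶠ_
infixr 2 _×ᶠ_

_⊎ᶠ_ : ∀ {m n} {A B : Set} → Fin m ↔ A → Fin n ↔ B → Fin (m + n) ↔ (A ⊎ B)
f ⊎ᶠ g = (f ⊎-↔ g) ↔-∘ +↔⊎

_×ᶠ_ : ∀ {m n} {A B : Set} → Fin m ↔ A → Fin n ↔ B → Fin (m * n) ↔ (A × B)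
f ×ᶠ g = (f ×-↔ g) ↔-∘ *↔×

finite : ∀ n → Fin n ↔ Fin n
finite n = ↔-id (Fin n)

-- Arc consistency

size : ∀ {n d} → Vec (Subset d) n → ℕ
size []       = 0
size (p ∷ ps) = ∣ p ∣ + size ps

size-remove : ∀ {n d} (D : Vec (Subset d) n) {x a} →
  a ∈ˢ lookup D x → size (D [ x ]%= (_- a)) < size D
size-remove (p ∷ D) {zero}  a∈p = +-monoˡ-< (size D) (x∈p⇒∣p-x∣<∣p∣ a∈p)
size-remove (p ∷ D) {suc x} a∈D = +-monoʳ-< ∣ p ∣ (size-remove D a∈D)

module _ {n d : ℕ} where

  arcConsistent? : (I : Instance n d) → ∀ x a → Dec (ArcConsistent I x a)
  arcConsistent? I x a = all? λ y → ¬? (x ≟ y) →-dec any? λ b →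
    (b ∈ˢ? dom I y) ×-dec (rel I x y a b ≟ᵇ true)

  ArcClosed : Instance n d → (Fin n → Fin d → Set) → Set
  ArcClosed I S = ∀ {x a} → S x a → ∀ y → x ≢ y → ∃[ b ] S y b × rel I x y a b ≡ true

  -- Pruning never removes a value of an arc-closed family of subdomains.
  establish : (I : Instance n d) (S : Fin n → Fin d → Set) →
    (∀ {x a} → S x a → a ∈ˢ dom I x) → ArcClosed I S →
    ∃[ J ] Establishes ArcConsistent I J × (∀ {x a} → S x a → a ∈ˢ dom J x)
  establish I S = go I (<-wellFounded _)
    where
    go : ∀ I → Acc _<_ (size (domains I)) → (∀ {x a} → S x a → a ∈ˢ dom I x) → ArcClosed I S →
      ∃[ J ] Establishes ArcConsistent I J × (∀ {x a} → S x a → a ∈ˢ dom J x)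
    go I (acc rec) S⊆I closed with any? (λ x → any? λ a → (a ∈ˢ? dom I x) ×-dec ¬? (arcConsistent? I x a))
    ... | no none = I , (ε , λ x a a∈ → decidable-stable (arcConsistent? I x a)
                               λ bad → none (x , a , a∈ , bad)) , S⊆I
    ... | yes (x , a , a∈ , bad) =
      let (J , (steps , ac) , S⊆J) = go (removeValue I x a) (rec (size-remove (domains I) a∈)) S⊆I′ closed
      in J , (prune a∈ bad ◅ steps , ac) , S⊆J
      where
      kept : ¬ S x a
      kept s = bad λ y x≢y → let (b , t , r) = closed s y x≢y in b , S⊆I t , r
      S⊆I′ : ∀ {y b} → S y b → b ∈ˢ dom (removeValue I x a) y
      S⊆I′ {y} {b} s with y ≟ x
      ... | yes refl = subst (b ∈ˢ_) (sym (lookup∘updateAt x (domains I)))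
                         (x∈p∧x≢y⇒x∈p-y (S⊆I s) λ { refl → kept s })
      ... | no y≢x   = subst (b ∈ˢ_) (sym (lookup∘updateAt′ y x y≢x (domains I))) (S⊆I s)

-- A network is an instance whose values are typed points, each lying at one
-- variable, so that the domains are disjoint.
record Network : Set₁ where
  field
    {Var Pt} : Set
    {n d}    : ℕ
    vars     : Fin n ↔ Var
    pts      : Fin d ↔ Pt
    at       : Pt → Var
    Clash    : Pt → Pt → Set
    clash?   : ∀ p q → Dec (Clash p q)
    clash-sym : ∀ {p q} → Clash p q → Clash q p

  open Inverse vars using () renaming
    (to to variable′; from to index; strictlyInverseˡ to variable-index; strictlyInverseʳ to index-variable) public
  open Inverse pts using () renaming
    (to to point; from to code; strictlyInverseˡ to point-code; strictlyInverseʳ to code-point) public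

  toInstance : Instance n d
  toInstance = record
    { domains = tabulate λ x → tabulate λ a → does (index (at (point a)) ≟ x)
    ; rel     = λ _ _ a b → not (does (clash? (point a) (point b)))
    ; rel-sym = λ _ a b → cong not (does-⇔ (mk⇔ clash-sym clash-sym) (clash? _ _) (clash? _ _))
    }

  dom-lookup : ∀ x a → lookup (dom toInstance x) a ≡ does (index (at (point a)) ≟ x)
  dom-lookup x a = trans (cong (λ p → lookup p a) (lookup∘tabulate _ x)) (lookup∘tabulate _ a)

  ∈dom⁺ : ∀ {x a} → index (at (point a)) ≡ x → a ∈ˢ dom toInstance x
  ∈dom⁺ {x} {a} eq = lookup⇒[]= a _ (trans (dom-lookup x a) (dec-true (_ ≟ x) eq))

  ∈dom⁻ : ∀ {x a} → a ∈ˢ dom toInstance x → index (at (point a)) ≡ x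
  ∈dom⁻ {x} {a} a∈ with index (at (point a)) ≟ x in eq
  ... | yes p = p
  ... | no  _ with () ← trans (sym ([]=⇒lookup a∈)) (trans (dom-lookup x a) (cong does eq))

  rel⁺ : ∀ {x y a b} → ¬ Clash (point a) (point b) → rel toInstance x y a b ≡ true
  rel⁺ {a = a} {b} ok = cong not (dec-false (clash? (point a) (point b)) ok)

  rel⁻ : ∀ {x y a b} → rel toInstance x y a b ≡ true → ¬ Clash (point a) (point b)
  rel⁻ {a = a} {b} eq with clash? (point a) (point b)
  rel⁻ () | yes _
  rel⁻ _  | no ok = ok

  rel-clash : ∀ {x y a b} → Clash (point a) (point b) → rel toInstance x y a b ≡ false
  rel-clash {a = a} {b} c = cong not (dec-true (clash? (point a) (point b)) c)

  -- A certificate that SAC is wrong. `Keeps p` survives the assignment of `p`, but need not be the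
  -- largest arc consistent family that does. `origin` supplies one value, from which `keeps-some`
  -- shows that all domains are nonempty.
  record SACFails : Set₁ where
    field
      origin     : Pt
      Keeps      : Pt → Pt → Set
      keeps-only : ∀ {p q} → Keeps p q → at q ≡ at p → q ≡ p
      keeps-some : ∀ p y → ∃[ q ] at q ≡ y × Keeps p q
      keeps-arc  : ∀ {p q} → Keeps p q → ∀ y → at q ≢ y → ∃[ r ] at r ≡ y × Keeps p r × ¬ Clash q r
      unsolvable : (s : Var → Pt) → (∀ x → at (s x) ≡ x) → ¬ (∀ x y → x ≢ y → ¬ Clash (s x) (s y))

  module _ (fails : SACFails) where
    open SACFails fails

    singletonArcConsistent : ∀ x a → a ∈ˢ dom toInstance x → SingletonArcConsistent toInstance x a
    singletonArcConsistent x a a∈ =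
      let (J , est , S⊆J) = establish (assign toInstance x a) S S⊆ closed
      in J , est , λ y → let (q , at≡ , k) = keeps-some (point a) (variable′ y) in
           code q , S⊆J (trans (cong index (trans (cong at (point-code q)) at≡)) (index-variable y) ,
                         subst (Keeps (point a)) (sym (point-code q)) k)
      where
      S : Fin n → Fin d → Set
      S y b = index (at (point b)) ≡ y × Keeps (point a) (point b)
      S⊆ : ∀ {y b} → S y b → b ∈ˢ dom (assign toInstance x a) y
      S⊆ {y} {b} (b∈ , k) with y ≟ x
      ... | no y≢x   = subst (b ∈ˢ_) (sym (lookup∘update′ y≢x (domains toInstance) _)) (∈dom⁺ b∈)
      ... | yes refl = subst (b ∈ˢ_) (sym (lookup∘update x (domains toInstance) _))
                         (subst (_∈ˢ ⁅ a ⁆) (sym b≡a) (x∈⁅x⁆ a))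
        where
        same-var : at (point b) ≡ at (point a)
        same-var = trans (sym (variable-index _)) (trans (cong variable′ (trans b∈ (sym (∈dom⁻ a∈)))) (variable-index _))
        b≡a : b ≡ a
        b≡a = trans (sym (code-point b)) (trans (cong code (keeps-only k same-var)) (code-point a))
      closed : ArcClosed (assign toInstance x a) S
      closed {z} {b} (b∈ , k) y z≢y =
        let (r , at≡ , kr , ok) = keeps-arc k (variable′ y) λ eq →
              z≢y (trans (sym b∈) (trans (cong index eq) (index-variable y)))
        in code r ,
           (trans (cong index (trans (cong at (point-code r)) at≡)) (index-variable y) ,
            subst (Keeps (point a)) (sym (point-code r)) kr) ,
           rel⁺ {z} {y} (subst (λ r → ¬ Clash (point b) r) (sym (point-code r)) ok)

    -- Every value is singleton arc consistent, so the network is its own closure, reached by no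
    -- removal at all.
    ¬SACDecides : ¬ SACDecides toInstance
    ¬SACDecides decides =
      let (s , s∈ , ok) = decides toInstance (ε , singletonArcConsistent) nonempty in
      unsolvable (point ∘ s ∘ index)
        (λ x → trans (sym (variable-index _)) (trans (cong variable′ (∈dom⁻ (s∈ (index x)))) (variable-index x)))
        (λ x y x≢y → rel⁻ {index x} {index y} (ok (index x) (index y) λ eq →
           x≢y (trans (sym (variable-index x)) (trans (cong variable′ eq) (variable-index y)))))
      where
      nonempty : NonemptyDomains toInstance
      nonempty x = let (q , at≡ , _) = keeps-some origin (variable′ x) in
        code q , ∈dom⁺ (trans (cong index (trans (cong at (point-code q)) at≡)) (index-variable x))


-- Occurrences of a pattern in a network

edge⇒rel : ∀ {n d} (I : Instance n d) (p q : Value I) {r} → label (asPattern I) p q ≡ just r →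
  (r ≡ positive → rel I (proj₁ p) (proj₁ q) (proj₁ (proj₂ p)) (proj₁ (proj₂ q)) ≡ true) ×
  (r ≡ negative → rel I (proj₁ p) (proj₁ q) (proj₁ (proj₂ p)) (proj₁ (proj₂ q)) ≡ false)
edge⇒rel I (x , a , _) (y , b , _) eq with x ≟ y
edge⇒rel I _ _ () | yes _
edge⇒rel I (x , a , _) (y , b , _) eq | no _ with rel I x y a b
edge⇒rel _ _ _ refl | no _ | true  = (λ _ → refl) , λ ()
edge⇒rel _ _ _ refl | no _ | false = (λ ()) , λ _ → refl

rel⇒edge : ∀ {n d} (I : Instance n d) (p q : Value I) → proj₁ p ≢ proj₁ q →
  (rel I (proj₁ p) (proj₁ q) (proj₁ (proj₂ p)) (proj₁ (proj₂ q)) ≡ true → Positive (asPattern I) p q) ×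
  (rel I (proj₁ p) (proj₁ q) (proj₁ (proj₂ p)) (proj₁ (proj₂ q)) ≡ false → Negative (asPattern I) p q)
rel⇒edge I (x , a , _) (y , b , _) x≢y with x ≟ y
... | yes x≡y = contradiction x≡y x≢y
... | no  _   = (λ eq → cong (λ r → just (if r then positive else negative)) eq) ,
                (λ eq → cong (λ r → just (if r then positive else negative)) eq)

-- Functions are enumerated by their codes below `d ^ k`. Decoding the code of `f` returns `f` only
-- pointwise, so `Q` has to respect pointwise equality.
any-function? : ∀ {k d} {Q : (Fin k → Fin d) → Set} →
  (∀ f → Dec (Q f)) → (∀ {f g} → f ≗ g → Q f → Q g) → Dec (∃ Q)
any-function? {k} {d} {Q} Q? resp = map′ (λ (i , q) → finToFun i , q)
  (λ (f , q) → funToFin f , resp (λ a → sym (finToFun-funToFin f a)) q)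
  (any? {n = d ^ k} λ i → Q? (finToFun i))

module _ {m k : ℕ} (P : Pattern (Fin m) (Fin k)) where

  Pos Neg : Fin k → Fin k → Set
  Pos = Positive P
  Neg = Negative P

  pos-distinct : ∀ {a b} → Pos a b → var P a ≢ var P b
  pos-distinct {a} {b} ab eq with () ← trans (sym ab) (label-distinct P a b eq)

  neg-distinct : ∀ {a b} → Neg a b → var P a ≢ var P b
  neg-distinct {a} {b} ab eq with () ← trans (sym ab) (label-distinct P a b eq)

  pos-sym : ∀ {a b} → Pos a b → Pos b a
  pos-sym {a} {b} = trans (label-sym P b a)

  neg-sym : ∀ {a b} → Neg a b → Neg b a
  neg-sym {a} {b} = trans (label-sym P b a)

  pos-neg : ∀ {a b} → Pos a b → ¬ Neg a b
  pos-neg ab ab′ with () ← trans (sym ab) ab′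

  pos? : ∀ a b → Dec (Pos a b)
  pos? a b = Maybe.≡-dec Sign._≟_ (label P a b) (just positive)

  neg? : ∀ a b → Dec (Neg a b)
  neg? a b = Maybe.≡-dec Sign._≟_ (label P a b) (just negative)

  -- The form in which monotonicity is used throughout; `joined-by-neg` derives it for irreducible
  -- patterns.
  NegJoined : Set
  NegJoined = ∀ {a b} → Pos a b → ∃₂ λ a′ b′ → Neg a′ b′ × var P a′ ≡ var P a × var P b′ ≡ var P b

  Functional : Fin m → Fin m → Set
  Functional x y = ∀ {a u v} → var P a ≡ x → var P u ≡ y → var P v ≡ y → Pos a u → Pos a v → u ≡ v

  module _ (N : Network) where
    open Network N

    record Embeds (g : Fin k → Pt) : Set where
      field
        var⇒at   : ∀ {a b} → var P a ≡ var P b → at (g a) ≡ at (g b)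
        at⇒var   : ∀ {a b} → at (g a) ≡ at (g b) → var P a ≡ var P b
        pos⇒free : ∀ {a b} → Pos a b → ¬ Clash (g a) (g b)
        neg⇒clash : ∀ {a b} → Neg a b → Clash (g a) (g b)

    embeds? : ∀ g → Dec (Embeds g)
    embeds? g = map′
      (λ h → record { var⇒at = λ {a} {b} → proj₁ (h a b) ; at⇒var = λ {a} {b} → proj₁ (proj₂ (h a b))
                    ; pos⇒free = λ {a} {b} → proj₁ (proj₂ (proj₂ (h a b)))
                    ; neg⇒clash = λ {a} {b} → proj₂ (proj₂ (proj₂ (h a b))) })
      (λ e a b → let open Embeds e in var⇒at , at⇒var , pos⇒free , neg⇒clash)
      (all? λ a → all? λ b → (var P a ≟ var P b →-dec at? (g a) (g b)) ×-dec
        (at? (g a) (g b) →-dec var P a ≟ var P b) ×-dec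
        (pos? a b →-dec ¬? (clash? (g a) (g b))) ×-dec (neg? a b →-dec clash? (g a) (g b)))
      where
      at? : ∀ p q → Dec (at p ≡ at q)
      at? p q = map′ (λ eq → trans (sym (variable-index _)) (trans (cong variable′ eq) (variable-index _)))
                     (cong index) (index (at p) ≟ index (at q))


    private
      pointOf : Value toInstance → Pt
      pointOf (_ , a , _) = point a

      at-pointOf : ∀ v → at (pointOf v) ≡ variable′ (proj₁ v)
      at-pointOf (x , a , a∈) = trans (sym (variable-index _)) (cong variable′ (∈dom⁻ a∈))

    occurs⇒embeds : P occursIn asPattern toInstance → ∃ Embeds
    occurs⇒embeds (f , var⇔ , f⁺ , f⁻) = pointOf ∘ f , record
      { var⇒at = λ {a} {b} eq → trans (at-pointOf (f a))
          (trans (cong variable′ (Equivalence.to (var⇔ a b) eq)) (sym (at-pointOf (f b))))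
      ; at⇒var = λ {a} {b} eq → Equivalence.from (var⇔ a b)
          (trans (sym (index-variable _)) (trans (cong index
            (trans (sym (at-pointOf (f a))) (trans eq (at-pointOf (f b))))) (index-variable _)))
      ; pos⇒free = λ {a} {b} ab → rel⁻ {proj₁ (f a)} {proj₁ (f b)} (proj₁ (edge⇒rel toInstance (f a) (f b) (f⁺ a b ab)) refl)
      ; neg⇒clash = λ {a} {b} ab → decidable-stable (clash? _ _) λ ok →
          case trans (sym (proj₂ (edge⇒rel toInstance (f a) (f b) (f⁻ a b ab)) refl)) (rel⁺ {proj₁ (f a)} {proj₁ (f b)} ok) of λ ()
      }

    abstract
      -- Solvability merely refutes the absence of an occurrence. As there are finitely many maps of
      -- points, a search turns this into an actual one; `abstract` keeps the search from being
      -- evaluated.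
      embedding : SACSolvable P → SACFails → ∃ Embeds
      embedding solvable fails = decidable-stable (any-embedding?) λ none →
        ¬SACDecides fails (solvable toInstance (none ∘ occurs⇒embeds))
        where
        any-embedding? : Dec (∃ Embeds)
        any-embedding? = map′ (λ (f , e) → point ∘ f , e)
          (λ (g , e) → code ∘ g , respects (λ a → sym (point-code (g a))) e)
          (any-function? (λ f → embeds? (point ∘ f)) λ f≗g → respects (λ a → cong point (f≗g a)))
          where
          respects : ∀ {f g} → f ≗ g → Embeds f → Embeds g
          respects f≗g e = record
            { var⇒at = λ {a} {b} eq → subst₂ (λ p q → at p ≡ at q) (f≗g a) (f≗g b) (var⇒at eq)
            ; at⇒var = λ {a} {b} eq → at⇒var (subst₂ (λ p q → at p ≡ at q) (sym (f≗g a)) (sym (f≗g b)) eq)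
            ; pos⇒free = λ {a} {b} ab → subst₂ (λ p q → ¬ Clash p q) (f≗g a) (f≗g b) (pos⇒free ab)
            ; neg⇒clash = λ {a} {b} ab → subst₂ Clash (f≗g a) (f≗g b) (neg⇒clash ab)
            }
            where open Embeds e

  module _ (irreducible : Irreducible P) where

    separated : ∀ {a b} → a ≢ b → var P a ≡ var P b → ∃[ c ] ((Pos a c × Neg b c) ⊎ (Neg a c × Pos b c))
    separated {a} {b} a≢b eq = decidable-stable
      (any? λ c → (pos? a c ×-dec neg? b c) ⊎-dec (neg? a c ×-dec pos? b c))
      λ none → proj₂ irreducible a b (a≢b , eq , none)

    alive : ∀ a → (∀ b → ¬ Neg a b) → ∃₂ λ b c → b ≢ c × Pos a b × Pos a c
    alive a none = decidable-stable
      (any? λ b → any? λ c → ¬? (b ≟ c) ×-dec pos? a b ×-dec pos? a c)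
      λ few → proj₁ irreducible a
        ((λ b c ab ac → decidable-stable (b ≟ c) λ b≢c → few (b , c , b≢c , ab , ac)) ,
         λ (b , ab) → none b ab)

    module _ {N : Network} {g} (e : Embeds N g) where
      open Network N
      open Embeds e

      injective : ∀ {a b} → g a ≡ g b → a ≡ b
      injective {a} {b} eq = decidable-stable (a ≟ b) λ a≢b →
        case separated a≢b (at⇒var (cong at eq)) of λ where
          (c , inj₁ (ac , bc)) → pos⇒free ac (subst (λ p → Clash p (g c)) (sym eq) (neg⇒clash bc))
          (c , inj₂ (ac , bc)) → pos⇒free bc (subst (λ p → Clash p (g c)) eq (neg⇒clash ac))

another : ∀ {n} (a b : Fin (suc (suc (suc n)))) → ∃[ c ] c ≢ a × c ≢ b
another 0F            0F            = 1F , (λ ()) , (λ ())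
another 0F            1F            = 2F , (λ ()) , (λ ())
another 0F            (suc (suc _)) = 1F , (λ ()) , (λ ())
another 1F            0F            = 2F , (λ ()) , (λ ())
another (suc (suc _)) 0F            = 1F , (λ ()) , (λ ())
another (suc _)       (suc _)       = 0F , (λ ()) , (λ ())

-- 3-colouring the complete graph on four vertices

module Colouring where

  colouring : Network
  colouring = record
    { vars = finite 4 ; pts = finite 4 ×ᶠ finite 3
    ; at = proj₁
    ; Clash = λ (x , a) (y , b) → x ≢ y × a ≡ b
    ; clash? = λ (x , a) (y , b) → ¬? (x ≟ y) ×-dec (a ≟ b)
    ; clash-sym = λ (x≢y , a≡b) → x≢y ∘ sym , sym a≡b
    }

  open Network colouring

  -- Colouring one vertex leaves two colours at each of the others, and two colours are enough for
  -- arc consistency of disequality.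
  fails : SACFails
  fails = record
    { origin = 0F , 0F
    ; Keeps = Keeps
    ; keeps-only = λ where
        (inj₁ (refl , refl)) _  → refl
        (inj₂ (x≢x , _))     eq → contradiction eq x≢x
    ; keeps-some = some
    ; keeps-arc = arc
    ; unsolvable = unsolvable
    }
    where
    Keeps : Pt → Pt → Set
    Keeps (x₀ , a₀) (x , a) = (x ≡ x₀ × a ≡ a₀) ⊎ (x ≢ x₀ × a ≢ a₀)
    some : ∀ p y → ∃[ q ] at q ≡ y × Keeps p q
    some (x₀ , a₀) y with y ≟ x₀
    ... | yes refl = (y , a₀) , refl , inj₁ (refl , refl)
    ... | no  y≢x₀ = let (b , b≢a₀ , _) = another a₀ a₀ in (y , b) , refl , inj₂ (y≢x₀ , b≢a₀)
    arc : ∀ {p q} → Keeps p q → ∀ y → at q ≢ y → ∃[ r ] at r ≡ y × Keeps p r × ¬ Clash q r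
    arc {x₀ , a₀} {x , a} kept y x≢y with y ≟ x₀ | kept
    ... | yes refl | inj₁ (x≡x₀ , _)    = contradiction x≡x₀ x≢y
    ... | yes refl | inj₂ (_ , a≢a₀)    = (y , a₀) , refl , inj₁ (refl , refl) , a≢a₀ ∘ proj₂
    ... | no y≢x₀  | _                  =
      let (b , b≢a₀ , b≢a) = another a₀ a in (y , b) , refl , inj₂ (y≢x₀ , b≢a₀) , b≢a ∘ sym ∘ proj₂
    unsolvable : (s : Var → Pt) → (∀ x → at (s x) ≡ x) → ¬ (∀ x y → x ≢ y → ¬ Clash (s x) (s y))
    unsolvable s at-s proper = let (x , y , x<y , eq) = pigeonhole ≤-refl (proj₂ ∘ s) in
      proper x y (<⇒≢ x<y) ((λ at≡ → <⇒≢ x<y (trans (sym (at-s x)) (trans at≡ (at-s y)))) , eq)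

-- Four pigeons choose one of three holes, and every hole chooses a pigeon.

module Pigeons where

  pattern pigeon i j = inj₁ (i , j)
  pattern hole i j = inj₂ (i , j)

  Point : Set
  Point = (Fin 4 × Fin 3) ⊎ (Fin 4 × Fin 3)

  position : Point → Fin 4 ⊎ Fin 3
  position (pigeon i _) = inj₁ i
  position (hole _ j)   = inj₂ j

  Conflict : Point → Point → Set
  Conflict (pigeon i j) (hole i′ j′) = j ≡ j′ × i ≢ i′
  Conflict (hole i′ j′) (pigeon i j) = j ≡ j′ × i ≢ i′
  Conflict (pigeon _ _) (pigeon _ _) = ⊥
  Conflict (hole _ _)   (hole _ _)   = ⊥

  conflict-sym : ∀ p q → Conflict p q → Conflict q p
  conflict-sym (pigeon _ _) (hole _ _)   c = c
  conflict-sym (hole _ _)   (pigeon _ _) c = c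

  pigeons : Network
  pigeons = record
    { vars = finite 4 ⊎ᶠ finite 3 ; pts = finite 4 ×ᶠ finite 3 ⊎ᶠ finite 4 ×ᶠ finite 3
    ; at = position
    ; Clash = Conflict
    ; clash? = λ where
        (pigeon i j) (hole i′ j′) → (j ≟ j′) ×-dec ¬? (i ≟ i′)
        (hole i′ j′) (pigeon i j) → (j ≟ j′) ×-dec ¬? (i ≟ i′)
        (pigeon _ _) (pigeon _ _) → no λ ()
        (hole _ _)   (hole _ _)   → no λ ()
    ; clash-sym = λ {p} {q} → conflict-sym p q
    }

  open Network pigeons

  -- Placing one pigeon withdraws only its hole from the other pigeons, and only that pigeon from
  -- the other holes. Pigeon `i` in hole `j` and hole `j` choosing `i` support each other; with
  -- three holes, a remaining pigeon can avoid both the occupied hole and any given one.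
  fails : SACFails
  fails = record
    { origin = pigeon 0F 0F
    ; Keeps = λ p q → Keeps (pair p) (pair q)
    ; keeps-only = λ {p} {q} → only p q
    ; keeps-some = λ p → some (pair p)
    ; keeps-arc = λ {p} {q} → arc {p} {q}
    ; unsolvable = unsolvable
    }
    where
    pair : Point → Fin 4 × Fin 3
    pair = [ id , id ]′
    Keeps : Fin 4 × Fin 3 → Fin 4 × Fin 3 → Set
    Keeps (i₀ , j₀) (i , j) = (i ≡ i₀ × j ≡ j₀) ⊎ (i ≢ i₀ × j ≢ j₀)
    only : ∀ p q → Keeps (pair p) (pair q) → at q ≡ at p → q ≡ p
    only (pigeon _ _) (pigeon _ _) (inj₁ (refl , refl)) _    = refl
    only (pigeon _ _) (pigeon _ _) (inj₂ (i≢i , _))     refl = contradiction refl i≢i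
    only (hole _ _)   (hole _ _)   (inj₁ (refl , refl)) _    = refl
    only (hole _ _)   (hole _ _)   (inj₂ (_ , j≢j))     refl = contradiction refl j≢j
    some : ∀ p y → ∃[ q ] at q ≡ y × Keeps p (pair q)
    some (i₀ , j₀) (inj₁ i) with i ≟ i₀
    ... | yes refl = pigeon i j₀ , refl , inj₁ (refl , refl)
    ... | no  i≢i₀ = let (j , j≢j₀ , _) = another j₀ j₀ in pigeon i j , refl , inj₂ (i≢i₀ , j≢j₀)
    some (i₀ , j₀) (inj₂ j) with j ≟ j₀
    ... | yes refl = hole i₀ j , refl , inj₁ (refl , refl)
    ... | no  j≢j₀ = let (i , i≢i₀ , _) = another i₀ i₀ in hole i j , refl , inj₂ (i≢i₀ , j≢j₀)
    arc : ∀ {p q} → Keeps (pair p) (pair q) → ∀ y → at q ≢ y →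
      ∃[ r ] at r ≡ y × Keeps (pair p) (pair r) × ¬ Clash q r
    arc {p} {pigeon i j} kept (inj₂ j′) _ with j ≟ j′
    ... | yes refl = hole i j , refl , kept , λ (_ , i≢i) → i≢i refl
    ... | no  j≢j′ with some (pair p) (inj₂ j′)
    ...   | hole i′ _ , refl , kept′ = hole i′ j′ , refl , kept′ , j≢j′ ∘ proj₁
    arc {p} {hole i j} kept (inj₁ i′) _ with i ≟ i′
    ... | yes refl = pigeon i j , refl , kept , λ (_ , i≢i) → i≢i refl
    ... | no  i≢i′ with i′ ≟ proj₁ (pair p) | kept
    ...   | yes refl | inj₁ (i≡i₀ , _)  = contradiction i≡i₀ i≢i′
    ...   | yes refl | inj₂ (_ , j≢j₀)  = pigeon i′ (proj₂ (pair p)) , refl , inj₁ (refl , refl) , j≢j₀ ∘ sym ∘ proj₁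
    ...   | no  i′≢i₀ | _               = let (j′ , j′≢j₀ , j′≢j) = another (proj₂ (pair p)) j in
                                            pigeon i′ j′ , refl , inj₂ (i′≢i₀ , j′≢j₀) , j′≢j ∘ proj₁
    arc {p} {pigeon i j} kept (inj₁ i′) _ with some (pair p) (inj₁ i′)
    ... | pigeon _ j′ , refl , kept′ = pigeon i′ j′ , refl , kept′ , λ ()
    arc {p} {hole i j} kept (inj₂ j′) _ with some (pair p) (inj₂ j′)
    ... | hole i′ _ , refl , kept′ = hole i′ j′ , refl , kept′ , λ ()
    unsolvable : (s : Var → Pt) → (∀ x → at (s x) ≡ x) → ¬ (∀ x y → x ≢ y → ¬ Clash (s x) (s y))
    unsolvable s at-s ok =
      let (i , i′ , i<i′ , eq) = pigeonhole {3} {4} ≤-refl (proj₁ ∘ choice)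
          (h , at-j) = chosen (proj₁ (choice i))
      in <⇒≢ i<i′ (trans (agrees i at-j refl) (sym (agrees i′ at-j (sym eq))))
      where
      choice : ∀ i → ∃[ j ] s (inj₁ i) ≡ pigeon i j
      choice i with s (inj₁ i) | at-s (inj₁ i)
      ... | pigeon _ j | refl = j , refl
      chosen : ∀ j → ∃[ i ] s (inj₂ j) ≡ hole i j
      chosen j with s (inj₂ j) | at-s (inj₂ j)
      ... | hole i _ | refl = i , refl
      agrees : ∀ i {j h} → s (inj₂ j) ≡ hole h j → proj₁ (choice i) ≡ j → i ≡ h
      agrees i {j} {h} at-j eq = decidable-stable (i ≟ h) λ i≢h → ok (inj₁ i) (inj₂ j) (λ ())
        (subst₂ Conflict (sym (proj₂ (choice i))) (sym at-j) (eq , i≢h))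

  module _ {m k} {P : Pattern (Fin m) (Fin k)} {g} (e : Embeds P pigeons g) where
    open Embeds e

    -- The value of a pigeon conflicts with a single hole, so `b` lies at a hole, and `a` and `c`
    -- are two different pigeons in that hole. A value `B` of the hole compatible with both would
    -- have to choose both.
    no-V : ∀ {a b c B} → Neg P b a → Neg P b c → var P a ≢ var P c → var P B ≡ var P b →
      Pos P B a → Pos P B c → ⊥
    no-V {a} {b} {c} {B} ba bc a≁c B~b Ba Bc =
      go (g a) (g b) (g c) (g B) (neg⇒clash ba) (neg⇒clash bc) (a≁c ∘ at⇒var) (var⇒at B~b) (pos⇒free Ba) (pos⇒free Bc)
      where
      go : ∀ a b c B → Conflict b a → Conflict b c → at a ≢ at c → at B ≡ at b →
        ¬ Conflict B a → ¬ Conflict B c → ⊥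
      go (hole _ j) (pigeon _ _) (hole _ j′) _ (refl , _) (refl , _) j≢j′ _ _ _ = j≢j′ refl
      go (pigeon i j) (hole _ _) (pigeon i′ j′) (hole h _) (refl , _) (refl , _) i≢i′ refl ok ok′ =
        i≢i′ (cong inj₁ (trans (stays i ok) (sym (stays i′ ok′))))
        where
        stays : ∀ i → ¬ (j ≡ j × i ≢ h) → i ≡ h
        stays i ok = decidable-stable (i ≟ h) λ i≢h → ok (refl , i≢h)

-- Subdivided instances

flip : Fin 2 → Fin 2
flip 0F = 1F
flip 1F = 0F

flip-flip : ∀ b → flip (flip b) ≡ b
flip-flip 0F = refl
flip-flip 1F = refl

≢⇒flip : ∀ {b c} → b ≢ c → c ≡ flip b
≢⇒flip {0F} {0F} 0≢0 = contradiction refl 0≢0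
≢⇒flip {0F} {1F} _   = refl
≢⇒flip {1F} {0F} _   = refl
≢⇒flip {1F} {1F} 1≢1 = contradiction refl 1≢1

flip≢ : ∀ b → flip b ≢ b
flip≢ 0F ()
flip≢ 1F ()

-- A network whose clashes are indexed by a finite type E, the clash e being
-- between the points end e 0F and end e 1F.
record Graph : Set₁ where
  field
    {Var Pt E}  : Set
    {n d l}     : ℕ
    vars        : Fin n ↔ Var
    pts         : Fin d ↔ Pt
    edges       : Fin l ↔ E
    _≟ₚ_        : DecidableEquality Pt
    at          : Pt → Var
    end         : E → Fin 2 → Pt
    ends-apart  : ∀ e b → at (end e (flip b)) ≢ at (end e b)
    origin      : Pt
    Keeps       : Pt → Pt → Set
    keeps-only  : ∀ {p q} → Keeps p q → at q ≡ at p → q ≡ p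
    keeps-some  : ∀ p y → ∃[ q ] at q ≡ y × Keeps p q
    keeps-arc   : ∀ {p} e b → Keeps p (end e b) →
      ∃[ r ] at r ≡ at (end e (flip b)) × Keeps p r × r ≢ end e (flip b)
    unsolvable  : (s : Var → Pt) → (∀ x → at (s x) ≡ x) →
      ¬ (∀ e → ¬ (∀ b → s (at (end e b)) ≡ end e b))
    simple      : ∀ {e e′ b b′} → at (end e b) ≡ at (end e′ b′) →
      at (end e (flip b)) ≡ at (end e′ (flip b′)) → e ≡ e′
    degree      : ∀ {e₁ e₂ e₃ b₁ b₂ b₃} → end e₁ b₁ ≡ end e₂ b₂ → end e₁ b₁ ≡ end e₃ b₃ →
      e₁ ≢ e₂ → e₁ ≢ e₃ → e₂ ≢ e₃ → ⊥
    small       : ∀ {e e′ b b′ q r} → end e b ≡ end e′ b′ → e ≢ e′ →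
      at q ≡ at (end e b) → at r ≡ at (end e b) → q ≢ end e b → r ≢ end e b → q ≢ r → ⊥

-- The clash e becomes a two-valued variable, whose value b clashes with end e b only.
module Subdivision (G : Graph) where
  open Graph G renaming (Var to Var₀; Pt to Pt₀; at to at₀; Keeps to Keeps₀; keeps-only to keeps-only₀;
    keeps-some to keeps-some₀; keeps-arc to keeps-arc₀; unsolvable to unsolvable₀; origin to origin₀)

  pattern base p = inj₁ p
  pattern sub e b = inj₂ (e , b)

  Point : Set
  Point = Pt₀ ⊎ (E × Fin 2)

  position : Point → Var₀ ⊎ E
  position (base p)  = inj₁ (at₀ p)
  position (sub e _) = inj₂ e

  Conflict : Point → Point → Set
  Conflict (base p)  (sub e b) = p ≡ end e b
  Conflict (sub e b) (base p)  = p ≡ end e b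
  Conflict (base _)  (base _)  = ⊥
  Conflict (sub _ _) (sub _ _) = ⊥

  conflict-sym : ∀ p q → Conflict p q → Conflict q p
  conflict-sym (base _)  (sub _ _) c = c
  conflict-sym (sub _ _) (base _)  c = c

  subdivision : Network
  subdivision = record
    { vars = vars ⊎ᶠ edges
    ; pts = pts ⊎ᶠ edges ×ᶠ finite 2
    ; at = position
    ; Clash = Conflict
    ; clash? = λ where
        (base p)  (sub e b) → p ≟ₚ end e b
        (sub e b) (base p)  → p ≟ₚ end e b
        (base _)  (base _)  → no λ ()
        (sub _ _) (sub _ _) → no λ ()
    ; clash-sym = λ {p} {q} → conflict-sym p q
    }

  open Network subdivision using (Var; Pt; at; Clash; SACFails)

  fails : SACFails
  fails = record
    { origin = base origin₀
    ; Keeps = λ p → Keeps (source p)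
    ; keeps-only = λ {p} {q} → only p q
    ; keeps-some = λ p → some (source p)
    ; keeps-arc = λ {p} {q} kept y q≁y → arc q kept y q≁y
    ; unsolvable = unsolvable
    }
    where
    -- Choosing the value b of e amounts to choosing the other end of e.
    source : Point → Pt₀
    source (base p)  = p
    source (sub e b) = end e (flip b)

    Keeps : Pt₀ → Point → Set
    Keeps p (base q)  = Keeps₀ p q
    Keeps p (sub e b) = ∃[ q ] at₀ q ≡ at₀ (end e b) × Keeps₀ p q × q ≢ end e b

    only : ∀ p q → Keeps (source p) q → at q ≡ at p → q ≡ p
    only (base p)  (base q)   kept at≡ = cong base (keeps-only₀ kept (inj₁-injective at≡))
    only (sub e b) (sub .e c) (q , at≡ , kept , q≢) refl = cong (sub e) (decidable-stable (c ≟ b) λ c≢b →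
      -- If `c` differed from `b`, then `end e c` would be the source itself, the only value kept at
      -- its variable, whereas `q` is a different kept value there.
      let b≡ = trans (cong flip (≢⇒flip c≢b)) (flip-flip c) in
      q≢ (trans (keeps-only₀ kept (trans at≡ (cong (at₀ ∘ end e) (sym b≡)))) (cong (end e) b≡)))

    some : ∀ p y → ∃[ q ] at q ≡ y × Keeps p q
    some p (inj₁ y) = let (q , at≡ , kept) = keeps-some₀ p y in base q , cong inj₁ at≡ , kept
    some p (inj₂ e) with keeps-some₀ p (at₀ (end e 0F))
    ... | q , at≡ , kept with q ≟ₚ end e 0F
    ...   | no  q≢   = sub e 0F , refl , q , at≡ , kept , q≢
    ...   | yes refl = sub e 1F , refl , keeps-arc₀ e 0F kept

    arc : ∀ {p} q → Keeps p q → ∀ y → at q ≢ y → ∃[ r ] at r ≡ y × Keeps p r × ¬ Clash q r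
    arc {p} (base q) kept (inj₁ y) _ with some p (inj₁ y)
    ... | base r , at≡ , kept′ = base r , at≡ , kept′ , λ ()
    arc {p} (base q) kept (inj₂ e) _ with q ≟ₚ end e 0F | q ≟ₚ end e 1F
    ... | yes refl | _        = sub e 1F , refl , keeps-arc₀ e 0F kept , λ eq → ends-apart e 0F (cong at₀ (sym eq))
    ... | no _     | yes refl = sub e 0F , refl , keeps-arc₀ e 1F kept , λ eq → ends-apart e 1F (cong at₀ (sym eq))
    ... | no q≢0   | no q≢1   with some p (inj₂ e)
    ...   | sub .e 0F , refl , kept′ = sub e 0F , refl , kept′ , q≢0
    ...   | sub .e 1F , refl , kept′ = sub e 1F , refl , kept′ , q≢1
    arc {p} (sub e b) (q , at≡ , kept , q≢) (inj₁ y) _ with keeps-some₀ p y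
    ... | r , refl , kept′ with r ≟ₚ end e b
    ...   | no  r≢   = base r , refl , kept′ , r≢
    ...   | yes refl = base q , cong inj₁ at≡ , kept , q≢
    arc {p} (sub e b) kept (inj₂ e′) _ with some p (inj₂ e′)
    ... | sub .e′ c , refl , kept′ = sub e′ c , refl , kept′ , λ ()

    unsolvable : (s : Var → Pt) → (∀ x → at (s x) ≡ x) → ¬ (∀ x y → x ≢ y → ¬ Clash (s x) (s y))
    unsolvable s at-s ok = unsolvable₀ (proj₁ ∘ chosen) at-chosen λ e both →
      let (b , eq) = middle e in ok (inj₁ (at₀ (end e b))) (inj₂ e) (λ ())
        (subst₂ Conflict (sym (proj₂ (chosen _))) (sym eq) (both b))
      where
      chosen : ∀ x → ∃[ p ] s (inj₁ x) ≡ base p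
      chosen x with s (inj₁ x) | at-s (inj₁ x)
      ... | base p | refl = p , refl
      middle : ∀ e → ∃[ b ] s (inj₂ e) ≡ sub e b
      middle e with s (inj₂ e) | at-s (inj₂ e)
      ... | sub _ b | refl = b , refl
      at-chosen : ∀ x → at₀ (proj₁ (chosen x)) ≡ x
      at-chosen x = inj₁-injective (trans (cong position (sym (proj₂ (chosen x)))) (at-s (inj₁ x)))

  module _ {m k} {P : Pattern (Fin m) (Fin k)} (irr : Irreducible P) {g} (emb : Embeds P subdivision g) where
    open Embeds emb

    _~_ : Fin k → Fin k → Set
    a ~ b = var P a ≡ var P b

    private
      -- The ends of a clash lie at different variables, so the variables of `e` and of `end e b`
      -- share just one conflicting pair.
      conflict-unique : ∀ {p p′ q q′} → Conflict p q → Conflict p′ q′ → position p ≡ position p′ →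
        position q ≡ position q′ → p ≡ p′
      conflict-unique {base _} {base _} {sub e b} {sub .e b′} refl refl at≡ refl =
        cong (base ∘ end e) (decidable-stable (b ≟ b′) λ b≢b′ →
          ends-apart e b (trans (cong (at₀ ∘ end e) (sym (≢⇒flip b≢b′))) (sym (inj₁-injective at≡))))
      conflict-unique {sub e b} {sub .e b′} {base _} {base _} refl refl refl at≡ =
        cong (sub e) (decidable-stable (b ≟ b′) λ b≢b′ →
          ends-apart e b (trans (cong (at₀ ∘ end e) (sym (≢⇒flip b≢b′))) (sym (inj₁-injective at≡))))

    neg-unique : ∀ {a b a′ b′} → Neg P a b → Neg P a′ b′ → a ~ a′ → b ~ b′ → a ≡ a′
    neg-unique ab a′b′ a~a′ b~b′ = injective P irr emb
      (conflict-unique (neg⇒clash ab) (neg⇒clash a′b′) (var⇒at a~a′) (var⇒at b~b′))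

    -- Conflicts join base variables to clash variables only, so the constraint graph is bipartite.
    no-triangle : ∀ {a b b′ c c′ a′} → Neg P a b → Neg P b′ c → Neg P c′ a′ → b ~ b′ → c ~ c′ → a′ ~ a → ⊥
    no-triangle {a} {b} {b′} {c} {c′} {a′} ab bc ca b~ c~ a~ =
      go (g a) (g b) (g b′) (g c) (g c′) (g a′) (neg⇒clash ab) (neg⇒clash bc) (neg⇒clash ca)
         (var⇒at b~) (var⇒at c~) (var⇒at a~)
      where
      go : ∀ a b b′ c c′ a′ → Conflict a b → Conflict b′ c → Conflict c′ a′ → at b ≡ at b′ → at c ≡ at c′ → at a′ ≡ at a → ⊥
      go (base _)  (sub _ _) (sub _ _) (base _)  (base _)  (sub _ _) _ _ _ _ _ ()
      go (sub _ _) (base _)  (base _)  (sub _ _) (sub _ _) (base _)  _ _ _ _ _ ()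

    -- A subdivided vertex clashes with one point per value.
    no-path : ∀ {a b c d} → Neg P a b → Neg P b c → Neg P c d → a ≢ c → b ≢ d → ⊥
    no-path {a} {b} {c} {d} ab bc cd a≢c b≢d =
      go (g a) (g b) (g c) (g d) (neg⇒clash ab) (neg⇒clash bc) (neg⇒clash cd) (a≢c ∘ injective P irr emb) (b≢d ∘ injective P irr emb)
      where
      go : ∀ a b c d → Conflict a b → Conflict b c → Conflict c d → a ≢ c → b ≢ d → ⊥
      go (base _) (sub _ _) (base _) _ refl refl _ a≢c _ = a≢c refl
      go _ (base _) (sub _ _) (base _) _ refl refl _ b≢d = b≢d refl

    private
      -- A 4-cycle alternates between two base variables and two clashes that both join them, and
      -- `simple` identifies the clashes. The flips arise because the cycle enters and leaves a
      -- clash variable by different values.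
      no-square′ : ∀ a b b′ c c′ d d′ a′ → Conflict a b → Conflict b′ c → Conflict c′ d → Conflict d′ a′ →
        at b ≡ at b′ → at c ≡ at c′ → at d ≡ at d′ → at a′ ≡ at a → at a ≢ at c → at b ≢ at d → ⊥
      no-square′ (base _) (sub e b₁) (sub .e b₂) (base _) (base _) (sub e′ b₃) (sub .e′ b₄) (base _)
        refl refl refl refl refl c~ refl a~ a≁c b≁d =
        b≁d (cong inj₂ (simple {e} {e′} {b₁} {b₄} (sym (inj₁-injective a~))
          (subst₂ (λ i j → at₀ (end e i) ≡ at₀ (end e′ j)) b₂≡ b₃≡ (inj₁-injective c~))))
        where
        b₂≡ : b₂ ≡ flip b₁
        b₂≡ = ≢⇒flip λ eq → a≁c (cong (inj₁ ∘ at₀ ∘ end e) eq)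
        b₃≡ : b₃ ≡ flip b₄
        b₃≡ = ≢⇒flip λ eq → a≁c (trans (sym a~) (trans (cong (inj₁ ∘ at₀ ∘ end e′) eq) (sym c~)))
      no-square′ (sub e₁ i₁) (base q) (base q′) (sub e₂ i₂) (sub .e₂ i₃) (base r) (base r′) (sub .e₁ i₄)
        refl refl refl refl b~ refl d~ refl a≁c b≁d =
        a≁c (cong inj₂ (simple {e₁} {e₂} {i₁} {i₂} (inj₁-injective b~)
          (subst₂ (λ i j → at₀ (end e₁ i) ≡ at₀ (end e₂ j)) i₄≡ i₃≡ (sym (inj₁-injective d~)))))
        where
        i₄≡ : i₄ ≡ flip i₁
        i₄≡ = ≢⇒flip λ eq → b≁d (trans (cong (inj₁ ∘ at₀ ∘ end e₁) eq) (sym d~))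
        i₃≡ : i₃ ≡ flip i₂
        i₃≡ = ≢⇒flip λ eq → b≁d (trans b~ (cong (inj₁ ∘ at₀ ∘ end e₂) eq))

    no-square : ∀ {a b b′ c c′ d d′ a′} → Neg P a b → Neg P b′ c → Neg P c′ d → Neg P d′ a′ →
      b ~ b′ → c ~ c′ → d ~ d′ → a′ ~ a → ¬ a ~ c → ¬ b ~ d → ⊥
    no-square ab bc cd da b~ c~ d~ a~ a≁c b≁d = no-square′ _ _ _ _ _ _ _ _
      (neg⇒clash ab) (neg⇒clash bc) (neg⇒clash cd) (neg⇒clash da)
      (var⇒at b~) (var⇒at c~) (var⇒at d~) (var⇒at a~) (a≁c ∘ at⇒var) (b≁d ∘ at⇒var)

    private
      two : (a b c : Fin 2) → a ≢ b → a ≢ c → b ≢ c → ⊥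
      two a b c a≢b a≢c b≢c = b≢c (trans (≢⇒flip a≢b) (sym (≢⇒flip a≢c)))

      end-of : ∀ {a b p} → Neg P a b → g a ≡ base p → ∃₂ λ e i → g b ≡ sub e i × p ≡ end e i
      end-of {a} {b} ab eq with g a | g b | neg⇒clash ab
      end-of _ refl | base _ | sub e i | c = e , i , refl , c

    -- `sub e i` conflicts with nothing but `end e i`.
    branch : ∀ {a b c} → Neg P b a → Neg P b c → a ≢ c → ∃[ p ] g b ≡ base p
    branch {a} {b} {c} ba bc a≢c with g b | g a in eqa | g c in eqc | neg⇒clash ba | neg⇒clash bc
    ... | base p  | _      | _      | _    | _    = p , refl
    ... | sub e i | base _ | base _ | refl | refl = contradiction (injective P irr emb (trans eqa (sym eqc))) a≢c

    -- Having two negative neighbours, `b` goes to a base point, so `a` goes to a value of a clash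
    -- variable. That variable has two values, too few for `a`, `x` and `y`.
    branch-neighbour : ∀ {a b c x y} → Neg P b a → Neg P b c → a ≢ c →
      a ~ x → a ~ y → a ≢ x → a ≢ y → x ≢ y → ⊥
    branch-neighbour {a} {b} {c} {x} {y} ba bc a≢c a~x a~y a≢x a≢y x≢y
      with branch ba bc a≢c
    ... | p , eq with end-of ba eq
    ...   | e , i , eqa , _
      with g x in eqx | g y in eqy | trans (sym (var⇒at a~x)) (cong position eqa) | trans (sym (var⇒at a~y)) (cong position eqa)
    ...     | sub _ j | sub _ l | refl | refl = two i j l
              (λ { refl → a≢x (injective P irr emb (trans eqa (sym eqx))) })
              (λ { refl → a≢y (injective P irr emb (trans eqa (sym eqy))) })
              (λ { refl → x≢y (injective P irr emb (trans eqx (sym eqy))) })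

    -- The image of `u` would be a base point at the end of three different clashes, against
    -- `degree`.
    no-star : ∀ {u a b c} → Neg P u a → Neg P u b → Neg P u c → ¬ a ~ b → ¬ a ~ c → ¬ b ~ c → ⊥
    no-star ua ub uc a≁b a≁c b≁c with branch ua ub (a≁b ∘ cong (var P))
    ... | p , eq with end-of ua eq | end-of ub eq | end-of uc eq
    ...   | e₁ , _ , eqa , end₁ | e₂ , _ , eqb , end₂ | e₃ , _ , eqc , end₃ =
      degree (trans (sym end₁) end₂) (trans (sym end₁) end₃) (apart eqa eqb a≁b) (apart eqa eqc a≁c) (apart eqb eqc b≁c)
      where
      apart : ∀ {a b e e′ i j} → g a ≡ sub e i → g b ≡ sub e′ j → ¬ a ~ b → e ≢ e′
      apart eqa eqb a≁b refl = a≁b (at⇒var (trans (cong position eqa) (cong position (sym eqb))))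

    -- The image of `u` is an end of two different clashes, so `small` applies to its variable.
    branch-small : ∀ {u a b x y} → Neg P u a → Neg P u b → ¬ a ~ b →
      u ~ x → u ~ y → u ≢ x → u ≢ y → x ≢ y → ⊥
    branch-small {u} {a} {b} {x} {y} ua ub a≁b u~x u~y u≢x u≢y x≢y with branch ua ub (a≁b ∘ cong (var P))
    ... | p , eq with end-of ua eq | end-of ub eq
    ...   | e₁ , _ , eqa , refl | e₂ , _ , eqb , end₂
      with g x in eqx | g y in eqy | trans (sym (var⇒at u~x)) (cong position eq) | trans (sym (var⇒at u~y)) (cong position eq)
    ...     | base q | base r | at-q | at-r = small end₂
              (λ { refl → a≁b (at⇒var (trans (cong position eqa) (cong position (sym eqb)))) })
              (inj₁-injective at-q) (inj₁-injective at-r)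
              (λ { refl → u≢x (injective P irr emb (trans eq (sym eqx))) })
              (λ { refl → u≢y (injective P irr emb (trans eq (sym eqy))) })
              (λ { refl → x≢y (injective P irr emb (trans eqx (sym eqy))) })

-- The eight clauses on three variables; literal v s is the copy of the variable v
-- used by the clause s, and the copies of v imply each other cyclically.

module Clauses where

  pattern choose s v = inj₁ (s , v)
  pattern literal v s b = inj₂ ((v , s) , b)
  pattern occurrence s v = inj₁ (s , v)
  pattern implication v s = inj₂ (v , s)

  Variable Point Edge : Set
  Variable = Fin 8 ⊎ (Fin 3 × Fin 8)
  Point    = (Fin 8 × Fin 3) ⊎ ((Fin 3 × Fin 8) × Fin 2)
  Edge     = (Fin 8 × Fin 3) ⊎ (Fin 3 × Fin 8)

  position : Point → Variable
  position (choose s _)    = inj₁ s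
  position (literal v s _) = inj₂ (v , s)

  -- The binary digits of the clause number, so that every sign vector belongs to exactly one
  -- clause.
  sign : Fin 8 → Fin 3 → Fin 2
  sign = finToFun

  next : Fin 8 → Fin 8
  next = lookup (1F ∷ 2F ∷ 3F ∷ 4F ∷ 5F ∷ 6F ∷ 7F ∷ 0F ∷ [])

  next-injective : ∀ s t → next s ≡ next t → s ≡ t
  next-injective = from-yes (all? λ s → all? λ t → (next s ≟ next t) →-dec (s ≟ t))

  next≢ : ∀ s → next s ≢ s
  next≢ = from-yes (all? λ s → ¬? (next s ≟ s))

  next-next≢ : ∀ s → next (next s) ≢ s
  next-next≢ = from-yes (all? λ s → ¬? (next (next s) ≟ s))

  steps : ℕ → Fin 8 → Fin 8
  steps zero    s = s
  steps (suc j) s = next (steps j s)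

  reach : ∀ s t → ∃[ j ] steps (toℕ {8} j) s ≡ t
  reach = from-yes (all? λ s → all? λ t → any? λ j → steps (toℕ {8} j) s ≟ t)

  end : Edge → Fin 2 → Point
  end (occurrence s v)  0F = choose s v
  end (occurrence s v)  1F = literal v s (flip (sign s v))
  end (implication v s) 0F = literal v s 1F
  end (implication v s) 1F = literal v (next s) 0F

  -- The only doubtful case is that of two implications running in opposite directions between the
  -- same copies; it would give the cycle of the eight copies length two.
  simple : ∀ {e e′ b b′} → position (end e b) ≡ position (end e′ b′) →
    position (end e (flip b)) ≡ position (end e′ (flip b′)) → e ≡ e′
  simple {occurrence _ _}  {occurrence _ _}  {0F} {0F} refl refl = refl
  simple {occurrence _ _}  {occurrence _ _}  {1F} {1F} refl refl = refl
  simple {implication v s} {implication _ t} {0F} {0F} refl _    = refl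
  simple {implication v s} {implication _ t} {1F} {1F} _    refl = refl
  simple {implication v s} {implication _ t} {0F} {1F} refl eq   = contradiction (cong proj₂ (inj₂-injective eq)) (next-next≢ t)
  simple {implication v s} {implication _ t} {1F} {0F} refl eq   = contradiction (cong proj₂ (inj₂-injective (sym eq))) (next-next≢ s)
  simple {occurrence _ _}  {occurrence _ _}  {0F} {1F} ()
  simple {occurrence _ _}  {occurrence _ _}  {1F} {0F} ()
  simple {occurrence _ _}  {implication _ _} {0F} {0F} ()
  simple {occurrence _ _}  {implication _ _} {0F} {1F} ()
  simple {occurrence _ _}  {implication _ _} {1F} {0F} _ ()
  simple {occurrence _ _}  {implication _ _} {1F} {1F} _ ()
  simple {implication _ _} {occurrence _ _}  {0F} {0F} ()
  simple {implication _ _} {occurrence _ _}  {1F} {0F} ()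
  simple {implication _ _} {occurrence _ _}  {0F} {1F} _ ()
  simple {implication _ _} {occurrence _ _}  {1F} {1F} _ ()

  private
    occurrence-unique : ∀ {s v s′ v′ b b′} → end (occurrence s v) b ≡ end (occurrence s′ v′) b′ →
      (s , v) ≡ (s′ , v′)
    occurrence-unique {b = 0F} {0F} refl = refl
    occurrence-unique {b = 0F} {1F} ()
    occurrence-unique {b = 1F} {0F} ()
    occurrence-unique {b = 1F} {1F} eq with refl ← cong proj₁ (inj₂-injective eq) = refl

    implication-unique : ∀ {v s v′ s′ b b′} → end (implication v s) b ≡ end (implication v′ s′) b′ →
      (v , s) ≡ (v′ , s′)
    implication-unique {b = 0F} {0F} refl = refl
    implication-unique {v} {s} {v′} {s′} {b = 1F} {1F} eq = cong₂ _,_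
      (cong (proj₁ ∘ proj₁) (inj₂-injective eq)) (next-injective s s′ (cong (proj₂ ∘ proj₁) (inj₂-injective eq)))
    implication-unique {b = 0F} {1F} ()
    implication-unique {b = 1F} {0F} ()

  -- A point is an end of at most one occurrence and one implication. This is what the separate
  -- copies for each clause achieve.
  degree : ∀ {e₁ e₂ e₃ b₁ b₂ b₃} → end e₁ b₁ ≡ end e₂ b₂ → end e₁ b₁ ≡ end e₃ b₃ →
    e₁ ≢ e₂ → e₁ ≢ e₃ → e₂ ≢ e₃ → ⊥
  degree {inj₁ _} {inj₁ _} p q n _ _ = n (cong inj₁ (occurrence-unique p))
  degree {inj₂ _} {inj₂ _} p q n _ _ = n (cong inj₂ (implication-unique p))
  degree {inj₁ _} {inj₂ _} {inj₁ _} p q _ n _ = n (cong inj₁ (occurrence-unique q))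
  degree {inj₁ _} {inj₂ _} {inj₂ _} p q _ _ n = n (cong inj₂ (implication-unique (trans (sym p) q)))
  degree {inj₂ _} {inj₁ _} {inj₁ _} p q _ _ n = n (cong inj₁ (occurrence-unique (trans (sym p) q)))
  degree {inj₂ _} {inj₁ _} {inj₂ _} p q _ n _ = n (cong inj₂ (implication-unique q))

  -- A choice of a clause is an end of its own occurrence only, so a point on two clashes is a
  -- literal, and its variable is two-valued.
  small : ∀ {e e′ b b′ q r} → end e b ≡ end e′ b′ → e ≢ e′ →
    position q ≡ position (end e b) → position r ≡ position (end e b) →
    q ≢ end e b → r ≢ end e b → q ≢ r → ⊥
  small {e} {e′} {b} {b′} {q} {r} eq e≢e′ at-q at-r q≢ r≢ q≢r with end e b in eqₑ
  ... | literal v s i with q | r | at-q | at-r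
  ...   | literal _ _ j | literal _ _ l | refl | refl = q≢r (cong (literal v s)
            (trans (≢⇒flip {i} {j} λ { refl → q≢ refl }) (sym (≢⇒flip {i} {l} λ { refl → r≢ refl }))))
  small {e} {e′} {b} {b′} {q} {r} eq e≢e′ at-q at-r q≢ r≢ q≢r | choose s v =
    e≢e′ (trans (only-occurrence e b eqₑ) (sym (only-occurrence e′ b′ (sym eq))))
    where
    only-occurrence : ∀ e b → end e b ≡ choose s v → e ≡ occurrence s v
    only-occurrence (occurrence _ _)  0F refl = refl
    only-occurrence (occurrence _ _)  1F ()
    only-occurrence (implication _ _) 0F ()
    only-occurrence (implication _ _) 1F ()

  graph : Graph
  graph = record
    { vars = finite 8 ⊎ᶠ finite 3 ×ᶠ finite 8
    ; pts = finite 8 ×ᶠ finite 3 ⊎ᶠ (finite 3 ×ᶠ finite 8) ×ᶠ finite 2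
    ; edges = finite 8 ×ᶠ finite 3 ⊎ᶠ finite 3 ×ᶠ finite 8
    ; _≟ₚ_ = ⊎-≡-dec (×-≡-dec _≟_ _≟_) (×-≡-dec (×-≡-dec _≟_ _≟_) _≟_)
    ; at = position
    ; end = end
    ; ends-apart = λ where
        (occurrence s v) 0F ()
        (occurrence s v) 1F ()
        (implication v s) 0F eq → next≢ s (cong proj₂ (inj₂-injective eq))
        (implication v s) 1F eq → next≢ s (cong proj₂ (inj₂-injective (sym eq)))
    ; origin = choose 0F 0F
    ; Keeps = Keeps
    ; keeps-only = λ {p} {q} → only p q
    ; keeps-some = some
    ; keeps-arc = λ {p} → arc p
    ; unsolvable = unsolvable
    ; simple = λ {e} {e′} {b} {b′} → simple {e} {e′} {b} {b′}
    ; degree = λ {e₁} {e₂} {e₃} {b₁} {b₂} {b₃} → degree {e₁} {e₂} {e₃} {b₁} {b₂} {b₃}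
    ; small = λ {e} {e′} {b} {b′} → small {e} {e′} {b} {b′}
    }
    where
    fixed : Point → Fin 3
    fixed (choose _ v)    = v
    fixed (literal v _ _) = v

    value : Point → Fin 2
    value (choose s v)    = sign s v
    value (literal _ _ b) = b

    Committed : Point → Fin 8 → Set
    Committed (choose s₀ _)    s = s ≡ s₀
    Committed (literal _ _ _)  s = ⊥

    committed? : ∀ p s → Dec (Committed p s)
    committed? (choose s₀ _)   s = s ≟ s₀
    committed? (literal _ _ _) s = no λ ()

    committed-sign : ∀ p {s} → Committed p s → sign s (fixed p) ≡ value p
    committed-sign (choose _ _) refl = refl

    -- Assigning `p` fixes one propositional variable in all its copies and leaves the others free.
    -- A clause may still choose the fixed variable only if its sign there agrees, and the clause of
    -- `p`, if `p` is a choice, can choose nothing else.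
    Keeps : Point → Point → Set
    Keeps p (choose s v)    = (v ≡ fixed p → sign s v ≡ value p) × (Committed p s → v ≡ fixed p)
    Keeps p (literal v s b) = v ≡ fixed p → b ≡ value p

    only : ∀ p q → Keeps p q → position q ≡ position p → q ≡ p
    only (choose s v)    (choose .s _)      (_ , kept) refl = cong (choose s) (kept refl)
    only (literal v s b) (literal .v .s _)  kept       refl = cong (literal v s) (kept refl)

    some : ∀ p y → ∃[ q ] position q ≡ y × Keeps p q
    some p (inj₂ (v , s)) = literal v s (value p) , refl , λ _ → refl
    some p (inj₁ s) with committed? p s
    ... | yes c = choose s (fixed p) , refl , (λ _ → committed-sign p c) , λ _ → refl
    ... | no ¬c = let (v , v≢ , _) = another (fixed p) (fixed p) in
      choose s v , refl , (λ eq → contradiction eq v≢) , λ c → contradiction c ¬c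

    arc : ∀ p e b → Keeps p (end e b) →
      ∃[ r ] position r ≡ position (end e (flip b)) × Keeps p r × r ≢ end e (flip b)
    arc p (occurrence s v) 0F (kept , _) = literal v s (sign s v) , refl , kept , λ eq →
      flip≢ _ (sym (cong proj₂ (inj₂-injective eq)))
    arc p (occurrence s v) 1F kept with v ≟ fixed p | committed? p s
    ... | yes refl | yes c = contradiction (trans (kept refl) (sym (committed-sign p c))) (flip≢ _)
    ... | yes refl | no ¬c = let (w , w≢v , _) = another v v in
      choose s w , refl , ((λ eq → contradiction eq w≢v) , λ c → contradiction c ¬c) , w≢v ∘ cong proj₂ ∘ inj₁-injective
    ... | no v≢    | yes c = choose s (fixed p) , refl , ((λ _ → committed-sign p c) , λ _ → refl) , v≢ ∘ sym ∘ cong proj₂ ∘ inj₁-injective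
    -- Three variables per clause leave one besides the fixed variable and `v`.
    ... | no v≢    | no ¬c = let (w , w≢ , w≢v) = another (fixed p) v in
      choose s w , refl , ((λ eq → contradiction eq w≢) , λ c → contradiction c ¬c) , w≢v ∘ cong proj₂ ∘ inj₁-injective
    arc p (implication v s) 0F kept = literal v (next s) 1F , refl , kept , λ ()
    arc p (implication v s) 1F kept = literal v s 0F , refl , kept , λ ()

    unsolvable : (s : Variable → Point) → (∀ x → position (s x) ≡ x) →
      ¬ (∀ e → ¬ (∀ b → s (position (end e b)) ≡ end e b))
    unsolvable α at-α ok =
      let (v , eq) = choice t
      in ok (occurrence t v) λ where
           0F → eq
           1F → trans (proj₂ (truth v t)) (cong (literal v t)
             (trans (constant v t 0F) (sym (trans (cong flip (finToFun-funToFin opposed v)) (flip-flip _)))))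
      where
      choice : ∀ s → ∃[ v ] α (inj₁ s) ≡ choose s v
      choice s with α (inj₁ s) | at-α (inj₁ s)
      ... | choose _ v | refl = v , refl
      truth : ∀ v s → ∃[ b ] α (inj₂ (v , s)) ≡ literal v s b
      truth v s with α (inj₂ (v , s)) | at-α (inj₂ (v , s))
      ... | literal _ _ b | refl = b , refl
      opposed : Fin 3 → Fin 2
      opposed v = flip (proj₁ (truth v 0F))
      -- The clause all of whose literals are false under the assignment.
      t : Fin 8
      t = funToFin opposed
      step : ∀ v s → proj₁ (truth v s) ≡ 1F → proj₁ (truth v (next s)) ≡ 1F
      step v s eq = decidable-stable (_ ≟ 1F) λ ≢1 → ok (implication v s) λ where
        0F → trans (proj₂ (truth v s)) (cong (literal v s) eq)
        1F → trans (proj₂ (truth v (next s))) (cong (literal v (next s)) (≢⇒flip (≢1 ∘ sym)))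
      many : ∀ v s j → proj₁ (truth v s) ≡ 1F → proj₁ (truth v (steps j s)) ≡ 1F
      many v s zero    eq = eq
      many v s (suc j) eq = step v (steps j s) (many v s j eq)
      spread : ∀ v s s′ → proj₁ (truth v s) ≡ 1F → proj₁ (truth v s′) ≡ 1F
      spread v s s′ eq = let (j , at-s′) = reach s s′ in
        subst (λ s → proj₁ (truth v s) ≡ 1F) at-s′ (many v s (toℕ j) eq)
      -- Truth of one copy spreads round the cycle to all the others, so a true copy excludes a
      -- false one.
      constant : ∀ v s s′ → proj₁ (truth v s) ≡ proj₁ (truth v s′)
      constant v s s′ with proj₁ (truth v s) in eq | proj₁ (truth v s′) in eq′
      ... | 0F | 0F = refl
      ... | 1F | 1F = refl
      ... | 0F | 1F = trans (sym eq) (spread v s′ s eq′)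
      ... | 1F | 0F = trans (sym (spread v s s′ eq)) eq′

  open Subdivision graph public hiding (Point; position; Conflict)

-- The magic square: no 3 × 3 array of bits has even rows and odd columns.
-- A line chooses the first two of its bits, and the third is determined by parity.

module Square where

  Line Cell Bits : Set
  Line = Fin 2 × Fin 3
  Cell = Fin 3 × Fin 3
  Bits = Fin 2 × Fin 2

  pattern line l t   = inj₁ (l , t)
  pattern copy l j t = inj₂ (inj₁ ((l , j) , t))
  pattern entry c b  = inj₂ (inj₂ (c , b))

  pattern lineᵥ l   = inj₁ l
  pattern copyᵥ l j = inj₂ (inj₁ (l , j))
  pattern cellᵥ c   = inj₂ (inj₂ c)

  Variable Point : Set
  Variable = Line ⊎ (Line × Fin 3) ⊎ Cell
  Point    = (Line × Bits) ⊎ ((Line × Fin 3) × Bits) ⊎ (Cell × Fin 2)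

  position : Point → Variable
  position (line l _)   = lineᵥ l
  position (copy l j _) = copyᵥ l j
  position (entry c _)  = cellᵥ c

  cell : Line → Fin 3 → Cell
  cell (0F , i) j = i , j
  cell (1F , j) i = i , j

  infixl 6 _⊕_
  _⊕_ : Fin 2 → Fin 2 → Fin 2
  0F ⊕ b = b
  1F ⊕ 0F = 1F
  1F ⊕ 1F = 0F

  -- The index `k` of the direction doubles as the parity: 0 for rows, which are even, and 1 for
  -- columns, which are odd.
  bit : Line → Bits → Fin 3 → Fin 2
  bit _       (p , q) 0F = p
  bit _       (p , q) 1F = q
  bit (k , _) (p , q) 2F = k ⊕ p ⊕ q

  bits-injective : ∀ l {t u} → (∀ j → bit l t j ≡ bit l u j) → t ≡ u
  bits-injective l eq = cong₂ _,_ (eq 0F) (eq 1F)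

  _≟ₗ_ : (l l′ : Line) → Dec (l ≡ l′)
  _≟ₗ_ = ×-≡-dec _≟_ _≟_

  _≟ₜ_ : (t t′ : Bits) → Dec (t ≡ t′)
  _≟ₜ_ = ×-≡-dec _≟_ _≟_

  _≟ᶜ_ : (c c′ : Cell) → Dec (c ≡ c′)
  _≟ᶜ_ = ×-≡-dec _≟_ _≟_

  Conflict : Point → Point → Set
  Conflict (line l t)    (copy l′ j t′) = l ≡ l′ × t ≢ t′
  Conflict (copy l′ j t′) (line l t)    = l ≡ l′ × t ≢ t′
  Conflict (copy l j t)  (entry c b)    = c ≡ cell l j × b ≢ bit l t j
  Conflict (entry c b)   (copy l j t)   = c ≡ cell l j × b ≢ bit l t j
  Conflict _             _              = ⊥

  conflict? : ∀ p q → Dec (Conflict p q)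
  conflict? (line l t)    (copy l′ j t′) = (l ≟ₗ l′) ×-dec ¬? (t ≟ₜ t′)
  conflict? (copy l′ j t′) (line l t)    = (l ≟ₗ l′) ×-dec ¬? (t ≟ₜ t′)
  conflict? (copy l j t)  (entry c b)    = (c ≟ᶜ cell l j) ×-dec ¬? (b ≟ bit l t j)
  conflict? (entry c b)   (copy l j t)   = (c ≟ᶜ cell l j) ×-dec ¬? (b ≟ bit l t j)
  conflict? (line _ _)    (line _ _)     = no λ ()
  conflict? (line _ _)    (entry _ _)    = no λ ()
  conflict? (copy _ _ _)  (copy _ _ _)   = no λ ()
  conflict? (entry _ _)   (line _ _)     = no λ ()
  conflict? (entry _ _)   (entry _ _)    = no λ ()

  conflict-sym : ∀ p q → Conflict p q → Conflict q p
  conflict-sym (line _ _)   (copy _ _ _) c = c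
  conflict-sym (copy _ _ _) (line _ _)   c = c
  conflict-sym (copy _ _ _) (entry _ _)  c = c
  conflict-sym (entry _ _)  (copy _ _ _) c = c

  square : Network
  square = record
    { vars = finite 2 ×ᶠ finite 3 ⊎ᶠ (finite 2 ×ᶠ finite 3) ×ᶠ finite 3 ⊎ᶠ finite 3 ×ᶠ finite 3
    ; pts = (finite 2 ×ᶠ finite 3) ×ᶠ bits ⊎ᶠ ((finite 2 ×ᶠ finite 3) ×ᶠ finite 3) ×ᶠ bits ⊎ᶠ (finite 3 ×ᶠ finite 3) ×ᶠ finite 2
    ; at = position
    ; Clash = Conflict
    ; clash? = conflict?
    ; clash-sym = λ {p} {q} → conflict-sym p q
    }
    where
    bits : Fin 4 ↔ Bits
    bits = finite 2 ×ᶠ finite 2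

  open Network square using (Var; Pt; at; Clash; SACFails)

  -- The upper left four bits determine all others, and the corner `c (2F , 2F)` obtained along its
  -- row differs from the one obtained along its column.
  no-square : ∀ (c : Cell → Fin 2) → (∀ i → c (i , 2F) ≡ c (i , 0F) ⊕ c (i , 1F)) →
    (∀ j → c (2F , j) ≡ 1F ⊕ c (0F , j) ⊕ c (1F , j)) → ⊥
  no-square c rows columns = parity (c (0F , 0F)) (c (0F , 1F)) (c (1F , 0F)) (c (1F , 1F))
    (trans (sym (trans (columns 2F) (cong₂ (λ a b → 1F ⊕ a ⊕ b) (rows 0F) (rows 1F))))
      (trans (rows 2F) (cong₂ _⊕_ (columns 0F) (columns 1F))))
    where
    parity : ∀ a b d e → 1F ⊕ (a ⊕ b) ⊕ (d ⊕ e) ≢ (1F ⊕ a ⊕ d) ⊕ (1F ⊕ b ⊕ e)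
    parity = from-yes (all? λ a → all? λ b → all? λ d → all? λ e → ¬? (1F ⊕ (a ⊕ b) ⊕ (d ⊕ e) ≟ (1F ⊕ a ⊕ d) ⊕ (1F ⊕ b ⊕ e)))

  module _ (l₀ : Line) (t₀ : Bits) where

    Agrees : Line → Bits → Set
    Agrees l t = ∀ j j₀ → cell l j ≡ cell l₀ j₀ → bit l t j ≡ bit l₀ t₀ j₀

    Fits : Cell → Fin 2 → Set
    Fits c b = ∀ j₀ → c ≡ cell l₀ j₀ → b ≡ bit l₀ t₀ j₀

  -- A line other than the fixed one meets it in at most one cell. Together with the bit asked for
  -- at `j` this prescribes at most two of the three bits, and a remaining one corrects the parity.
  fill : ∀ k₀ i₀ p₀ q₀ k i j b → Fits (k₀ , i₀) (p₀ , q₀) (cell (k , i) j) b →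
    ∃[ p ] ∃[ q ] Agrees (k₀ , i₀) (p₀ , q₀) (k , i) (p , q) × bit (k , i) (p , q) j ≡ b
  fill = from-yes (all? λ k₀ → all? λ i₀ → all? λ p₀ → all? λ q₀ → all? λ k → all? λ i → all? λ j → all? λ b →
    (all? λ j₀ → (cell (k , i) j ≟ᶜ cell (k₀ , i₀) j₀) →-dec (b ≟ bit (k₀ , i₀) (p₀ , q₀) j₀)) →-dec
    any? λ p → any? λ q →
      (all? λ j → all? λ j₀ → (cell (k , i) j ≟ᶜ cell (k₀ , i₀) j₀) →-dec (bit (k , i) (p , q) j ≟ bit (k₀ , i₀) (p₀ , q₀) j₀))
      ×-dec (bit (k , i) (p , q) j ≟ b))

  cell-injective : ∀ l {j j′} → cell l j ≡ cell l j′ → j ≡ j′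
  cell-injective (0F , _) refl = refl
  cell-injective (1F , _) refl = refl

  fails : SACFails
  fails = record
    { origin = entry (0F , 0F) 0F
    ; Keeps = λ p → Keeps (source p)
    ; keeps-only = λ {p} {q} → only p q
    ; keeps-some = λ p → some (source p)
    ; keeps-arc = λ {p} {q} → arc {source p} q
    ; unsolvable = unsolvable
    }
    where
    through : Fin 3 → Fin 2 → Bits
    through 0F b = b , 0F
    through 1F b = 0F , b
    through 2F b = b , 0F

    bit-through : ∀ i j b → bit (0F , i) (through j b) j ≡ b
    bit-through i 0F b  = refl
    bit-through i 1F b  = refl
    bit-through i 2F 0F = refl
    bit-through i 2F 1F = refl

    -- An entry is fixed by fixing a whole row through it, whose further bits are an arbitrary even
    -- completion. Thus only assigned lines have to be treated.
    source : Point → Line × Bits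
    source (line l t)         = l , t
    source (copy l _ t)       = l , t
    source (entry (i , j) b)  = (0F , i) , through j b

    Keeps : Line × Bits → Point → Set
    Keeps (l₀ , t₀) (line l t)   = Agrees l₀ t₀ l t
    Keeps (l₀ , t₀) (copy l _ t) = Agrees l₀ t₀ l t
    Keeps (l₀ , t₀) (entry c b)  = Fits l₀ t₀ c b

    only : ∀ p q → Keeps (source p) q → position q ≡ position p → q ≡ p
    only (line l t)   (line .l u)     kept refl = cong (line l) (bits-injective l λ j → kept j j refl)
    only (copy l j t) (copy .l .j u)  kept refl = cong (copy l j) (bits-injective l λ j → kept j j refl)
    only (line _ _) (copy _ _ _) _ ()
    only (line _ _) (entry _ _)  _ ()
    only (entry (i , j) b) (entry _ b′) kept refl = cong (entry (i , j)) (trans (kept j refl) (bit-through i j b))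

    fit : ∀ {l₀ t₀} c → ∃ (Fits l₀ t₀ c)
    fit {l₀} {t₀} c with any? (λ j → c ≟ᶜ cell l₀ j)
    ... | yes (j , c≡) = bit l₀ t₀ j , λ j′ eq → cong (bit l₀ t₀) (cell-injective l₀ (trans (sym c≡) eq))
    ... | no  off      = 0F , λ j eq → contradiction (j , eq) off

    agree : ∀ {l₀ t₀} l → ∃ (Agrees l₀ t₀ l)
    agree l = let (_ , _ , agrees , _) = fill _ _ _ _ _ _ 0F _ (proj₂ (fit (cell l 0F))) in _ , agrees

    some : ∀ p y → ∃[ q ] position q ≡ y × Keeps p q
    some p (lineᵥ l)   = line l _ , refl , proj₂ (agree l)
    some p (copyᵥ l j) = copy l j _ , refl , proj₂ (agree l)
    some p (cellᵥ c)   = entry c _ , refl , proj₂ (fit c)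

    arc : ∀ {p} q → Keeps p q → ∀ y → position q ≢ y → ∃[ r ] position r ≡ y × Keeps p r × ¬ Conflict q r
    arc (line l t) kept (copyᵥ l′ j) _ with l ≟ₗ l′
    ... | yes refl = copy l j t , refl , kept , λ (_ , t≢t) → t≢t refl
    ... | no  l≢l′ = copy l′ j _ , refl , proj₂ (agree l′) , l≢l′ ∘ proj₁
    arc (copy l j t) kept (lineᵥ l′) _ with l′ ≟ₗ l
    ... | yes refl = line l t , refl , kept , λ (_ , t≢t) → t≢t refl
    ... | no  l′≢l = line l′ _ , refl , proj₂ (agree l′) , l′≢l ∘ proj₁
    arc (copy l j t) kept (cellᵥ c) _ with c ≟ᶜ cell l j
    ... | yes refl = entry c (bit l t j) , refl , kept j , λ (_ , b≢b) → b≢b refl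
    ... | no  c≢   = entry c _ , refl , proj₂ (fit c) , c≢ ∘ proj₁
    arc (entry c b) kept (copyᵥ l j) _ with c ≟ᶜ cell l j
    ... | yes refl = let (p , q , agrees , eq) = fill _ _ _ _ _ _ j b kept in
                     copy l j (p , q) , refl , agrees , λ (_ , b≢) → b≢ (sym eq)
    ... | no  c≢   = copy l j _ , refl , proj₂ (agree l) , c≢ ∘ proj₁
    arc (line _ _)   _ (lineᵥ l)   _ = line l _ , refl , proj₂ (agree l) , λ ()
    arc (line _ _)   _ (cellᵥ c)   _ = entry c _ , refl , proj₂ (fit c) , λ ()
    arc (copy _ _ _) _ (copyᵥ l j) _ = copy l j _ , refl , proj₂ (agree l) , λ ()
    arc (entry _ _)  _ (lineᵥ l)   _ = line l _ , refl , proj₂ (agree l) , λ ()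
    arc (entry _ _)  _ (cellᵥ c)   _ = entry c _ , refl , proj₂ (fit c) , λ ()

    unsolvable : (s : Variable → Point) → (∀ x → position (s x) ≡ x) → ¬ (∀ x y → x ≢ y → ¬ Conflict (s x) (s y))
    unsolvable s at-s ok = no-square (proj₁ ∘ content)
      (λ i → trans (reads (0F , i) 2F) (sym (cong₂ _⊕_ (reads (0F , i) 0F) (reads (0F , i) 1F))))
      (λ j → trans (reads (1F , j) 2F) (sym (cong₂ (λ a b → 1F ⊕ a ⊕ b) (reads (1F , j) 0F) (reads (1F , j) 1F))))
      where
      bits : ∀ l → ∃[ t ] s (lineᵥ l) ≡ line l t
      bits l with s (lineᵥ l) | at-s (lineᵥ l)
      ... | line _ t   | refl = t , refl
      ... | copy _ _ _ | ()
      ... | entry _ _  | ()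
      copied : ∀ l j → ∃[ t ] s (copyᵥ l j) ≡ copy l j t
      copied l j with s (copyᵥ l j) | at-s (copyᵥ l j)
      ... | copy _ _ t | refl = t , refl
      content : ∀ c → ∃[ b ] s (cellᵥ c) ≡ entry c b
      content c with s (cellᵥ c) | at-s (cellᵥ c)
      ... | entry _ b | refl = b , refl
      same-bits : ∀ l j → proj₁ (bits l) ≡ proj₁ (copied l j)
      same-bits l j = decidable-stable (_ ≟ₜ _) λ t≢ → ok (lineᵥ l) (copyᵥ l j) (λ ())
        (subst₂ Conflict (sym (proj₂ (bits l))) (sym (proj₂ (copied l j))) (refl , t≢))
      reads : ∀ l j → proj₁ (content (cell l j)) ≡ bit l (proj₁ (bits l)) j
      reads l j = trans
        (decidable-stable (_ ≟ _) λ b≢ → ok (copyᵥ l j) (cellᵥ (cell l j)) (λ ())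
          (subst₂ Conflict (sym (proj₂ (copied l j))) (sym (proj₂ (content (cell l j)))) (refl , b≢)))
        (cong (λ t → bit l t j) (sym (same-bits l j)))

  data Kind : Set where
    lineᵏ copyᵏ cellᵏ : Kind

  kind : Variable → Kind
  kind (lineᵥ _)   = lineᵏ
  kind (copyᵥ _ _) = copyᵏ
  kind (cellᵥ _)   = cellᵏ

  -- An entry is compatible with two values of each adjacent copy; the arrow from cell to copy marks
  -- this failure of functionality.
  NoArrow : Kind → Kind → Set
  NoArrow κ κ′ = ¬ (κ ≡ cellᵏ × κ′ ≡ copyᵏ)

  Adjacent : Variable → Variable → Set
  Adjacent (lineᵥ l)    (copyᵥ l′ _) = l ≡ l′
  Adjacent (copyᵥ l′ _) (lineᵥ l)    = l ≡ l′
  Adjacent (copyᵥ l j)  (cellᵥ c)    = c ≡ cell l j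
  Adjacent (cellᵥ c)    (copyᵥ l j)  = c ≡ cell l j
  Adjacent _            _            = ⊥

  conflict⇒adjacent : ∀ p q → Conflict p q → Adjacent (position p) (position q)
  conflict⇒adjacent (line _ _)   (copy _ _ _) = proj₁
  conflict⇒adjacent (copy _ _ _) (line _ _)   = proj₁
  conflict⇒adjacent (copy _ _ _) (entry _ _)  = proj₁
  conflict⇒adjacent (entry _ _)  (copy _ _ _) = proj₁

  data Kinds₃ : Kind → Kind → Kind → Set where
    at-line  : Kinds₃ copyᵏ lineᵏ copyᵏ
    at-cell  : Kinds₃ copyᵏ cellᵏ copyᵏ
    inwards  : Kinds₃ cellᵏ copyᵏ lineᵏ
    outwards : Kinds₃ lineᵏ copyᵏ cellᵏ

  -- A copy is adjacent to one line and one cell, so a path through it joins a line to a cell.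
  kinds₃ : ∀ x y z → Adjacent x y → Adjacent y z → x ≢ z → Kinds₃ (kind x) (kind y) (kind z)
  kinds₃ (copyᵥ _ _) (lineᵥ _)   (copyᵥ _ _) _ _ _ = at-line
  kinds₃ (copyᵥ _ _) (cellᵥ _)   (copyᵥ _ _) _ _ _ = at-cell
  kinds₃ (cellᵥ _)   (copyᵥ _ _) (lineᵥ _)   _ _ _ = inwards
  kinds₃ (lineᵥ _)   (copyᵥ _ _) (cellᵥ _)   _ _ _ = outwards
  kinds₃ (lineᵥ _)   (copyᵥ _ _) (lineᵥ _)   refl refl x≢z = contradiction refl x≢z
  kinds₃ (cellᵥ _)   (copyᵥ _ _) (cellᵥ _)   refl refl x≢z = contradiction refl x≢z

  module _ {m k} {P : Pattern (Fin m) (Fin k)} (irr : Irreducible P) {g} (emb : Embeds P square g)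
           (joined-by-neg : NegJoined P) where
    open Embeds emb

    kindOf : Fin k → Kind
    kindOf a = kind (position (g a))

    neg⇒adjacent : ∀ {a b} → Neg P a b → Adjacent (position (g a)) (position (g b))
    neg⇒adjacent ab = conflict⇒adjacent (g _) (g _) (neg⇒clash ab)

    -- Only the constraints from cells to copies are not functional.
    functional : ∀ {a b} → NoArrow (kindOf a) (kindOf b) → Functional P (var P a) (var P b)
    functional {a₀} {b₀} other {a} {u} {v} a~ u~ v~ au av = injective P irr emb
      (go (g a) (g u) (g v) adjacent (trans (var⇒at u~) (sym (var⇒at v~))) (pos⇒free au) (pos⇒free av)
        λ (cellᵃ , copyᵘ) → other (trans (cong kind (sym (var⇒at a~))) cellᵃ , trans (cong kind (sym (var⇒at u~))) copyᵘ))
      where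
      adjacent : Adjacent (position (g a)) (position (g u))
      adjacent = let (a′ , u′ , neg , a′~ , u′~) = joined-by-neg au in
        subst₂ Adjacent (var⇒at a′~) (var⇒at u′~) (neg⇒adjacent neg)
      go : ∀ p q r → Adjacent (position p) (position q) → position q ≡ position r →
        ¬ Conflict p q → ¬ Conflict p r → NoArrow (kind (position p)) (kind (position q)) → q ≡ r
      go (line l t) (copy _ j t′) (copy _ _ t″) refl refl ok ok′ _ = cong (copy l j)
        (trans (sym (decidable-stable (t ≟ₜ t′) λ t≢ → ok (refl , t≢))) (decidable-stable (t ≟ₜ t″) λ t≢ → ok′ (refl , t≢)))
      go (copy l _ t) (line _ t′) (line _ t″) refl refl ok ok′ _ = cong (line l)
        (trans (decidable-stable (t′ ≟ₜ t) λ t≢ → ok (refl , t≢)) (sym (decidable-stable (t″ ≟ₜ t) λ t≢ → ok′ (refl , t≢))))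
      go (copy l j t) (entry c b) (entry _ b′) refl refl ok ok′ _ = cong (entry c)
        (trans (decidable-stable (b ≟ _) λ b≢ → ok (refl , b≢)) (sym (decidable-stable (b′ ≟ _) λ b≢ → ok′ (refl , b≢))))
      go (entry _ _) (copy _ _ _) _ _ _ _ _ other = contradiction (refl , refl) other
      go (copy _ _ _) (line _ _) (copy _ _ _) _ ()
      go (copy _ _ _) (line _ _) (entry _ _)  _ ()

-- Monotonicity: positive edges lie along negative ones

iterate : ∀ {A : Set} → (A → A) → ℕ → A → A
iterate f zero    a = a
iterate f (suc i) a = f (iterate f i a)

-- If no negative edge joins the variables of a positive edge ab, delete all
-- positive edges between these variables. By monotonicity P still occurs in the
-- result, that is, some injective map on points preserves positive edges and has
-- no edge between these variables in its image; but the orbit of ab is a cycle.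
module _ {m k : ℕ} (P : Pattern (Fin m) (Fin k)) (monotone : Monotone P) (irr : Irreducible P) where

  joined-by-neg : NegJoined P
  joined-by-neg {a₀} {b₀} pos₀ = decidable-stable
    (any? λ a → any? λ b → neg? P a b ×-dec (var P a ≟ x) ×-dec (var P b ≟ y))
    λ none → monotone (toInstance) (pos-distinct P pos₀)
      (λ occ → let (g , e) = occurs⇒embeds P N occ in collapse g e) (occurs none)
    where
    x y : Fin m
    x = var P a₀
    y = var P b₀

    Between : Fin m → Fin m → Set
    Between u v = (u ≡ x × v ≡ y) ⊎ (v ≡ x × u ≡ y)

    between? : ∀ u v → Dec (Between u v)
    between? u v = ((u ≟ x) ×-dec (v ≟ y)) ⊎-dec ((v ≟ x) ×-dec (u ≟ y))

    Kept : Fin k → Fin k → Set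
    Kept a b = Pos P a b × ¬ Between (var P a) (var P b)

    kept? : ∀ a b → Dec (Kept a b)
    kept? a b = pos? P a b ×-dec ¬? (between? (var P a) (var P b))

    kept-sym : ∀ {a b} → Kept a b → Kept b a
    kept-sym (ab , apart) = pos-sym P ab , λ where
      (inj₁ (p , q)) → apart (inj₂ (p , q))
      (inj₂ (p , q)) → apart (inj₁ (p , q))

    -- Unlabelled pairs become clashes like negative ones, so that a compatible pair of `N` is a
    -- genuine positive edge of `P`.
    N : Network
    N = record
      { vars = finite m ; pts = finite k
      ; at = var P
      ; Clash = λ a b → ¬ Kept a b
      ; clash? = λ a b → ¬? (kept? a b)
      ; clash-sym = λ ¬ab ba → ¬ab (kept-sym ba)
      }

    open Network N using (toInstance; rel⁺; rel-clash; ∈dom⁺)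

    occurs : ¬ (∃₂ λ a b → Neg P a b × var P a ≡ x × var P b ≡ y) →
      P occursIn asPattern (deleteConstraint toInstance x y)
    occurs none = value , (λ _ _ → mk⇔ id id) ,
      (λ a b ab → proj₁ (rel⇒edge Deleted (value a) (value b) (pos-distinct P ab)) (rel-pos ab)) ,
      (λ a b ab → proj₂ (rel⇒edge Deleted (value a) (value b) (neg-distinct P ab)) (rel-neg ab))
      where
      Deleted : Instance m k
      Deleted = deleteConstraint toInstance x y
      value : Fin k → Value Deleted
      value a = var P a , a , ∈dom⁺ refl
      rel-pos : ∀ {a b} → Pos P a b → rel Deleted (var P a) (var P b) a b ≡ true
      rel-pos {a} {b} ab with between? (var P a) (var P b) in eq
      ... | yes _    = cong (_∨ rel toInstance (var P a) (var P b) a b) (cong does eq)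
      ... | no apart = trans (cong (does (between? (var P a) (var P b)) ∨_)
                         (rel⁺ {var P a} {var P b} λ ¬kept → ¬kept (ab , apart))) (∨-zeroʳ _)
      rel-neg : ∀ {a b} → Neg P a b → rel Deleted (var P a) (var P b) a b ≡ false
      rel-neg {a} {b} ab = cong₂ _∨_
        (dec-false (between? (var P a) (var P b)) λ where
          (inj₁ (p , q)) → none (a , b , ab , p , q)
          (inj₂ (p , q)) → none (b , a , neg-sym P ab , p , q))
        (rel-clash {var P a} {var P b} λ (ab′ , _) → pos-neg P ab′ ab)

    module _ (g : Fin k → Fin k) (e : Embeds P N g) where
      open Embeds e

      step : ∀ {a b} → Pos P a b → Kept (g a) (g b)
      step {a} {b} ab = decidable-stable (kept? (g a) (g b)) (pos⇒free ab)

      orbit : ∀ i → Pos P (iterate g i a₀) (iterate g i b₀)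
      orbit zero    = pos₀
      orbit (suc i) = proj₁ (step (orbit i))

      returns : ∀ i l {a} → iterate g i a ≡ iterate g (i + suc l) a → a ≡ g (iterate g l a)
      returns zero    l eq = eq
      returns (suc i) l eq = returns i l (injective P irr e eq)

      collapse : ⊥
      collapse =
        -- There are `k * k` pairs of points, so two iterates of the pair `a₀`, `b₀` coincide.
        -- Cancelling applications of the injective `g` makes this pair the image of a positive
        -- edge, but such images do not lie between `x` and `y`.
        let (i , j , i<j , eq) = pigeonhole {n = suc (k * k)} ≤-refl λ i →
              combine (iterate g (toℕ i) a₀) (iterate g (toℕ i) b₀)
            (eqᵃ , eqᵇ) = combine-injective _ _ _ _ eq
            (l , i+l≡j) = m≤n⇒∃[o]m+o≡n i<j
            j≡ = sym (trans (+-suc (toℕ i) l) i+l≡j)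
            a≡ = returns (toℕ i) l (trans eqᵃ (cong (λ j → iterate g j a₀) j≡))
            b≡ = returns (toℕ i) l (trans eqᵇ (cong (λ j → iterate g j b₀) j≡))
        in proj₂ (step (orbit l)) (inj₁ (cong (var P) (sym a≡) , cong (var P) (sym b≡)))

-- Templates: reasoning with sites instead of points

Joins : ∀ {k} → Fin k → Fin k → Fin k × Fin k → Set
Joins p q (u , v) = (p ≡ u × q ≡ v) ⊎ (p ≡ v × q ≡ u)

module _ {m k : ℕ} (P : Pattern (Fin m) (Fin k)) (irr : Irreducible P)
  (joined : NegJoined P) where

  -- An injective map of the points of P to the sites of a template, where site x
  -- belongs to the variable ix x, and the negative edges of P are exactly es.
  record Skeleton {s r : ℕ} (X : Fin s → Fin m) (ix : Vec (Fin s) r) (es : List (Fin r × Fin r)) : Set where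
    field
      site : Fin k → Fin r
      site-injective : ∀ {p q} → site p ≡ site q → p ≡ q
      X-injective : ∀ {v w} → X v ≡ X w → v ≡ w
      on   : ∀ p → var P p ≡ X (lookup ix (site p))
      neg⇒ : ∀ {p q} → Neg P p q → (site p , site q) ∈ es ⊎ (site q , site p) ∈ es
      ⇒neg : ∀ {x y} → (x , y) ∈ es → ∃₂ λ p q → site p ≡ x × site q ≡ y × Neg P p q

  module Reasoning {s r : ℕ} {X : Fin s → Fin m} {ix : Vec (Fin s) r} {es : List (Fin r × Fin r)} (S : Skeleton X ix es) where
    open Skeleton S public
    open DecMembership (×-≡-dec (_≟_ {r}) (_≟_ {r})) using () renaming (_∈?_ to _∈ₑ?_)
    open DecMembership (_≟_ {r}) using (_∈?_)

    F : Fin s → Fin s → Set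
    F v w = Functional P (X v) (X w)

    infix 4 _—_ _—?_
    _—_ : Fin r → Fin r → Set
    x — y = ∃₂ λ p q → site p ≡ x × site q ≡ y × Pos P p q

    _—?_ : ∀ x y → Dec (x — y)
    x —? y = any? λ p → any? λ q → (site p ≟ x) ×-dec (site q ≟ y) ×-dec pos? P p q

    —-sym : ∀ {x y} → x — y → y — x
    —-sym (p , q , p≡ , q≡ , pq) = q , p , q≡ , p≡ , pos-sym P pq

    Present : Fin r → Set
    Present x = ∃[ p ] site p ≡ x

    present? : ∀ x → Dec (Present x)
    present? x = any? λ p → site p ≟ x

    site-apart : ∀ {p q x y} → site p ≡ x → site q ≡ y → x ≢ y → p ≢ q
    site-apart refl refl x≢y p≡q = x≢y (cong site p≡q)

    same-variable : ∀ {p q x y} → site p ≡ x → site q ≡ y → lookup ix x ≡ lookup ix y → var P p ≡ var P q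
    same-variable {p} {q} refl refl eq = trans (on p) (trans (cong X eq) (sym (on q)))

    end₁ : ∀ {x y} → x — y → Present x
    end₁ (p , _ , p≡ , _) = p , p≡

    endpoints : ∀ {x y} → (x , y) ∈ es → Present x × Present y
    endpoints e = let (p , q , p≡ , q≡ , _) = ⇒neg e in (p , p≡) , (q , q≡)

    Edge Adjacent : Fin r → Fin r → Set
    Edge x y = (x , y) ∈ es ⊎ (y , x) ∈ es
    Adjacent x y = Any (λ (u , v) → (lookup ix u ≡ lookup ix x × lookup ix v ≡ lookup ix y) ⊎
                                    (lookup ix u ≡ lookup ix y × lookup ix v ≡ lookup ix x)) es

    edge? : ∀ x y → Dec (Edge x y)
    edge? x y = ((x , y) ∈ₑ? es) ⊎-dec ((y , x) ∈ₑ? es)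

    adjacent? : ∀ x y → Dec (Adjacent x y)
    adjacent? x y = Any.any? (λ (u , v) → ((lookup ix u ≟ lookup ix x) ×-dec (lookup ix v ≟ lookup ix y)) ⊎-dec
                                          ((lookup ix u ≟ lookup ix y) ×-dec (lookup ix v ≟ lookup ix x))) es

    edge-points : ∀ {x y} → Edge x y → ∃₂ λ p q → site p ≡ x × site q ≡ y × Neg P p q
    edge-points (inj₁ e) = ⇒neg e
    edge-points (inj₂ e) = let (p , q , p≡ , q≡ , pq) = ⇒neg e in q , p , q≡ , p≡ , neg-sym P pq

    -- On a concrete template both filters evaluate to explicit lists, so the disjunctions below can
    -- be taken apart by matching on `here` and `there`.
    neighbours candidates : Fin r → List (Fin r)
    neighbours x = filter (edge? x) (allFin r)
    candidates x = filter (adjacent? x) (allFin r)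

    neg⇒neighbour : ∀ {p q} → Neg P p q → site q ∈ neighbours (site p)
    neg⇒neighbour {p} pq = ∈-filter⁺ (edge? (site p)) (∈-allFin _) (neg⇒ pq)

    same-index : ∀ {p q} → var P p ≡ var P q → lookup ix (site p) ≡ lookup ix (site q)
    same-index {p} {q} eq = X-injective (trans (sym (on p)) (trans eq (on q)))

    pos⇒adjacent : ∀ {p q} → Pos P p q → Adjacent (site p) (site q)
    pos⇒adjacent pq with joined pq
    ... | p′ , q′ , neg , p′~p , q′~q with neg⇒ neg
    ...   | inj₁ e = lose e (inj₁ (same-index p′~p , same-index q′~q))
    ...   | inj₂ e = lose e (inj₂ (same-index q′~q , same-index p′~p))

    pos⇒candidate : ∀ {p q} → Pos P p q → site q ∈ candidates (site p)
    pos⇒candidate {p} pq = ∈-filter⁺ (adjacent? (site p)) (∈-allFin _) (pos⇒adjacent pq)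

    -- The two points are not mergeable, and the point that separates them is a negative neighbour
    -- of one of them, hence taken from a known list.
    split : ∀ x y → Present x → Present y → {True (¬? (x ≟ y))} → {True (lookup ix x ≟ lookup ix y)} →
      Any (x —_) (neighbours y) ⊎ Any (y —_) (neighbours x)
    split x y (p , refl) (q , refl) {x≢y} {same} with
      separated P irr (λ p≡q → toWitness x≢y (cong site p≡q))
        (trans (on p) (trans (cong X (toWitness same)) (sym (on q))))
    ... | c , inj₁ (pc , qc) = inj₁ (lose (neg⇒neighbour qc) (p , c , refl , refl , pc))
    ... | c , inj₂ (pc , qc) = inj₂ (lose (neg⇒neighbour pc) (q , c , refl , refl , qc))

    null⇒≡[] : ∀ {xs : List (Fin r)} → T (null xs) → xs ≡ []
    null⇒≡[] {[]} _ = refl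

    two-positives : ∀ {x} → neighbours x ≡ [] → Present x →
      ∃₂ λ y z → y ≢ z × y ∈ candidates x × z ∈ candidates x × x — y × x — z
    two-positives isolated (p , refl) =
      let (b , c , b≢c , pb , pc) = alive P irr p λ q pq →
            case subst (site q ∈_) isolated (neg⇒neighbour pq) of λ ()
      in site b , site c , b≢c ∘ site-injective , pos⇒candidate pb , pos⇒candidate pc ,
         (p , b , refl , refl , pb) , (p , c , refl , refl , pc)

    -- A point without negative edges that is not dangling has two positive edges, and at least one
    -- of them avoids `y`.
    another-positive : ∀ x y → Present x → {T (null (neighbours x))} →
      Any (x —_) (filter (λ z → ¬? (z ≟ y)) (candidates x))
    another-positive x y present {isolated} with two-positives (null⇒≡[] isolated) present
    ... | u , v , u≢v , u∈ , v∈ , xu , xv with u ≟ y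
    ...   | no  u≢y  = lose (∈-filter⁺ (λ z → ¬? (z ≟ y)) u∈ u≢y) xu
    ...   | yes refl = lose (∈-filter⁺ (λ z → ¬? (z ≟ y)) v∈ (u≢v ∘ sym)) xv

    one-positive : ∀ {v w x y z} → F v w → x — y → x — z →
      lookup ix x ≡ v → lookup ix y ≡ w → lookup ix z ≡ w → y ≡ z
    one-positive functional (p , q , refl , refl , pq) (p′ , q′ , p≡p′ , refl , pq′) refl refl eq
      with refl ← site-injective p≡p′ = cong site (functional (on p) (on q) (trans (on q′) (cong X eq)) pq pq′)

    only-one : ∀ {v w x y z} → F v w → x — y → x — z →
      {True (lookup ix x ≟ v)} → {True (lookup ix y ≟ w)} → {True (lookup ix z ≟ w)} → {True (¬? (y ≟ z))} → ⊥
    only-one functional xy xz {x∈} {y∈} {z∈} {y≢z} =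
      toWitness y≢z (one-positive functional xy xz (toWitness x∈) (toWitness y∈) (toWitness z∈))

    -- All positive edges at `x` lead to the single variable `w`. Functionality leaves at most one
    -- of them, and `x` is dangling.
    no-leaf : ∀ {v w} x → F v w → {T (null (neighbours x))} → {True (lookup ix x ≟ v)} →
      {True (All.all? (λ y → lookup ix y ≟ w) (candidates x))} → ¬ Present x
    no-leaf x functional {isolated} {x∈} {leaf} present =
      let (y , z , y≢z , y∈ , z∈ , xy , xz) = two-positives (null⇒≡[] isolated) present
      in y≢z (one-positive functional xy xz (toWitness x∈)
                (All.lookup (toWitness leaf) y∈) (All.lookup (toWitness leaf) z∈))

    V-free : (∀ {a b c B} → Neg P b a → Neg P b c → var P a ≢ var P c → var P B ≡ var P b → Pos P B a → Pos P B c → ⊥) →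
      ∀ {x y z B} → Edge x y → Edge x z → lookup ix y ≢ lookup ix z → lookup ix B ≡ lookup ix x → B — y → ¬ B — z
    V-free no-V {x} xy xz y≁z B~x (p , q , refl , refl , pq) (p′ , r , p≡ , refl , p′r)
      with refl ← site-injective p≡ | b , _ , refl , q≡ , bq ← edge-points xy | b′ , _ , b≡ , r≡ , br ← edge-points xz
      with refl ← site-injective b≡ | refl ← site-injective q≡ | refl ← site-injective r≡ =
        no-V bq br (y≁z ∘ same-index) (trans (on p) (trans (cong X B~x) (sym (on b)))) pq p′r

    module _ {t : ℕ} (R : Pattern (Fin 4) (Fin t)) (h : Vec (Fin t) r)
             (absent : List (Fin r)) (excluded : List (Fin r × Fin r)) where

      Maps : Fin r → Fin r → Set
      Maps x y = (lookup ix x ≡ lookup ix y → var R (lookup h x) ≡ var R (lookup h y)) ×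
        (var R (lookup h x) ≡ var R (lookup h y) → lookup ix x ≡ lookup ix y) ×
        (Edge x y → Neg R (lookup h x) (lookup h y)) ×
        (Adjacent x y → Edge x y ⊎ ((x , y) ∈ excluded ⊎ (y , x) ∈ excluded) ⊎ Pos R (lookup h x) (lookup h y))

      maps? : Dec (∀ x y → x ∈ absent ⊎ y ∈ absent ⊎ Maps x y)
      maps? = all? λ x → all? λ y → (x ∈? absent) ⊎-dec (y ∈? absent) ⊎-dec
        ((lookup ix x ≟ lookup ix y →-dec var R (lookup h x) ≟ var R (lookup h y)) ×-dec
         (var R (lookup h x) ≟ var R (lookup h y) →-dec lookup ix x ≟ lookup ix y) ×-dec
         (edge? x y →-dec neg? R (lookup h x) (lookup h y)) ×-dec
         (adjacent? x y →-dec (edge? x y ⊎-dec ((x , y) ∈ₑ? excluded ⊎-dec (y , x) ∈ₑ? excluded) ⊎-dec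
                               pos? R (lookup h x) (lookup h y))))

      -- Only the absent sites and the excluded positive edges require proof; that `h` sends every
      -- edge still possible to an edge of `R` is decided by evaluation. The values of `h` at absent
      -- sites do not matter.
      occurs : All (¬_ ∘ Present) absent → All (λ (x , y) → ¬ x — y) excluded → {True maps?} → P occursIn R
      occurs absences exclusions {maps} = f ,
        (λ a b → let (to , from , _) = at a b in mk⇔
          (λ eq → to (same-index eq))
          (λ eq → trans (on a) (trans (cong X (from eq)) (sym (on b))))) ,
        (λ a b ab → let (_ , _ , _ , pos) = at a b in
          case pos (pos⇒adjacent ab) of λ where
            (inj₁ e) → ⊥-elim (edge-not-positive e ab)
            (inj₂ (inj₁ (inj₁ e))) → ⊥-elim (All.lookup exclusions e (a , b , refl , refl , ab))
            (inj₂ (inj₁ (inj₂ e))) → ⊥-elim (All.lookup exclusions e (b , a , refl , refl , pos-sym P ab))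
            (inj₂ (inj₂ pos)) → pos) ,
        (λ a b ab → let (_ , _ , neg , _) = at a b in neg (neg⇒ ab))
        where
        f : Fin k → Fin t
        f p = lookup h (site p)
        at : ∀ a b → Maps (site a) (site b)
        at a b with toWitness maps (site a) (site b)
        ... | inj₁ x∈        = contradiction (a , refl) (All.lookup absences x∈)
        ... | inj₂ (inj₁ y∈) = contradiction (b , refl) (All.lookup absences y∈)
        ... | inj₂ (inj₂ ok) = ok
        edge-not-positive : ∀ {a b} → Edge (site a) (site b) → ¬ Pos P a b
        edge-not-positive e ab with edge-points e
        ... | p , q , p≡ , q≡ , pq = pos-neg P ab (subst₂ (Neg P) (site-injective p≡) (site-injective q≡) pq)

  module _ {s r : ℕ} (ix : Vec (Fin s) r) (es ds : List (Fin r × Fin r)) where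
    open DecMembership (×-≡-dec (_≟_ {r}) (_≟_ {r})) using () renaming (_∈?_ to _∈ₑ?_)

    abstract
      -- Two points without negative edges at the same variable would be mergeable.
      skeleton : (vs : Vec (Fin m) s) (ps : Vec (Fin k) r) → Unique vs →
        (∀ i → var P (lookup ps i) ≡ lookup vs (lookup ix i)) →
        All (λ (i , j) → lookup ps i ≢ lookup ps j) ds →
        All (λ (u , v) → Neg P u v) (map (λ (i , j) → lookup ps i , lookup ps j) es) →
        (∀ {p q} → Neg P p q → Any (Joins p q) (map (λ (i , j) → lookup ps i , lookup ps j) es)) →
        {True (all? λ i → all? λ j → (i ≟ j) ⊎-dec ¬? (lookup ix i ≟ lookup ix j) ⊎-dec
                ((i , j) ∈ₑ? ds) ⊎-dec ((j , i) ∈ₑ? ds))} →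
        Skeleton (lookup vs) (ix ++ Vec.allFin s) (map (λ (i , j) → i ↑ˡ s , j ↑ˡ s) es)
      skeleton vs ps unique at apart negs complete {covered} = record
        { site = place
        ; site-injective = λ {p} {q} → place-injective p q
        ; X-injective = lookup-injective unique _ _
        ; on = on
        ; neg⇒ = neg⇒es
        ; ⇒neg = λ e → let (ij , ij∈ , eq) = ∈-map⁻ _ e in
            lookup ps (proj₁ ij) , lookup ps (proj₂ ij) ,
            trans (named (proj₁ ij)) (sym (cong proj₁ eq)) , trans (named (proj₂ ij)) (sym (cong proj₂ eq)) ,
            All.lookup negs (∈-map⁺ _ ij∈)
        }
        where
        ps-injective : ∀ i j → lookup ps i ≡ lookup ps j → i ≡ j
        ps-injective i j eq with toWitness covered i j
        ... | inj₁ i≡j = i≡j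
        ... | inj₂ (inj₁ ix≢) = contradiction
                (lookup-injective unique _ _ (trans (sym (at i)) (trans (cong (var P) eq) (at j)))) ix≢
        ... | inj₂ (inj₂ (inj₁ ij∈)) = contradiction eq (All.lookup apart ij∈)
        ... | inj₂ (inj₂ (inj₂ ji∈)) = contradiction (sym eq) (All.lookup apart ji∈)

        index-edge : ∀ {p q} es → Any (Joins p q) (map (λ (i , j) → lookup ps i , lookup ps j) es) →
          ∃₂ λ i j → p ≡ lookup ps i × q ≡ lookup ps j × ((i , j) ∈ es ⊎ (j , i) ∈ es)
        index-edge ((i , j) ∷ _)  (here (inj₁ (p≡ , q≡))) = i , j , p≡ , q≡ , inj₁ (here refl)
        index-edge ((i , j) ∷ _)  (here (inj₂ (p≡ , q≡))) = j , i , p≡ , q≡ , inj₂ (here refl)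
        index-edge (_ ∷ es) (there e) = let (i , j , p≡ , q≡ , ∈es) = index-edge es e in
          i , j , p≡ , q≡ , Sum.map there there ∈es

        variable-of : ∀ p → ∃[ v ] var P p ≡ lookup vs v
        variable-of p with any? (neg? P p)
        ... | yes (q , pq) = let (i , _ , p≡ , _) = index-edge es (complete pq) in
                lookup ix i , trans (cong (var P) p≡) (at i)
        -- Not being dangling, `p` has a positive edge, and by `joined` the variable of `p` then
        -- carries an end of a negative edge.
        ... | no none = let (_ , _ , _ , pb , _) = alive P irr p (λ q pq → none (q , pq))
                            (_ , _ , neg , p′~p , _) = joined pb
                            (i , _ , p≡ , _) = index-edge es (complete neg)
                        in lookup ix i , trans (sym p′~p) (trans (cong (var P) p≡) (at i))

        name? : ∀ p → Dec (∃[ i ] p ≡ lookup ps i)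
        name? p = any? λ i → p ≟ lookup ps i

        place : Fin k → Fin (r + s)
        place p with name? p
        ... | yes (i , _) = i ↑ˡ s
        ... | no  _       = r ↑ʳ proj₁ (variable-of p)

        on : ∀ p → var P p ≡ lookup vs (lookup (ix ++ Vec.allFin s) (place p))
        on p with name? p
        ... | yes (i , refl) = trans (at i) (cong (lookup vs) (sym (lookup-++ˡ ix _ i)))
        ... | no  _ = let (v , v≡) = variable-of p in
                trans v≡ (cong (lookup vs) (sym (trans (lookup-++ʳ ix _ v) (lookup-allFin v))))

        neg⇒named : ∀ {p q} → Neg P p q → ∃[ i ] p ≡ lookup ps i
        neg⇒named pq = let (i , _ , p≡ , _) = index-edge es (complete pq) in i , p≡

        apart↑ : ∀ {i : Fin r} {v : Fin s} → i ↑ˡ s ≢ r ↑ʳ v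
        apart↑ {i} {v} eq with () ← trans (sym (splitAt-↑ˡ r i s)) (trans (cong (splitAt r) eq) (splitAt-↑ʳ r s v))

        place-injective : ∀ p q → place p ≡ place q → p ≡ q
        place-injective p q eq with name? p | name? q
        ... | yes (i , p≡) | yes (j , q≡) = trans p≡ (trans (cong (lookup ps) (↑ˡ-injective s i j eq)) (sym q≡))
        ... | yes _ | no _  = contradiction eq apart↑
        ... | no _  | yes _ = contradiction (sym eq) apart↑
        ... | no p-unnamed | no q-unnamed = decidable-stable (p ≟ q) λ p≢q →
          case separated P irr p≢q (trans (proj₂ (variable-of p))
                 (trans (cong (lookup vs) (↑ʳ-injective r _ _ eq)) (sym (proj₂ (variable-of q))))) of λ where
            (_ , inj₁ (_ , qc)) → q-unnamed (neg⇒named qc)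
            (_ , inj₂ (pc , _)) → p-unnamed (neg⇒named pc)

        named : ∀ i → place (lookup ps i) ≡ i ↑ˡ s
        named i with name? (lookup ps i)
        ... | yes (j , eq) = cong (_↑ˡ s) (sym (ps-injective i j eq))
        ... | no unnamed   = contradiction (i , refl) unnamed

        raise : Fin r × Fin r → Fin (r + s) × Fin (r + s)
        raise (i , j) = i ↑ˡ s , j ↑ˡ s

        neg⇒es : ∀ {p q} → Neg P p q → (place p , place q) ∈ map raise es ⊎ (place q , place p) ∈ map raise es
        neg⇒es pq with index-edge es (complete pq)
        ... | i , j , refl , refl , ij∈ = Sum.map
          (λ e → subst (_∈ map raise es) (cong₂ _,_ (sym (named i)) (sym (named j))) (∈-map⁺ raise e))
          (λ e → subst (_∈ map raise es) (cong₂ _,_ (sym (named j)) (sym (named i))) (∈-map⁺ raise e)) ij∈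

-- Classification by the shape of the negative edges

module _ {m k : ℕ} (P : Pattern (Fin m) (Fin k)) where

  Conclusion : Set
  Conclusion = P occursIn Q1 ⊎ P occursIn Q2 ⊎
    P occursIn R1 ⊎ P occursIn R2 ⊎ P occursIn R3 ⊎ P occursIn R4 ⊎
    P occursIn R5 ⊎ P occursIn R6 ⊎ P occursIn R7 ⊎ P occursIn R8 ⊎
    P occursIn R9 ⊎ P occursIn R10

module Conclude {m k : ℕ} (P : Pattern (Fin m) (Fin k)) where
  inQ1 : P occursIn Q1 → Conclusion P
  inQ1 = inj₁
  inQ2 : P occursIn Q2 → Conclusion P
  inQ2 = inj₂ ∘ inj₁
  inR1 : P occursIn R1 → Conclusion P
  inR1 = inj₂ ∘ inj₂ ∘ inj₁
  inR2 : P occursIn R2 → Conclusion P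
  inR2 = inj₂ ∘ inj₂ ∘ inj₂ ∘ inj₁
  inR3 : P occursIn R3 → Conclusion P
  inR3 = inj₂ ∘ inj₂ ∘ inj₂ ∘ inj₂ ∘ inj₁
  inR4 : P occursIn R4 → Conclusion P
  inR4 = inj₂ ∘ inj₂ ∘ inj₂ ∘ inj₂ ∘ inj₂ ∘ inj₁
  inR5 : P occursIn R5 → Conclusion P
  inR5 = inj₂ ∘ inj₂ ∘ inj₂ ∘ inj₂ ∘ inj₂ ∘ inj₂ ∘ inj₁
  inR6 : P occursIn R6 → Conclusion P
  inR6 = inj₂ ∘ inj₂ ∘ inj₂ ∘ inj₂ ∘ inj₂ ∘ inj₂ ∘ inj₂ ∘ inj₁
  inR7 : P occursIn R7 → Conclusion P
  inR7 = inj₂ ∘ inj₂ ∘ inj₂ ∘ inj₂ ∘ inj₂ ∘ inj₂ ∘ inj₂ ∘ inj₂ ∘ inj₁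
  inR8 : P occursIn R8 → Conclusion P
  inR8 = inj₂ ∘ inj₂ ∘ inj₂ ∘ inj₂ ∘ inj₂ ∘ inj₂ ∘ inj₂ ∘ inj₂ ∘ inj₂ ∘ inj₁
  inR9 : P occursIn R9 → Conclusion P
  inR9 = inj₂ ∘ inj₂ ∘ inj₂ ∘ inj₂ ∘ inj₂ ∘ inj₂ ∘ inj₂ ∘ inj₂ ∘ inj₂ ∘ inj₂ ∘ inj₁
  inR10 : P occursIn R10 → Conclusion P
  inR10 = inj₂ ∘ inj₂ ∘ inj₂ ∘ inj₂ ∘ inj₂ ∘ inj₂ ∘ inj₂ ∘ inj₂ ∘ inj₂ ∘ inj₂ ∘ inj₂

-- Sites of a template: the endpoints of its negative edges in lower case, and
-- then, in upper case, one further site for every variable.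
module Classification {m k : ℕ} (P : Pattern (Fin m) (Fin k)) (irr : Irreducible P)
  (joined : NegJoined P) where

  open Conclude P

  Template : ∀ s {r} → (Fin s → Fin m) → Vec (Fin s) r → List (Fin r × Fin r) → Set
  Template s X ix es = Skeleton P irr joined X (ix ++ Vec.allFin s) (map (λ (i , j) → i ↑ˡ s , j ↑ˡ s) es)

  pattern 1st = here refl
  pattern 2nd = there (here refl)
  pattern 3rd = there (there (here refl))

  -- The letters `s` and `d` in the names of the templates tell whether negative edges end in the
  -- same point or in different points of a variable that they share.
  ix-dd : Vec (Fin 4) 6
  ix-dd = 0F ∷ 1F ∷ 1F ∷ 2F ∷ 2F ∷ 3F ∷ []

  es-dd : List (Fin 6 × Fin 6)
  es-dd = (0F , 1F) ∷ (2F , 3F) ∷ (4F , 5F) ∷ []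

  module PathDD {X : Fin 4 → Fin m} (S : Template 4 X ix-dd es-dd) where
    open Reasoning P irr joined S

    a b₂ b₁ c₁ c₂ d A B C D : Fin 10
    a = 0F ; b₂ = 1F ; b₁ = 2F ; c₁ = 3F ; c₂ = 4F ; d = 5F
    A = 6F ; B = 7F ; C = 8F ; D = 9F

    split-b : b₂ — c₁ ⊎ b₁ — a
    split-b = case split b₂ b₁ (proj₂ (endpoints 1st)) (proj₁ (endpoints 2nd)) of λ where
      (inj₁ (here p)) → inj₁ p
      (inj₂ (here p)) → inj₂ p

    split-c : c₁ — d ⊎ c₂ — b₁
    split-c = case split c₁ c₂ (proj₂ (endpoints 2nd)) (proj₁ (endpoints 3rd)) of λ where
      (inj₁ (here p)) → inj₁ p
      (inj₂ (here p)) → inj₂ p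

    -- `B` has no negative edges, so it differs from `b₂` only by a positive edge to `a`, and from
    -- `b₁` only by one to `c₁`.
    split-B : Present B → B — a × B — c₁
    split-B B∈ = (case split B b₂ B∈ (proj₂ (endpoints 1st)) of λ { (inj₁ (here p)) → p }) ,
                 (case split B b₁ B∈ (proj₁ (endpoints 2nd)) of λ { (inj₁ (here p)) → p })

    split-C : Present C → C — b₁ × C — d
    split-C C∈ = (case split C c₁ C∈ (proj₂ (endpoints 2nd)) of λ { (inj₁ (here p)) → p }) ,
                 (case split C c₂ C∈ (proj₁ (endpoints 3rd)) of λ { (inj₁ (here p)) → p })

    D∉ : F 3F 2F → ¬ Present D
    D∉ f₃₂ = no-leaf D f₃₂

    C∉ : F 1F 2F → F 3F 2F → ¬ Present C
    C∉ f₁₂ f₃₂ C∈ = let (Cb₁ , Cd) = split-C C∈ in case split-c of λ where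
      (inj₁ c₁d)  → only-one f₃₂ (—-sym c₁d) (—-sym Cd)
      (inj₂ c₂b₁) → only-one f₁₂ (—-sym c₂b₁) (—-sym Cb₁)

    -- Only points at the first variable may have several positive edges to one variable. `B` leads
    -- to R9 or R8, according to `b₂ — c₂`; failing `B`, `A` leads to R6; failing both, `b₂ — c₂`
    -- decides between R10 and R5.
    inwards : F 1F 0F → F 1F 2F → F 2F 1F → F 2F 3F → F 3F 2F → Conclusion P
    inwards f₁₀ f₁₂ f₂₁ f₂₃ f₃₂ = case present? B of λ where
        (yes B∈) → with-B B∈
        (no B∉)  → without-B B∉
      where
      with-B : Present B → Conclusion P
      with-B B∈ = case b₂ —? c₂ of λ where
          (yes b₂c₂) → inR9 (occurs R9 (0F ∷ 2F ∷ 1F ∷ 4F ∷ 5F ∷ 6F ∷ 0F ∷ 3F ∷ 0F ∷ 0F ∷ [])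
            (A ∷ C ∷ D ∷ []) ((b₂ , c₁) ∷ (b₁ , c₂) ∷ (B , c₂) ∷ [])
            (A∉ ∷ C∉ f₁₂ f₃₂ ∷ D∉ f₃₂ ∷ [])
            (¬b₂c₁ ∷ (λ b₁c₂ → only-one f₂₁ (—-sym b₁c₂) (—-sym b₂c₂)) ∷ ¬Bc₂ ∷ []))
          (no ¬b₂c₂) → inR8 (occurs R8 (0F ∷ 2F ∷ 1F ∷ 4F ∷ 5F ∷ 6F ∷ 0F ∷ 3F ∷ 0F ∷ 0F ∷ [])
            (A ∷ C ∷ D ∷ []) ((b₂ , c₁) ∷ (b₂ , c₂) ∷ (B , c₂) ∷ [])
            (A∉ ∷ C∉ f₁₂ f₃₂ ∷ D∉ f₃₂ ∷ []) (¬b₂c₁ ∷ ¬b₂c₂ ∷ ¬Bc₂ ∷ []))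
        where
        ¬b₂c₁ : ¬ b₂ — c₁
        ¬b₂c₁ b₂c₁ = only-one f₂₁ (—-sym b₂c₁) (—-sym (proj₂ (split-B B∈)))
        ¬Bc₂ : ¬ B — c₂
        ¬Bc₂ Bc₂ = only-one f₁₂ (proj₂ (split-B B∈)) Bc₂
        A∉ : ¬ Present A
        A∉ A∈ = case split-b of λ where
          (inj₁ b₂c₁) → ¬b₂c₁ b₂c₁
          (inj₂ b₁a)  → case another-positive A b₂ A∈ of λ where
            (here Ab₁)        → only-one f₁₀ b₁a (—-sym Ab₁)
            (there (here AB)) → only-one f₁₀ (proj₁ (split-B B∈)) (—-sym AB)
      without-B : ¬ Present B → Conclusion P
      without-B B∉ = case present? A of λ where
          (yes A∈) → let Ab₁ = case another-positive A b₂ A∈ of λ where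
                                  (here Ab₁)        → Ab₁
                                  (there (here AB)) → ⊥-elim (B∉ (end₁ (—-sym AB)))
                         ¬ab₁ = λ ab₁ → only-one f₁₀ (—-sym ab₁) (—-sym Ab₁)
                         b₂c₁ = case split-b of λ where
                                  (inj₁ b₂c₁) → b₂c₁
                                  (inj₂ b₁a)  → ⊥-elim (¬ab₁ (—-sym b₁a))
            in inR6 (occurs R6 (1F ∷ 3F ∷ 2F ∷ 4F ∷ 5F ∷ 6F ∷ 0F ∷ 0F ∷ 0F ∷ 0F ∷ [])
                 (B ∷ C ∷ D ∷ []) ((a , b₁) ∷ (b₂ , c₂) ∷ [])
                 (B∉ ∷ C∉ f₁₂ f₃₂ ∷ D∉ f₃₂ ∷ [])
                 (¬ab₁ ∷ (λ b₂c₂ → only-one f₁₂ b₂c₁ b₂c₂) ∷ []))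
          (no A∉) → case b₂ —? c₂ of λ where
            (yes b₂c₂) → inR10 (occurs R10 (0F ∷ 2F ∷ 1F ∷ 3F ∷ 4F ∷ 5F ∷ 0F ∷ 0F ∷ 0F ∷ 0F ∷ [])
              (A ∷ B ∷ C ∷ D ∷ []) ((b₂ , c₁) ∷ []) (A∉ ∷ B∉ ∷ C∉ f₁₂ f₃₂ ∷ D∉ f₃₂ ∷ [])
              ((λ b₂c₁ → only-one f₁₂ b₂c₁ b₂c₂) ∷ []))
            (no ¬b₂c₂) → inR5 (occurs R5 (0F ∷ 2F ∷ 1F ∷ 3F ∷ 4F ∷ 5F ∷ 0F ∷ 0F ∷ 0F ∷ 0F ∷ [])
              (A ∷ B ∷ C ∷ D ∷ []) ((b₂ , c₂) ∷ []) (A∉ ∷ B∉ ∷ C∉ f₁₂ f₃₂ ∷ D∉ f₃₂ ∷ [])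
              (¬b₂c₂ ∷ []))

    -- Only points at the second variable may have several positive edges to one variable. This
    -- rules out `B` and admits `C`, which calls for R7.
    outwards : F 0F 1F → F 2F 1F → F 2F 3F → F 3F 2F → Conclusion P
    outwards f₀₁ f₂₁ f₂₃ f₃₂ = case present? C of λ where
        (yes C∈) → let (Cb₁ , Cd) = split-C C∈
                       ¬c₁d = λ c₁d → only-one f₃₂ (—-sym c₁d) (—-sym Cd)
                       c₂b₁ = case split-c of λ where
                                (inj₁ c₁d)  → ⊥-elim (¬c₁d c₁d)
                                (inj₂ c₂b₁) → c₂b₁
          -- The path is reflected: its third variable becomes the second one of R7, with `C` at
          -- `b₃`.
          in inR7 (occurs R7 (6F ∷ 5F ∷ 4F ∷ 1F ∷ 2F ∷ 0F ∷ 0F ∷ 0F ∷ 3F ∷ 0F ∷ [])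
               (A ∷ B ∷ D ∷ []) ((C , b₂) ∷ (c₂ , b₂) ∷ (c₁ , d) ∷ [])
               (no-leaf A f₀₁ ∷ B∉ ∷ D∉ f₃₂ ∷ [])
               ((λ Cb₂ → only-one f₂₁ Cb₁ Cb₂) ∷ (λ c₂b₂ → only-one f₂₁ c₂b₁ c₂b₂) ∷ ¬c₁d ∷ []))
        (no C∉) → case b₂ —? c₂ of λ where
          (yes b₂c₂) → inR10 (occurs R10 (5F ∷ 4F ∷ 3F ∷ 1F ∷ 2F ∷ 0F ∷ 0F ∷ 0F ∷ 0F ∷ 0F ∷ [])
            (A ∷ B ∷ C ∷ D ∷ []) ((b₁ , c₂) ∷ []) (no-leaf A f₀₁ ∷ B∉ ∷ C∉ ∷ D∉ f₃₂ ∷ [])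
            ((λ b₁c₂ → only-one f₂₁ (—-sym b₁c₂) (—-sym b₂c₂)) ∷ []))
          (no ¬b₂c₂) → inR5 (occurs R5 (0F ∷ 2F ∷ 1F ∷ 3F ∷ 4F ∷ 5F ∷ 0F ∷ 0F ∷ 0F ∷ 0F ∷ [])
            (A ∷ B ∷ C ∷ D ∷ []) ((b₂ , c₂) ∷ []) (no-leaf A f₀₁ ∷ B∉ ∷ C∉ ∷ D∉ f₃₂ ∷ [])
            (¬b₂c₂ ∷ []))
      where
      B∉ : ¬ Present B
      B∉ B∈ = let (Ba , Bc₁) = split-B B∈ in case split-b of λ where
        (inj₁ b₂c₁) → only-one f₂₁ (—-sym b₂c₁) (—-sym Bc₁)
        (inj₂ b₁a)  → only-one f₀₁ (—-sym b₁a) (—-sym Ba)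

  ix-sd : Vec (Fin 4) 5
  ix-sd = 0F ∷ 1F ∷ 2F ∷ 2F ∷ 3F ∷ []

  es-sd : List (Fin 5 × Fin 5)
  es-sd = (0F , 1F) ∷ (1F , 2F) ∷ (3F , 4F) ∷ []

  module PathSD {X : Fin 4 → Fin m} (S : Template 4 X ix-sd es-sd) where
    open Reasoning P irr joined S

    a b c₂ c₁ d A B C D : Fin 9
    a = 0F ; b = 1F ; c₂ = 2F ; c₁ = 3F ; d = 4F
    A = 5F ; B = 6F ; C = 7F ; D = 8F

    split-c : c₁ — b ⊎ c₂ — d
    split-c = case split c₁ c₂ (proj₁ (endpoints 3rd)) (proj₂ (endpoints 2nd)) of λ where
      (inj₁ (here p)) → inj₁ p
      (inj₂ (here p)) → inj₂ p

    split-B : Present B → B — a ⊎ B — c₂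
    split-B B∈ = case split B b B∈ (proj₂ (endpoints 1st)) of λ where
      (inj₁ (here p))         → inj₁ p
      (inj₁ (there (here p))) → inj₂ p

    module _ (C∉ : ¬ Present C) (no-V : B — a → ¬ B — c₂) where

      ¬Bc₂ : F 1F 2F → ¬ Present A → ¬ B — c₂
      ¬Bc₂ f₁₂ A∉ Bc₂ = case another-positive B c₂ (end₁ Bc₂) of λ where
        (here Ba)                         → no-V Ba Bc₂
        (there (here Bc₁))                → only-one f₁₂ Bc₂ Bc₁
        (there (there (here BA)))         → A∉ (end₁ (—-sym BA))
        (there (there (there (here BC)))) → C∉ (end₁ (—-sym BC))

      in-R1 : ¬ Present A → ¬ Present D → ¬ B — c₂ → Conclusion P
      in-R1 A∉ D∉ ¬Bc₂ = inR1 (occurs R1 (0F ∷ 2F ∷ 4F ∷ 3F ∷ 5F ∷ 0F ∷ 1F ∷ 0F ∷ 0F ∷ [])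
        (A ∷ C ∷ D ∷ []) ((B , c₂) ∷ []) (A∉ ∷ C∉ ∷ D∉ ∷ []) (¬Bc₂ ∷ []))

      -- The names tell from which variable functionality may fail. Beyond R1 this admits `A` at the
      -- left (R2), `D` at the right (R3) and, from the second variable, `B` with both `c₁` and `c₂`
      -- (R4); from the third it admits nothing new.
      from-left : F 1F 0F → F 1F 2F → F 3F 2F → Conclusion P
      from-left f₁₀ f₁₂ f₃₂ = case present? A of λ where
        (no A∉)  → in-R1 A∉ (no-leaf D f₃₂) (¬Bc₂ f₁₂ A∉)
        (yes A∈) →
          let AB  = case another-positive A b A∈ of λ { (here AB) → AB }
              ¬aB = λ aB → only-one f₁₀ (—-sym aB) (—-sym AB)
              Bc₂ = case split-B (end₁ (—-sym AB)) of λ where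
                      (inj₁ Ba)  → ⊥-elim (¬aB (—-sym Ba))
                      (inj₂ Bc₂) → Bc₂
          in inR2 (occurs R2 (1F ∷ 3F ∷ 5F ∷ 4F ∷ 6F ∷ 0F ∷ 2F ∷ 0F ∷ 0F ∷ [])
               (C ∷ D ∷ []) ((a , B) ∷ (B , c₁) ∷ [])
               (C∉ ∷ no-leaf D f₃₂ ∷ []) (¬aB ∷ (λ Bc₁ → only-one f₁₂ Bc₂ Bc₁) ∷ []))

      from-right : F 0F 1F → F 1F 2F → F 2F 1F → F 2F 3F → Conclusion P
      from-right f₀₁ f₁₂ f₂₁ f₂₃ = case present? D of λ where
          (no D∉)  → in-R1 A∉ D∉ (¬Bc₂ f₁₂ A∉)
          (yes D∈) →
            let Dc₂  = case another-positive D c₁ D∈ of λ where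
                         (here Dc₂)        → Dc₂
                         (there (here DC)) → ⊥-elim (C∉ (end₁ (—-sym DC)))
                ¬c₂d = λ c₂d → only-one f₂₃ c₂d (—-sym Dc₂)
                c₁b  = case split-c of λ where
                         (inj₁ c₁b) → c₁b
                         (inj₂ c₂d) → ⊥-elim (¬c₂d c₂d)
                B∉   = λ B∈ → case split-B B∈ of λ where
                         (inj₂ Bc₂) → ¬Bc₂ f₁₂ A∉ Bc₂
                         (inj₁ Ba)  → case another-positive B a B∈ of λ where
                           (here Bc₂)                → no-V Ba Bc₂
                           (there (here Bc₁))        → only-one f₂₁ c₁b (—-sym Bc₁)
                           (there (there (here BA))) → A∉ (end₁ (—-sym BA))
                           (there (there (there (here BC)))) → C∉ (end₁ (—-sym BC))
            in inR3 (occurs R3 (0F ∷ 1F ∷ 3F ∷ 2F ∷ 4F ∷ 0F ∷ 0F ∷ 0F ∷ 5F ∷ [])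
                 (A ∷ B ∷ C ∷ []) ((c₂ , d) ∷ []) (A∉ ∷ B∉ ∷ C∉ ∷ []) (¬c₂d ∷ []))
        where
        A∉ : ¬ Present A
        A∉ = no-leaf A f₀₁

      from-second : F 0F 1F → F 2F 1F → F 3F 2F → Conclusion P
      from-second f₀₁ f₂₁ f₃₂ = case B —? c₂ of λ where
          (no ¬Bc₂) → in-R1 A∉ (no-leaf D f₃₂) ¬Bc₂
          (yes Bc₂) →
            let Bc₁ = case another-positive B c₂ (end₁ Bc₂) of λ where
                        (here Ba)                         → ⊥-elim (no-V Ba Bc₂)
                        (there (here Bc₁))                → Bc₁
                        (there (there (here BA)))         → ⊥-elim (A∉ (end₁ (—-sym BA)))
                        (there (there (there (here BC)))) → ⊥-elim (C∉ (end₁ (—-sym BC)))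
            in inR4 (occurs R4 (0F ∷ 2F ∷ 4F ∷ 3F ∷ 5F ∷ 0F ∷ 1F ∷ 0F ∷ 0F ∷ [])
                 (A ∷ C ∷ D ∷ []) ((B , a) ∷ (b , c₁) ∷ []) (A∉ ∷ C∉ ∷ no-leaf D f₃₂ ∷ [])
                 ((λ Ba → no-V Ba Bc₂) ∷ (λ bc₁ → only-one f₂₁ (—-sym bc₁) (—-sym Bc₁)) ∷ []))
        where
        A∉ : ¬ Present A
        A∉ = no-leaf A f₀₁

      from-third : F 0F 1F → F 1F 2F → F 3F 2F → Conclusion P
      from-third f₀₁ f₁₂ f₃₂ = in-R1 (no-leaf A f₀₁) (no-leaf D f₃₂) (¬Bc₂ f₁₂ (no-leaf A f₀₁))

  ix-3d : Vec (Fin 3) 4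
  ix-3d = 0F ∷ 1F ∷ 1F ∷ 2F ∷ []

  es-3d : List (Fin 4 × Fin 4)
  es-3d = (0F , 1F) ∷ (2F , 3F) ∷ []

  module ShortPathD {X : Fin 3 → Fin m} (S : Template 3 X ix-3d es-3d) where
    open Reasoning P irr joined S

    a b₂ b₁ c A B C : Fin 7
    a = 0F ; b₂ = 1F ; b₁ = 2F ; c = 3F ; A = 4F ; B = 5F ; C = 6F

    split-b : b₂ — c ⊎ b₁ — a
    split-b = case split b₂ b₁ (proj₂ (endpoints 1st)) (proj₁ (endpoints 2nd)) of λ where
      (inj₁ (here p)) → inj₁ p
      (inj₂ (here p)) → inj₂ p

    split-B : Present B → B — a × B — c
    split-B B∈ = (case split B b₂ B∈ (proj₂ (endpoints 1st)) of λ { (inj₁ (here p)) → p }) ,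
                 (case split B b₁ B∈ (proj₁ (endpoints 2nd)) of λ { (inj₁ (here p)) → p })

    in-R5 : ¬ Present A → ¬ Present B → ¬ Present C → Conclusion P
    in-R5 A∉ B∉ C∉ = inR5 (occurs R5 (0F ∷ 2F ∷ 1F ∷ 3F ∷ 0F ∷ 0F ∷ 0F ∷ [])
      (A ∷ B ∷ C ∷ []) [] (A∉ ∷ B∉ ∷ C∉ ∷ []) [])

    inwards : F 1F 0F → F 2F 1F → Conclusion P
    inwards f₁₀ f₂₁ = case present? B of λ where
        (yes B∈) →
          let (Ba , Bc) = split-B B∈
              ¬b₂c = λ b₂c → only-one f₂₁ (—-sym b₂c) (—-sym Bc)
              b₁a  = case split-b of λ where
                       (inj₁ b₂c) → ⊥-elim (¬b₂c b₂c)
                       (inj₂ b₁a) → b₁a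
              A∉   = λ A∈ → case another-positive A b₂ A∈ of λ where
                       (here Ab₁)        → only-one f₁₀ b₁a (—-sym Ab₁)
                       (there (here AB)) → only-one f₁₀ Ba (—-sym AB)
          in inR8 (occurs R8 (0F ∷ 2F ∷ 1F ∷ 4F ∷ 0F ∷ 3F ∷ 0F ∷ [])
               (A ∷ C ∷ []) ((b₂ , c) ∷ []) (A∉ ∷ C∉ ∷ []) (¬b₂c ∷ []))
        (no B∉) → case present? A of λ where
          (no A∉)  → in-R5 A∉ B∉ C∉
          (yes A∈) →
            let Ab₁ = case another-positive A b₂ A∈ of λ where
                        (here Ab₁)        → Ab₁
                        (there (here AB)) → ⊥-elim (B∉ (end₁ (—-sym AB)))
            in inR6 (occurs R6 (1F ∷ 3F ∷ 2F ∷ 4F ∷ 0F ∷ 0F ∷ 0F ∷ [])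
                 (B ∷ C ∷ []) ((a , b₁) ∷ []) (B∉ ∷ C∉ ∷ [])
                 ((λ ab₁ → only-one f₁₀ (—-sym ab₁) (—-sym Ab₁)) ∷ []))
      where
      C∉ : ¬ Present C
      C∉ = no-leaf C f₂₁

    outwards : F 0F 1F → F 2F 1F → Conclusion P
    outwards f₀₁ f₂₁ = in-R5 (no-leaf A f₀₁)
      (λ B∈ → let (Ba , Bc) = split-B B∈ in case split-b of λ where
        (inj₁ b₂c) → only-one f₂₁ (—-sym b₂c) (—-sym Bc)
        (inj₂ b₁a) → only-one f₀₁ (—-sym b₁a) (—-sym Ba))
      (no-leaf C f₂₁)

  ix-3s : Vec (Fin 3) 3
  ix-3s = 0F ∷ 1F ∷ 2F ∷ []

  es-3s : List (Fin 3 × Fin 3)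
  es-3s = (0F , 1F) ∷ (1F , 2F) ∷ []

  module ShortPathS {X : Fin 3 → Fin m} (S : Template 3 X ix-3s es-3s) where
    open Reasoning P irr joined S

    a b c A B C : Fin 6
    a = 0F ; b = 1F ; c = 2F ; A = 3F ; B = 4F ; C = 5F

    split-B : Present B → B — a ⊎ B — c
    split-B B∈ = case split B b B∈ (proj₂ (endpoints 1st)) of λ where
      (inj₁ (here p))         → inj₁ p
      (inj₁ (there (here p))) → inj₂ p

    module _ (no-V : B — a → ¬ B — c) where

      in-R1 : ¬ Present A → ¬ Present C → Conclusion P
      in-R1 A∉ C∉ = inR1 (occurs R1 (0F ∷ 2F ∷ 4F ∷ 0F ∷ 0F ∷ 0F ∷ [])
        (A ∷ B ∷ C ∷ []) [] (A∉ ∷ B∉ ∷ C∉ ∷ []) [])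
        where
        B∉ : ¬ Present B
        B∉ B∈ = case split-B B∈ of λ where
          (inj₁ Ba) → case another-positive B a B∈ of λ where
            (here Bc)                 → no-V Ba Bc
            (there (here BA))         → A∉ (end₁ (—-sym BA))
            (there (there (here BC))) → C∉ (end₁ (—-sym BC))
          (inj₂ Bc) → case another-positive B c B∈ of λ where
            (here Ba)                 → no-V Ba Bc
            (there (here BA))         → A∉ (end₁ (—-sym BA))
            (there (there (here BC))) → C∉ (end₁ (—-sym BC))

      inwards : F 1F 0F → F 2F 1F → Conclusion P
      inwards f₁₀ f₂₁ = case present? A of λ where
        (no A∉)  → in-R1 A∉ (no-leaf C f₂₁)
        (yes A∈) →
          let AB = case another-positive A b A∈ of λ { (here AB) → AB }
          in inR2 (occurs R2 (1F ∷ 3F ∷ 5F ∷ 0F ∷ 2F ∷ 0F ∷ [])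
               (C ∷ []) ((a , B) ∷ []) (no-leaf C f₂₁ ∷ [])
               ((λ aB → only-one f₁₀ (—-sym aB) (—-sym AB)) ∷ []))

      outwards : F 0F 1F → F 2F 1F → Conclusion P
      outwards f₀₁ f₂₁ = in-R1 (no-leaf A f₀₁) (no-leaf C f₂₁)

  ix-1 : Vec (Fin 2) 2
  ix-1 = 0F ∷ 1F ∷ []

  es-1 : List (Fin 2 × Fin 2)
  es-1 = (0F , 1F) ∷ []

  module SingleEdge {X : Fin 2 → Fin m} (S : Template 2 X ix-1 es-1) where
    open Reasoning P irr joined S

    a b A B : Fin 4
    a = 0F ; b = 1F ; A = 2F ; B = 3F

    -- By functionality an additional site at one of the variables would be dangling. Once it is
    -- absent, so is the other, whose second positive edge would end there. A bare negative edge
    -- remains.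
    conclude : F 0F 1F ⊎ F 1F 0F → Conclusion P
    conclude f = inR5 (occurs R5 (0F ∷ 2F ∷ 0F ∷ 0F ∷ []) (A ∷ B ∷ []) [] (A∉ ∷ B∉ ∷ []) [])
      where
      A∉ : ¬ Present A
      A∉ A∈ = case f of λ where
        (inj₁ f₀₁) → no-leaf A f₀₁ A∈
        (inj₂ f₁₀) → case another-positive A b A∈ of λ { (here AB) → no-leaf B f₁₀ (end₁ (—-sym AB)) }
      B∉ : ¬ Present B
      B∉ B∈ = case f of λ where
        (inj₂ f₁₀) → no-leaf B f₁₀ B∈
        (inj₁ f₀₁) → case another-positive B a B∈ of λ { (here BA) → no-leaf A f₀₁ (end₁ (—-sym BA)) }

  ix-2 : Vec (Fin 4) 4
  ix-2 = 0F ∷ 1F ∷ 2F ∷ 3F ∷ []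

  es-2 : List (Fin 4 × Fin 4)
  es-2 = (0F , 1F) ∷ (2F , 3F) ∷ []

  module TwoEdges {X : Fin 4 → Fin m} (S : Template 4 X ix-2 es-2) where
    open Reasoning P irr joined S

    a b c d A B C D : Fin 8
    a = 0F ; b = 1F ; c = 2F ; d = 3F
    A = 4F ; B = 5F ; C = 6F ; D = 7F

    conclude : F 0F 1F ⊎ F 1F 0F → F 2F 3F ⊎ F 3F 2F → Conclusion P
    conclude f g = inR5 (occurs R5 (0F ∷ 2F ∷ 4F ∷ 5F ∷ 0F ∷ 0F ∷ 0F ∷ 0F ∷ [])
        (A ∷ B ∷ C ∷ D ∷ []) [] (A∉ ∷ B∉ ∷ C∉ ∷ D∉ ∷ []) [])
      where
      A∉ : ¬ Present A
      A∉ A∈ = case f of λ where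
        (inj₁ f₀₁) → no-leaf A f₀₁ A∈
        (inj₂ f₁₀) → case another-positive A b A∈ of λ { (here AB) → no-leaf B f₁₀ (end₁ (—-sym AB)) }
      B∉ : ¬ Present B
      B∉ B∈ = case f of λ where
        (inj₂ f₁₀) → no-leaf B f₁₀ B∈
        (inj₁ f₀₁) → case another-positive B a B∈ of λ { (here BA) → no-leaf A f₀₁ (end₁ (—-sym BA)) }
      C∉ : ¬ Present C
      C∉ C∈ = case g of λ where
        (inj₁ f₂₃) → no-leaf C f₂₃ C∈
        (inj₂ f₃₂) → case another-positive C d C∈ of λ { (here CD) → no-leaf D f₃₂ (end₁ (—-sym CD)) }
      D∉ : ¬ Present D
      D∉ D∈ = case g of λ where
        (inj₂ f₃₂) → no-leaf D f₃₂ D∈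
        (inj₁ f₂₃) → case another-positive D c D∈ of λ { (here DC) → no-leaf C f₂₃ (end₁ (—-sym DC)) }

  ix-star : Vec (Fin 4) 6
  ix-star = 0F ∷ 1F ∷ 2F ∷ 3F ∷ 3F ∷ 3F ∷ []

  es-star : List (Fin 6 × Fin 6)
  es-star = (0F , 3F) ∷ (1F , 4F) ∷ (2F , 5F) ∷ []

  module StarDDD {X : Fin 4 → Fin m} (S : Template 4 X ix-star es-star) where
    open Reasoning P irr joined S

    p q r u v w P₀ Q₀ R₀ M : Fin 10
    p = 0F ; q = 1F ; r = 2F ; u = 3F ; v = 4F ; w = 5F
    P₀ = 6F ; Q₀ = 7F ; R₀ = 8F ; M = 9F

    split-uv : u — q ⊎ v — p
    split-uv = case split u v (proj₂ (endpoints 1st)) (proj₂ (endpoints 2nd)) of λ where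
      (inj₁ (here e)) → inj₁ e
      (inj₂ (here e)) → inj₂ e

    split-uw : u — r ⊎ w — p
    split-uw = case split u w (proj₂ (endpoints 1st)) (proj₂ (endpoints 3rd)) of λ where
      (inj₁ (here e)) → inj₁ e
      (inj₂ (here e)) → inj₂ e

    split-vw : v — r ⊎ w — q
    split-vw = case split v w (proj₂ (endpoints 2nd)) (proj₂ (endpoints 3rd)) of λ where
      (inj₁ (here e)) → inj₁ e
      (inj₂ (here e)) → inj₂ e

    -- Each of the three pairs among `u`, `v`, `w` needs a separating positive edge, but each leaf
    -- admits only one into the centre. The first choice therefore forces the others cyclically; the
    -- two cyclic orders differ by exchanging `q` and `r` in Q1.
    conclude : F 0F 3F → F 1F 3F → F 2F 3F → Conclusion P
    conclude f₀ f₁ f₂ = case split-uv of λ where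
        (inj₂ vp) →
          let ¬wp = λ wp → only-one f₀ (—-sym vp) (—-sym wp)
              ur  = case split-uw of λ { (inj₁ ur) → ur ; (inj₂ wp) → ⊥-elim (¬wp wp) }
              ¬vr = λ vr → only-one f₂ (—-sym ur) (—-sym vr)
              wq  = case split-vw of λ { (inj₁ vr) → ⊥-elim (¬vr vr) ; (inj₂ wq) → wq }
          in inQ1 (occurs Q1 (0F ∷ 1F ∷ 2F ∷ 4F ∷ 5F ∷ 3F ∷ 0F ∷ 0F ∷ 0F ∷ 0F ∷ [])
               (P₀ ∷ Q₀ ∷ R₀ ∷ M ∷ []) ((w , p) ∷ (v , r) ∷ (u , q) ∷ []) absences
               (¬wp ∷ ¬vr ∷ (λ uq → only-one f₁ (—-sym uq) (—-sym wq)) ∷ []))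
        (inj₁ uq) →
          let ¬wq = λ wq → only-one f₁ (—-sym uq) (—-sym wq)
              vr  = case split-vw of λ { (inj₁ vr) → vr ; (inj₂ wq) → ⊥-elim (¬wq wq) }
              ¬ur = λ ur → only-one f₂ (—-sym ur) (—-sym vr)
              wp  = case split-uw of λ { (inj₁ ur) → ⊥-elim (¬ur ur) ; (inj₂ wp) → wp }
          in inQ1 (occurs Q1 (0F ∷ 2F ∷ 1F ∷ 4F ∷ 3F ∷ 5F ∷ 0F ∷ 0F ∷ 0F ∷ 0F ∷ [])
               (P₀ ∷ Q₀ ∷ R₀ ∷ M ∷ []) ((w , q) ∷ (u , r) ∷ (v , p) ∷ []) absences
               (¬wq ∷ ¬ur ∷ (λ vp → only-one f₀ (—-sym vp) (—-sym wp)) ∷ []))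
      where
      M∉ : ¬ Present M
      M∉ M∈ =
        let Mp = case split M u M∈ (proj₂ (endpoints 1st)) of λ { (inj₁ (here e)) → e }
            Mq = case split M v M∈ (proj₂ (endpoints 2nd)) of λ { (inj₁ (here e)) → e }
        in case split-uv of λ where
          (inj₁ uq) → only-one f₁ (—-sym uq) (—-sym Mq)
          (inj₂ vp) → only-one f₀ (—-sym vp) (—-sym Mp)
      absences : All (¬_ ∘ Present) (P₀ ∷ Q₀ ∷ R₀ ∷ M ∷ [])
      absences = no-leaf P₀ f₀ ∷ no-leaf Q₀ f₁ ∷ no-leaf R₀ f₂ ∷ M∉ ∷ []

  ix-ssd : Vec (Fin 4) 5
  ix-ssd = 0F ∷ 1F ∷ 2F ∷ 3F ∷ 3F ∷ []

  es-ssd : List (Fin 5 × Fin 5)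
  es-ssd = (0F , 3F) ∷ (1F , 3F) ∷ (2F , 4F) ∷ []

  module StarSSD {X : Fin 4 → Fin m} (S : Template 4 X ix-ssd es-ssd) where
    open Reasoning P irr joined S

    p q r u v P₀ Q₀ R₀ M : Fin 9
    p = 0F ; q = 1F ; r = 2F ; u = 3F ; v = 4F
    P₀ = 5F ; Q₀ = 6F ; R₀ = 7F ; M = 8F

    -- Q2 has only one of the edges from `v` to the two leaves clashing with `u`. Not both can be
    -- present, and exchanging these leaves covers either one.
    conclude : ¬ Present M → (v — p → ¬ v — q) → F 0F 3F → F 1F 3F → F 2F 3F → Conclusion P
    conclude M∉ no-V f₀ f₁ f₂ = case v —? q of λ where
        (no ¬vq) → inQ2 (occurs Q2 (0F ∷ 1F ∷ 2F ∷ 4F ∷ 3F ∷ 0F ∷ 0F ∷ 0F ∷ 0F ∷ [])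
          (P₀ ∷ Q₀ ∷ R₀ ∷ M ∷ []) ((v , q) ∷ []) absences (¬vq ∷ []))
        (yes vq) → inQ2 (occurs Q2 (1F ∷ 0F ∷ 2F ∷ 4F ∷ 3F ∷ 0F ∷ 0F ∷ 0F ∷ 0F ∷ [])
          (P₀ ∷ Q₀ ∷ R₀ ∷ M ∷ []) ((v , p) ∷ []) absences ((λ vp → no-V vp vq) ∷ []))
      where
      absences : All (¬_ ∘ Present) (P₀ ∷ Q₀ ∷ R₀ ∷ M ∷ [])
      absences = no-leaf P₀ f₀ ∷ no-leaf Q₀ f₁ ∷ no-leaf R₀ f₂ ∷ M∉ ∷ []

-- Combining the restrictions from the instances

module Main {m k : ℕ} (P : Pattern (Fin m) (Fin k))
  (monotone : Monotone P) (irr : Irreducible P) (solvable : SACSolvable P) where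

  neg-joined : NegJoined P
  neg-joined = joined-by-neg P monotone irr

  colouring-embedding : ∃ (Embeds P Colouring.colouring)
  colouring-embedding = embedding P Colouring.colouring solvable Colouring.fails

  pigeons-embedding : ∃ (Embeds P Pigeons.pigeons)
  pigeons-embedding = embedding P Pigeons.pigeons solvable Pigeons.fails

  clauses-embedding : ∃ (Embeds P Clauses.subdivision)
  clauses-embedding = embedding P Clauses.subdivision solvable Clauses.fails

  square-embedding : ∃ (Embeds P Square.square)
  square-embedding = embedding P Square.square solvable Square.fails

  infix 4 _~_ _~?_
  _~_ : Fin k → Fin k → Set
  a ~ b = var P a ≡ var P b

  _~?_ : ∀ a b → Dec (a ~ b)
  a ~? b = var P a ≟ var P b

  no-five : (ps : Vec (Fin k) 5) → ¬ Unique (Vec.map (var P) ps)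
  no-five ps unique =
    let (g , e) = colouring-embedding
        (i , j , i<j , eq) = pigeonhole ≤-refl (λ i → proj₁ (g (lookup ps i)))
    in <⇒≢ i<j (lookup-injective unique i j
         (trans (lookup-map i (var P) ps) (trans (Embeds.at⇒var e eq) (sym (lookup-map j (var P) ps)))))

  no-V : ∀ {a b c B} → Neg P b a → Neg P b c → var P a ≢ var P c → var P B ≡ var P b → Pos P B a → Pos P B c → ⊥
  no-V = Pigeons.no-V (proj₂ pigeons-embedding)

  private
    in-clauses = proj₂ clauses-embedding
    in-square = proj₂ square-embedding

  neg-unique : ∀ {p q a b} → Neg P p q → Neg P a b → p ~ a → q ~ b → p ≡ a × q ≡ b
  neg-unique pq ab p~a q~b = Clauses.neg-unique irr in-clauses pq ab p~a q~b ,
    Clauses.neg-unique irr in-clauses (neg-sym P pq) (neg-sym P ab) q~b p~a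

  no-triangle : ∀ {a b b′ c c′ a′} → Neg P a b → Neg P b′ c → Neg P c′ a′ → b ~ b′ → c ~ c′ → a′ ~ a → ⊥
  no-triangle = Clauses.no-triangle irr in-clauses

  no-square : ∀ {a b b′ c c′ d d′ a′} → Neg P a b → Neg P b′ c → Neg P c′ d → Neg P d′ a′ →
    b ~ b′ → c ~ c′ → d ~ d′ → a′ ~ a → ¬ a ~ c → ¬ b ~ d → ⊥
  no-square = Clauses.no-square irr in-clauses

  open Square using (Kind; lineᵏ; copyᵏ; cellᵏ; NoArrow; Kinds₃; at-line; at-cell; inwards; outwards)

  kindOf : Fin k → Kind
  kindOf = Square.kindOf irr in-square neg-joined

  functional : ∀ {a b} → NoArrow (kindOf a) (kindOf b) → Functional P (var P a) (var P b)
  functional = Square.functional irr in-square neg-joined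

  kinds : ∀ {a b b′ c} → Neg P a b → b ~ b′ → Neg P b′ c → ¬ a ~ c → Kinds₃ (kindOf a) (kindOf b) (kindOf c)
  kinds {a} {b} {b′} {c} ab b~b′ b′c a≁c = Square.kinds₃ _ _ _
    (Square.neg⇒adjacent irr in-square neg-joined ab)
    (subst (λ x → Square.Adjacent x _) (sym (Embeds.var⇒at in-square b~b′)) (Square.neg⇒adjacent irr in-square neg-joined b′c))
    (a≁c ∘ Embeds.at⇒var in-square)

  functional-at : ∀ {a a′ b b′} → a ~ a′ → b ~ b′ → NoArrow (kindOf a) (kindOf b) →
    Functional P (var P a′) (var P b′)
  functional-at a~ b~ none = subst₂ (Functional P) a~ b~ (functional none)

  functional-one-way : ∀ a b → Functional P (var P a) (var P b) ⊎ Functional P (var P b) (var P a)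
  functional-one-way a b with kindOf a in eq
  ... | lineᵏ = inj₁ (functional λ (eq′ , _) → case trans (sym eq) eq′ of λ ())
  ... | copyᵏ = inj₁ (functional λ (eq′ , _) → case trans (sym eq) eq′ of λ ())
  ... | cellᵏ = inj₂ (functional λ (_ , eq′) → case trans (sym eq) eq′ of λ ())

  -- In the case left (right), functionality can fail only from the first to the
  -- second variable of a path (from the last to the one before it). In the other
  -- cases it can fail only from the variable named by the case to its neighbours.
  data Arrows₃ (κ₁ κ₂ κ₃ : Kind) : Set where
    left   : NoArrow κ₂ κ₁ → NoArrow κ₃ κ₂ → Arrows₃ κ₁ κ₂ κ₃
    right  : NoArrow κ₂ κ₃ → NoArrow κ₁ κ₂ → Arrows₃ κ₁ κ₂ κ₃
    middle : NoArrow κ₁ κ₂ → NoArrow κ₃ κ₂ → Arrows₃ κ₁ κ₂ κ₃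

  arrows₃ : ∀ {κ₁ κ₂ κ₃} → Kinds₃ κ₁ κ₂ κ₃ → Arrows₃ κ₁ κ₂ κ₃
  arrows₃ at-line  = left (λ ()) (λ ())
  arrows₃ at-cell  = middle (λ ()) (λ ())
  arrows₃ inwards  = left (λ ()) (λ ())
  arrows₃ outwards = right (λ ()) (λ ())

  data Arrows₄ (κ₁ κ₂ κ₃ κ₄ : Kind) : Set where
    left   : NoArrow κ₂ κ₁ → NoArrow κ₂ κ₃ → NoArrow κ₃ κ₂ → NoArrow κ₃ κ₄ → NoArrow κ₄ κ₃ → Arrows₄ κ₁ κ₂ κ₃ κ₄
    right  : NoArrow κ₃ κ₄ → NoArrow κ₃ κ₂ → NoArrow κ₂ κ₃ → NoArrow κ₂ κ₁ → NoArrow κ₁ κ₂ → Arrows₄ κ₁ κ₂ κ₃ κ₄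
    second : NoArrow κ₁ κ₂ → NoArrow κ₃ κ₂ → NoArrow κ₃ κ₄ → NoArrow κ₄ κ₃ → Arrows₄ κ₁ κ₂ κ₃ κ₄
    third  : NoArrow κ₄ κ₃ → NoArrow κ₂ κ₃ → NoArrow κ₂ κ₁ → NoArrow κ₁ κ₂ → Arrows₄ κ₁ κ₂ κ₃ κ₄

  arrows₄ : ∀ {κ₁ κ₂ κ₃ κ₄} → Kinds₃ κ₁ κ₂ κ₃ → Kinds₃ κ₂ κ₃ κ₄ → Arrows₄ κ₁ κ₂ κ₃ κ₄
  arrows₄ at-line  outwards = right (λ ()) (λ ()) (λ ()) (λ ()) (λ ())
  arrows₄ at-cell  inwards  = second (λ ()) (λ ()) (λ ()) (λ ())
  arrows₄ inwards  at-line  = left (λ ()) (λ ()) (λ ()) (λ ()) (λ ())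
  arrows₄ outwards at-cell  = third (λ ()) (λ ()) (λ ()) (λ ())

  -- Around a copy, any two different neighbours are of different kinds, line and cell; three
  -- pairwise different neighbours do not fit.
  star-centre : ∀ {κ κ₁ κ₂ κ₃} → Kinds₃ κ₁ κ κ₂ → Kinds₃ κ₁ κ κ₃ → Kinds₃ κ₂ κ κ₃ → κ ≢ copyᵏ
  star-centre inwards  inwards  ()
  star-centre outwards outwards ()
  star-centre at-line  _ _ ()
  star-centre at-cell  _ _ ()

  open Classification P irr neg-joined
  open Conclude P

  distinct₂ : ∀ {a b} → ¬ a ~ b → Unique (Vec.map (var P) (a ∷ b ∷ []))
  distinct₂ ab = (ab ∷ []) VAP.∷ [] VAP.∷ VAP.[]

  distinct₃ : ∀ {a b c} → ¬ a ~ b → ¬ a ~ c → ¬ b ~ c → Unique (Vec.map (var P) (a ∷ b ∷ c ∷ []))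
  distinct₃ ab ac bc = (ab ∷ ac ∷ []) VAP.∷ distinct₂ bc

  distinct₄ : ∀ {a b c d} → ¬ a ~ b → ¬ a ~ c → ¬ a ~ d → ¬ b ~ c → ¬ b ~ d → ¬ c ~ d →
    Unique (Vec.map (var P) (a ∷ b ∷ c ∷ d ∷ []))
  distinct₄ ab ac ad bc bd cd = (ab ∷ ac ∷ ad ∷ []) VAP.∷ distinct₃ bc bd cd

  locate : ∀ {a b c d} → Unique (Vec.map (var P) (a ∷ b ∷ c ∷ d ∷ [])) → ∀ p → p ~ a ⊎ p ~ b ⊎ p ~ c ⊎ p ~ d
  locate {a} {b} {c} {d} unique p with p ~? a | p ~? b | p ~? c | p ~? d
  ... | yes ~a | _      | _      | _      = inj₁ ~a
  ... | _      | yes ~b | _      | _      = inj₂ (inj₁ ~b)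
  ... | _      | _      | yes ~c | _      = inj₂ (inj₂ (inj₁ ~c))
  ... | _      | _      | _      | yes ~d = inj₂ (inj₂ (inj₂ ~d))
  ... | no ≁a  | no ≁b  | no ≁c  | no ≁d  =
    ⊥-elim (no-five (p ∷ a ∷ b ∷ c ∷ d ∷ []) ((≁a ∷ ≁b ∷ ≁c ∷ ≁d ∷ []) VAP.∷ unique))

  flip-joins : ∀ {p q} {es : List (Fin k × Fin k)} → Any (Joins q p) es → Any (Joins p q) es
  flip-joins = Any.map [ inj₂ ∘ swap , inj₁ ∘ swap ]′

  record Path (a b b′ c c′ d : Fin k) : Set where
    field
      ab  : Neg P a b
      bc  : Neg P b′ c
      cd  : Neg P c′ d
      b~  : b ~ b′
      c~  : c ~ c′
      a≁c : ¬ a ~ c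
      a≁d : ¬ a ~ d
      b≁d : ¬ b ~ d

    a≁b : ¬ a ~ b
    a≁b = neg-distinct P ab
    b≁c : ¬ b ~ c
    b≁c b~c = neg-distinct P bc (trans (sym b~) b~c)
    c≁d : ¬ c ~ d
    c≁d c~d = neg-distinct P cd (trans (sym c~) c~d)

    unique : Unique (Vec.map (var P) (a ∷ b ∷ c ∷ d ∷ []))
    unique = distinct₄ a≁b a≁c a≁d b≁c b≁d c≁d

    -- The path uses up the four variables, so any further negative edge would be parallel to one of
    -- the three or close a cycle of length three or four.
    complete : ∀ {p q} → Neg P p q → Any (Joins p q) ((a , b) ∷ (b′ , c) ∷ (c′ , d) ∷ [])
    complete {p} {q} pq with locate unique p | locate unique q
    ... | inj₁ pa | inj₁ qa = contradiction (trans pa (sym qa)) (neg-distinct P pq)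
    ... | inj₂ (inj₁ pb) | inj₂ (inj₁ qb) = contradiction (trans pb (sym qb)) (neg-distinct P pq)
    ... | inj₂ (inj₂ (inj₁ pc)) | inj₂ (inj₂ (inj₁ qc)) = contradiction (trans pc (sym qc)) (neg-distinct P pq)
    ... | inj₂ (inj₂ (inj₂ pd)) | inj₂ (inj₂ (inj₂ qd)) = contradiction (trans pd (sym qd)) (neg-distinct P pq)
    ... | inj₁ pa | inj₂ (inj₁ qb) = here (inj₁ (neg-unique pq ab pa qb))
    ... | inj₂ (inj₁ pb) | inj₁ qa = flip-joins (here (inj₁ (neg-unique (neg-sym P pq) ab qa pb)))
    ... | inj₂ (inj₁ pb) | inj₂ (inj₂ (inj₁ qc)) = there (here (inj₁ (neg-unique pq bc (trans pb b~) qc)))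
    ... | inj₂ (inj₂ (inj₁ pc)) | inj₂ (inj₁ qb) =
          flip-joins (there (here (inj₁ (neg-unique (neg-sym P pq) bc (trans qb b~) pc))))
    ... | inj₂ (inj₂ (inj₁ pc)) | inj₂ (inj₂ (inj₂ qd)) =
          there (there (here (inj₁ (neg-unique pq cd (trans pc c~) qd))))
    ... | inj₂ (inj₂ (inj₂ pd)) | inj₂ (inj₂ (inj₁ qc)) =
          flip-joins (there (there (here (inj₁ (neg-unique (neg-sym P pq) cd (trans qc c~) pd)))))
    ... | inj₁ pa | inj₂ (inj₂ (inj₁ qc)) = ⊥-elim (no-triangle ab bc (neg-sym P pq) b~ (sym qc) pa)
    ... | inj₂ (inj₂ (inj₁ pc)) | inj₁ qa = ⊥-elim (no-triangle ab bc pq b~ (sym pc) qa)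
    ... | inj₂ (inj₁ pb) | inj₂ (inj₂ (inj₂ qd)) = ⊥-elim (no-triangle bc cd (neg-sym P pq) c~ (sym qd) (trans pb b~))
    ... | inj₂ (inj₂ (inj₂ pd)) | inj₂ (inj₁ qb) = ⊥-elim (no-triangle bc cd pq c~ (sym pd) (trans qb b~))
    ... | inj₁ pa | inj₂ (inj₂ (inj₂ qd)) = ⊥-elim (no-square ab bc cd (neg-sym P pq) b~ c~ (sym qd) pa a≁c b≁d)
    ... | inj₂ (inj₂ (inj₂ pd)) | inj₁ qa = ⊥-elim (no-square ab bc cd pq b~ c~ (sym pd) qa a≁c b≁d)

  reverse : ∀ {a b b′ c c′ d} → Path a b b′ c c′ d → Path d c′ c b′ b a
  reverse path = record
    { ab = neg-sym P cd ; bc = neg-sym P bc ; cd = neg-sym P ab ; b~ = sym c~ ; c~ = sym b~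
    ; a≁c = λ d~b′ → b≁d (trans b~ (sym d~b′)) ; a≁d = a≁d ∘ sym ; b≁d = λ c′~a → a≁c (sym (trans c~ c′~a)) }
    where open Path path

  path-arrows : ∀ {a b b′ c c′ d} → Path a b b′ c c′ d → Arrows₄ (kindOf a) (kindOf b) (kindOf c) (kindOf d)
  path-arrows {b = b} {b′} {c} path = arrows₄ (kinds ab b~ bc a≁c)
    (subst (λ κ → Kinds₃ κ _ _) (cong Square.kind (sym (Embeds.var⇒at in-square b~))) (kinds bc c~ cd λ b′~d → b≁d (trans b~ b′~d)))
    where open Path path

  template-dd : ∀ {a b b′ c c′ d} → Path a b b′ c c′ d → b ≢ b′ → c ≢ c′ →
    Template 4 (lookup (Vec.map (var P) (a ∷ b ∷ c ∷ d ∷ []))) ix-dd es-dd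
  template-dd {a} {b} {b′} {c} {c′} {d} path b≢b′ c≢c′ = skeleton P irr neg-joined ix-dd es-dd
    ((1F , 2F) ∷ (3F , 4F) ∷ [])
    (Vec.map (var P) (a ∷ b ∷ c ∷ d ∷ [])) (a ∷ b ∷ b′ ∷ c ∷ c′ ∷ d ∷ []) unique
    (λ { 0F → refl ; 1F → refl ; 2F → sym b~ ; 3F → refl ; 4F → sym c~ ; 5F → refl })
    (b≢b′ ∷ c≢c′ ∷ []) (ab ∷ bc ∷ cd ∷ []) complete
    where open Path path

  path-dd : ∀ {a b b′ c c′ d} → Path a b b′ c c′ d → b ≢ b′ → c ≢ c′ → Conclusion P
  path-dd {a} {b} {b′} {c} {c′} {d} path b≢b′ c≢c′ = case path-arrows path of λ where
      (left n₁ n₂ n₃ n₄ n₅) → PathDD.inwards (template-dd path b≢b′ c≢c′)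
        (functional n₁) (functional n₂) (functional n₃) (functional n₄) (functional n₅)
      (second n₁ n₂ n₃ n₄) → PathDD.outwards (template-dd path b≢b′ c≢c′)
        (functional n₁) (functional n₂) (functional n₃) (functional n₄)
      (right n₁ n₂ n₃ n₄ n₅) → PathDD.inwards (template-dd (reverse path) (c≢c′ ∘ sym) (b≢b′ ∘ sym))
        (functional-at c~ refl n₁) (functional-at c~ b~ n₂) (functional-at b~ c~ n₃)
        (functional-at b~ refl n₄) (functional-at refl b~ n₅)
      (third n₁ n₂ n₃ n₄) → PathDD.outwards (template-dd (reverse path) (c≢c′ ∘ sym) (b≢b′ ∘ sym))
        (functional-at refl c~ n₁) (functional-at b~ c~ n₂) (functional-at b~ refl n₃) (functional-at refl b~ n₄)
    where
    open Path path using (b~; c~)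

  path-sd : ∀ {a b c c′ d} → Path a b b c c′ d → c ≢ c′ → Conclusion P
  path-sd {a} {b} {c} {c′} {d} path c≢c′ = case path-arrows path of λ where
      (left n₁ n₂ _ _ n₅)   → from-left C∉ no-V′ (functional n₁) (functional n₂) (functional n₅)
      (right n₁ n₂ n₃ _ n₅) → from-right C∉ no-V′ (functional n₅) (functional n₃) (functional n₂) (functional n₁)
      (second n₁ n₂ _ n₄)   → from-second C∉ no-V′ (functional n₁) (functional n₂) (functional n₄)
      (third n₁ n₂ _ n₄)    → from-third C∉ no-V′ (functional n₄) (functional n₂) (functional n₁)
    where
    open Path path
    template : Template 4 (lookup (Vec.map (var P) (a ∷ b ∷ c ∷ d ∷ []))) ix-sd es-sd
    template = skeleton P irr neg-joined ix-sd es-sd ((2F , 3F) ∷ [])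
      (Vec.map (var P) (a ∷ b ∷ c ∷ d ∷ [])) (a ∷ b ∷ c ∷ c′ ∷ d ∷ []) unique
      (λ { 0F → refl ; 1F → refl ; 2F → refl ; 3F → sym c~ ; 4F → refl })
      (c≢c′ ∷ []) (ab ∷ bc ∷ cd ∷ []) complete
    open PathSD template
    open Reasoning P irr neg-joined template
    no-V′ : 6F — 0F → ¬ 6F — 2F
    no-V′ = V-free no-V {1F} {0F} {2F} {6F} (inj₂ 1st) (inj₁ 2nd) (λ ()) refl
    -- The second variable has one point with two negative edges, to `a` and to `c₂`, so the
    -- variable of `c₂` has room for `c₂` and `c₁` only.
    C∉ : ¬ Present 7F
    C∉ (r , r≡) =
      let (p , q , p≡ , q≡ , pq)     = ⇒neg 1st
          (q′ , s , q′≡ , s≡ , q′s)  = ⇒neg 2nd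
          (t , _ , t≡ , _)           = ⇒neg 3rd
      in Clauses.branch-neighbour irr in-clauses q′s (subst (λ q → Neg P q p) (site-injective (trans q≡ (sym q′≡))) (neg-sym P pq))
           (site-apart s≡ p≡ λ ()) (same-variable s≡ t≡ refl) (same-variable s≡ r≡ refl)
           (site-apart s≡ t≡ λ ()) (site-apart s≡ r≡ λ ()) (site-apart t≡ r≡ λ ())

  record ShortPath (a b b′ c : Fin k) : Set where
    field
      ab  : Neg P a b
      bc  : Neg P b′ c
      b~  : b ~ b′
      a≁c : ¬ a ~ c

    a≁b : ¬ a ~ b
    a≁b = neg-distinct P ab
    b≁c : ¬ b ~ c
    b≁c b~c = neg-distinct P bc (trans (sym b~) b~c)

    unique : Unique (Vec.map (var P) (a ∷ b ∷ c ∷ []))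
    unique = distinct₃ a≁b a≁c b≁c

    Inside : Fin k → Set
    Inside p = p ~ a ⊎ p ~ b ⊎ p ~ c

    inside? : ∀ p → Dec (Inside p)
    inside? p = (p ~? a) ⊎-dec (p ~? b) ⊎-dec (p ~? c)

    complete : (∀ {p q} → Neg P p q → Inside q) → ∀ {p q} → Neg P p q → Any (Joins p q) ((a , b) ∷ (b′ , c) ∷ [])
    complete inside {p} {q} pq with inside (neg-sym P pq) | inside pq
    ... | inj₁ pa | inj₁ qa = contradiction (trans pa (sym qa)) (neg-distinct P pq)
    ... | inj₂ (inj₁ pb) | inj₂ (inj₁ qb) = contradiction (trans pb (sym qb)) (neg-distinct P pq)
    ... | inj₂ (inj₂ pc) | inj₂ (inj₂ qc) = contradiction (trans pc (sym qc)) (neg-distinct P pq)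
    ... | inj₁ pa | inj₂ (inj₁ qb) = here (inj₁ (neg-unique pq ab pa qb))
    ... | inj₂ (inj₁ pb) | inj₁ qa = flip-joins (here (inj₁ (neg-unique (neg-sym P pq) ab qa pb)))
    ... | inj₂ (inj₁ pb) | inj₂ (inj₂ qc) = there (here (inj₁ (neg-unique pq bc (trans pb b~) qc)))
    ... | inj₂ (inj₂ pc) | inj₂ (inj₁ qb) =
          flip-joins (there (here (inj₁ (neg-unique (neg-sym P pq) bc (trans qb b~) pc))))
    ... | inj₁ pa | inj₂ (inj₂ qc) = ⊥-elim (no-triangle ab bc (neg-sym P pq) b~ (sym qc) pa)
    ... | inj₂ (inj₂ pc) | inj₁ qa = ⊥-elim (no-triangle ab bc pq b~ (sym pc) qa)

  reverse-short : ∀ {a b b′ c} → ShortPath a b b′ c → ShortPath c b′ b a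
  reverse-short path = record { ab = neg-sym P bc ; bc = neg-sym P ab ; b~ = sym b~ ; a≁c = a≁c ∘ sym }
    where open ShortPath path

  short-path-arrows : ∀ {a b b′ c} → ShortPath a b b′ c → Arrows₃ (kindOf a) (kindOf b) (kindOf c)
  short-path-arrows path = arrows₃ (kinds ab b~ bc a≁c)
    where open ShortPath path

  template-3d : ∀ {a b b′ c} (path : ShortPath a b b′ c) → (∀ {p q} → Neg P p q → ShortPath.Inside path q) →
    b ≢ b′ → Template 3 (lookup (Vec.map (var P) (a ∷ b ∷ c ∷ []))) ix-3d es-3d
  template-3d {a} {b} {b′} {c} path inside b≢b′ = skeleton P irr neg-joined ix-3d es-3d ((1F , 2F) ∷ [])
    (Vec.map (var P) (a ∷ b ∷ c ∷ [])) (a ∷ b ∷ b′ ∷ c ∷ []) unique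
    (λ { 0F → refl ; 1F → refl ; 2F → sym b~ ; 3F → refl })
    (b≢b′ ∷ []) (ab ∷ bc ∷ []) (complete inside)
    where open ShortPath path

  short-path-d : ∀ {a b b′ c} (path : ShortPath a b b′ c) →
    (∀ {p q} → Neg P p q → ShortPath.Inside path q) → b ≢ b′ → Conclusion P
  short-path-d {a} {b} {b′} {c} path inside b≢b′ = case short-path-arrows path of λ where
      (left n₁ n₂)   → ShortPathD.inwards (template-3d path inside b≢b′) (functional n₁) (functional n₂)
      (middle n₁ n₂) → ShortPathD.outwards (template-3d path inside b≢b′) (functional n₁) (functional n₂)
      (right n₁ n₂)  → ShortPathD.inwards (template-3d (reverse-short path) (inside-reverse ∘ inside) (b≢b′ ∘ sym))
                         (functional-at b~ refl n₁) (functional-at refl b~ n₂)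
    where
    open ShortPath path using (b~)
    inside-reverse : ∀ {q} → ShortPath.Inside path q → ShortPath.Inside (reverse-short path) q
    inside-reverse (inj₁ qa)        = inj₂ (inj₂ qa)
    inside-reverse (inj₂ (inj₁ qb)) = inj₂ (inj₁ (trans qb b~))
    inside-reverse (inj₂ (inj₂ qc)) = inj₁ qc

  short-path-s : ∀ {a b c} (path : ShortPath a b b c) →
    (∀ {p q} → Neg P p q → ShortPath.Inside path q) → Conclusion P
  short-path-s {a} {b} {c} path inside = case short-path-arrows path of λ where
      (left n₁ n₂)   → ShortPathS.inwards (template path inside) (no-V′ path inside) (functional n₁) (functional n₂)
      (middle n₁ n₂) → ShortPathS.outwards (template path inside) (no-V′ path inside) (functional n₁) (functional n₂)
      (right n₁ n₂)  → ShortPathS.inwards (template (reverse-short path) (inside-reverse ∘ inside))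
                         (no-V′ (reverse-short path) (inside-reverse ∘ inside)) (functional n₁) (functional n₂)
    where
    inside-reverse : ∀ {q} → ShortPath.Inside path q → ShortPath.Inside (reverse-short path) q
    inside-reverse (inj₁ qa)        = inj₂ (inj₂ qa)
    inside-reverse (inj₂ (inj₁ qb)) = inj₂ (inj₁ qb)
    inside-reverse (inj₂ (inj₂ qc)) = inj₁ qc
    template : ∀ {a b c} (path : ShortPath a b b c) → (∀ {p q} → Neg P p q → ShortPath.Inside path q) →
      Template 3 (lookup (Vec.map (var P) (a ∷ b ∷ c ∷ []))) ix-3s es-3s
    template {a} {b} {c} path inside = skeleton P irr neg-joined ix-3s es-3s []
      (Vec.map (var P) (a ∷ b ∷ c ∷ [])) (a ∷ b ∷ c ∷ []) unique
      (λ { 0F → refl ; 1F → refl ; 2F → refl }) [] (ab ∷ bc ∷ []) (complete inside)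
      where open ShortPath path
    no-V′ : ∀ {a b c} (path : ShortPath a b b c) (inside : ∀ {p q} → Neg P p q → ShortPath.Inside path q) →
      let open Reasoning P irr neg-joined (template path inside) in 4F — 0F → ¬ 4F — 2F
    no-V′ path inside = Reasoning.V-free P irr neg-joined (template path inside) no-V {1F} {0F} {2F} {4F}
      (inj₂ 1st) (inj₁ 2nd) (λ ()) refl

  record Star (a c f b b′ b″ : Fin k) : Set where
    field
      ab : Neg P a b
      cb : Neg P c b′
      fb : Neg P f b″
      b~ : b ~ b′
      b~′ : b ~ b″
      a≁c : ¬ a ~ c
      a≁f : ¬ a ~ f
      c≁f : ¬ c ~ f

    unique : Unique (Vec.map (var P) (a ∷ c ∷ f ∷ b ∷ []))
    unique = distinct₄ a≁c a≁f (neg-distinct P ab) c≁f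
      (λ c~b → neg-distinct P cb (trans c~b b~)) (λ f~b → neg-distinct P fb (trans f~b b~′))

    complete : ∀ {p q} → Neg P p q → Any (Joins p q) ((a , b) ∷ (c , b′) ∷ (f , b″) ∷ [])
    complete {p} {q} pq with locate unique p | locate unique q
    ... | inj₁ pa | inj₁ qa = contradiction (trans pa (sym qa)) (neg-distinct P pq)
    ... | inj₂ (inj₁ pc) | inj₂ (inj₁ qc) = contradiction (trans pc (sym qc)) (neg-distinct P pq)
    ... | inj₂ (inj₂ (inj₁ pf)) | inj₂ (inj₂ (inj₁ qf)) = contradiction (trans pf (sym qf)) (neg-distinct P pq)
    ... | inj₂ (inj₂ (inj₂ pb)) | inj₂ (inj₂ (inj₂ qb)) = contradiction (trans pb (sym qb)) (neg-distinct P pq)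
    ... | inj₁ pa | inj₂ (inj₂ (inj₂ qb)) = here (inj₁ (neg-unique pq ab pa qb))
    ... | inj₂ (inj₂ (inj₂ pb)) | inj₁ qa = flip-joins (here (inj₁ (neg-unique (neg-sym P pq) ab qa pb)))
    ... | inj₂ (inj₁ pc) | inj₂ (inj₂ (inj₂ qb)) = there (here (inj₁ (neg-unique pq cb pc (trans qb b~))))
    ... | inj₂ (inj₂ (inj₂ pb)) | inj₂ (inj₁ qc) =
          flip-joins (there (here (inj₁ (neg-unique (neg-sym P pq) cb qc (trans pb b~)))))
    ... | inj₂ (inj₂ (inj₁ pf)) | inj₂ (inj₂ (inj₂ qb)) =
          there (there (here (inj₁ (neg-unique pq fb pf (trans qb b~′)))))
    ... | inj₂ (inj₂ (inj₂ pb)) | inj₂ (inj₂ (inj₁ qf)) =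
          flip-joins (there (there (here (inj₁ (neg-unique (neg-sym P pq) fb qf (trans pb b~′))))))
    ... | inj₁ pa | inj₂ (inj₁ qc) = ⊥-elim (no-triangle ab (neg-sym P cb) (neg-sym P pq) b~ (sym qc) pa)
    ... | inj₂ (inj₁ pc) | inj₁ qa = ⊥-elim (no-triangle ab (neg-sym P cb) pq b~ (sym pc) qa)
    ... | inj₁ pa | inj₂ (inj₂ (inj₁ qf)) = ⊥-elim (no-triangle ab (neg-sym P fb) (neg-sym P pq) b~′ (sym qf) pa)
    ... | inj₂ (inj₂ (inj₁ pf)) | inj₁ qa = ⊥-elim (no-triangle ab (neg-sym P fb) pq b~′ (sym pf) qa)
    ... | inj₂ (inj₁ pc) | inj₂ (inj₂ (inj₁ qf)) =
          ⊥-elim (no-triangle cb (neg-sym P fb) (neg-sym P pq) (trans (sym b~) b~′) (sym qf) pc)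
    ... | inj₂ (inj₂ (inj₁ pf)) | inj₂ (inj₁ qc) =
          ⊥-elim (no-triangle cb (neg-sym P fb) pq (trans (sym b~) b~′) (sym pf) qc)

    centre : kindOf b ≢ copyᵏ
    centre = star-centre (kinds ab b~ (neg-sym P cb) a≁c) (kinds ab b~′ (neg-sym P fb) a≁f)
      (subst (λ κ → Kinds₃ _ κ _) (cong Square.kind (sym (Embeds.var⇒at in-square b~)))
        (kinds cb (trans (sym b~) b~′) (neg-sym P fb) c≁f))

    -- Arrows end at copies, and the centre is not a copy.
    functional-leaf : ∀ p → Functional P (var P p) (var P b)
    functional-leaf p = functional {p} {b} (centre ∘ proj₂)

  rotate : ∀ {a c f b b′ b″} → Star a c f b b′ b″ → Star c f a b′ b″ b
  rotate star = record { ab = cb ; cb = fb ; fb = ab ; b~ = trans (sym b~) b~′ ; b~′ = sym b~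
                       ; a≁c = c≁f ; a≁f = a≁c ∘ sym ; c≁f = a≁f ∘ sym }
    where open Star star

  star-ssd : ∀ {a c f b b″} → Star a c f b b b″ → b ≢ b″ → Conclusion P
  star-ssd {a} {c} {f} {b} {b″} star b≢b″ = StarSSD.conclude template M∉
      (λ vp vq → V-free no-V {3F} {0F} {1F} {4F} (inj₂ 1st) (inj₂ 2nd) (λ ()) refl vp vq)
      (functional-leaf a) (functional-leaf c) (functional-leaf f)
    where
    open Star star
    template : Template 4 (lookup (Vec.map (var P) (a ∷ c ∷ f ∷ b ∷ []))) ix-ssd es-ssd
    template = skeleton P irr neg-joined ix-ssd es-ssd ((3F , 4F) ∷ [])
      (Vec.map (var P) (a ∷ c ∷ f ∷ b ∷ [])) (a ∷ c ∷ f ∷ b ∷ b″ ∷ []) unique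
      (λ { 0F → refl ; 1F → refl ; 2F → refl ; 3F → refl ; 4F → sym b~′ })
      (b≢b″ ∷ []) (ab ∷ cb ∷ fb ∷ []) complete
    open Reasoning P irr neg-joined template
    -- Two negative edges to different variables share a point of the centre, which leaves the
    -- centre at most two points.
    M∉ : ¬ Present 8F
    M∉ (r , r≡) =
      let (p , u , p≡ , u≡ , pu)     = ⇒neg 1st
          (q , u′ , q≡ , u′≡ , qu′)  = ⇒neg 2nd
          (_ , v , _ , v≡ , _)       = ⇒neg 3rd
      in Clauses.branch-small irr in-clauses
           (neg-sym P pu) (subst (λ u → Neg P u q) (site-injective (trans u′≡ (sym u≡))) (neg-sym P qu′))
           (λ p~q → case trans (sym (cong (lookup (ix-ssd ++ Vec.allFin 4)) p≡))
              (trans (same-index p~q) (cong (lookup (ix-ssd ++ Vec.allFin 4)) q≡)) of λ ())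
           (same-variable u≡ v≡ refl) (same-variable u≡ r≡ refl)
           (site-apart u≡ v≡ λ ()) (site-apart u≡ r≡ λ ()) (site-apart v≡ r≡ λ ())

  star : ∀ {a c f b b′ b″} → Star a c f b b′ b″ → Conclusion P
  star {a} {c} {f} {b} {b′} {b″} s with b ≟ b′ | b′ ≟ b″ | b ≟ b″
  ... | yes refl | yes refl | _ = ⊥-elim (Clauses.no-star irr in-clauses
          (neg-sym P ab) (neg-sym P cb) (neg-sym P fb) a≁c a≁f c≁f)
          where open Star s
  ... | yes refl | no b≢b″ | _        = star-ssd s b≢b″
  ... | no b≢b′ | yes refl | _        = star-ssd (rotate s) (b≢b′ ∘ sym)
  ... | no b≢b′ | no b′≢b″ | yes refl = star-ssd (rotate (rotate s)) b≢b′
  ... | no b≢b′ | no b′≢b″ | no b≢b″  = StarDDD.conclude template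
          (functional-leaf a) (functional-leaf c) (functional-leaf f)
    where
    open Star s
    template : Template 4 (lookup (Vec.map (var P) (a ∷ c ∷ f ∷ b ∷ []))) ix-star es-star
    template = skeleton P irr neg-joined ix-star es-star ((3F , 4F) ∷ (3F , 5F) ∷ (4F , 5F) ∷ [])
      (Vec.map (var P) (a ∷ c ∷ f ∷ b ∷ [])) (a ∷ c ∷ f ∷ b ∷ b′ ∷ b″ ∷ []) unique
      (λ { 0F → refl ; 1F → refl ; 2F → refl ; 3F → refl ; 4F → sym b~ ; 5F → sym b~′ })
      (b≢b′ ∷ b≢b″ ∷ b′≢b″ ∷ []) (ab ∷ cb ∷ fb ∷ []) complete

  path : ∀ {a b b′ c c′ d} → Path a b b′ c c′ d → Conclusion P
  path {a} {b} {b′} {c} {c′} {d} s with b ≟ b′ | c ≟ c′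
  ... | no b≢b′  | no c≢c′  = path-dd s b≢b′ c≢c′
  ... | yes refl | no c≢c′  = path-sd s c≢c′
  ... | no b≢b′  | yes refl = path-sd (reverse s) (b≢b′ ∘ sym)
  ... | yes refl | yes refl = ⊥-elim (Clauses.no-path irr in-clauses ab bc cd (a≁c ∘ cong (var P)) (b≁d ∘ cong (var P)))
    where open Path s

  -- A negative edge leaving the three variables prolongs the path at an end or completes a star at
  -- the middle; one that is disjoint from them would make five variables.
  short-path : ∀ {a b b′ c} → ShortPath a b b′ c → Conclusion P
  short-path {a} {b} {b′} {c} s = case any? (λ e → any? λ f → neg? P e f ×-dec ¬? (inside? f)) of λ where
      (no none) → closed λ {p} {q} pq → decidable-stable (inside? q) λ out → none (p , q , pq , out)
      (yes (e , f , ef , f-out)) → case inside? e of λ where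
        (yes (inj₁ e~a)) → path record
          { ab = neg-sym P ef ; bc = ab ; cd = bc ; b~ = e~a ; c~ = b~
          ; a≁c = f-out ∘ inj₂ ∘ inj₁ ; a≁d = f-out ∘ inj₂ ∘ inj₂ ; b≁d = λ e~c → a≁c (trans (sym e~a) e~c) }
        (yes (inj₂ (inj₁ e~b))) → star record
          { ab = ab ; cb = neg-sym P bc ; fb = neg-sym P ef ; b~ = b~ ; b~′ = sym e~b
          ; a≁c = a≁c ; a≁f = λ a~f → f-out (inj₁ (sym a~f)) ; c≁f = λ c~f → f-out (inj₂ (inj₂ (sym c~f))) }
        (yes (inj₂ (inj₂ e~c))) → path record
          { ab = ab ; bc = bc ; cd = ef ; b~ = b~ ; c~ = sym e~c
          ; a≁c = a≁c ; a≁d = λ a~f → f-out (inj₁ (sym a~f)) ; b≁d = λ b~f → f-out (inj₂ (inj₁ (sym b~f))) }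
        (no e-out) → ⊥-elim (no-five (e ∷ f ∷ a ∷ b ∷ c ∷ [])
          ((neg-distinct P ef ∷ e-out ∘ inj₁ ∷ e-out ∘ inj₂ ∘ inj₁ ∷ e-out ∘ inj₂ ∘ inj₂ ∷ []) VAP.∷
           (f-out ∘ inj₁ ∷ f-out ∘ inj₂ ∘ inj₁ ∷ f-out ∘ inj₂ ∘ inj₂ ∷ []) VAP.∷ unique))
    where
    open ShortPath s
    closed : (∀ {p q} → Neg P p q → Inside q) → Conclusion P
    closed inside with b ≟ b′
    ... | yes refl = short-path-s s inside
    ... | no b≢b′  = short-path-d s inside b≢b′

  -- Without two consecutive negative edges, each variable has negative edges to at most one other,
  -- and `neg-unique` leaves a single one.
  linked : ¬ (∃[ a ] ∃[ b ] ∃[ b′ ] ∃[ c ] Neg P a b × b ~ b′ × Neg P b′ c × ¬ a ~ c) →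
    ∀ {a b p q} → Neg P a b → Neg P p q → p ~ a → p ≡ a × q ≡ b
  linked no-short {a} {b} {p} {q} ab pq p~a = neg-unique pq ab p~a (decidable-stable (q ~? b) λ q≁b →
    no-short (b , a , p , q , neg-sym P ab , sym p~a , pq , q≁b ∘ sym))

  conclusion : Conclusion P
  conclusion with any? (λ a → any? λ b → any? λ b′ → any? λ c →
    neg? P a b ×-dec (b ~? b′) ×-dec neg? P b′ c ×-dec ¬? (a ~? c))
  ... | yes (_ , _ , _ , _ , ab , b~ , bc , a≁c) = short-path record { ab = ab ; bc = bc ; b~ = b~ ; a≁c = a≁c }
  ... | no no-short with any? (λ a → any? λ b → neg? P a b)
  -- Without negative edges there are no positive ones, so every point would be dangling. The
  -- pattern has no points and occurs in any pattern; Q1 is an arbitrary choice.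
  ...   | no none = inQ1 (⊥-elim ∘ no-point , (λ a → ⊥-elim (no-point a)) , (λ a → ⊥-elim (no-point a)) , λ a → ⊥-elim (no-point a))
    where
    no-point : ¬ Fin k
    no-point p = let (_ , _ , _ , pb , _) = alive P irr p (λ q pq → none (p , q , pq))
                     (a , b , ab , _) = neg-joined pb
                 in none (a , b , ab)
  ...   | yes (a , b , ab) with any? (λ c → any? λ d → neg? P c d ×-dec ¬? (c ~? a) ×-dec ¬? (c ~? b))
  ...     | no none = SingleEdge.conclude template (functional-one-way a b)
    where
    complete : ∀ {p q} → Neg P p q → Any (Joins p q) ((a , b) ∷ [])
    complete {p} {q} pq with p ~? a | p ~? b
    ... | yes p~a | _       = here (inj₁ (linked no-short ab pq p~a))
    ... | no _    | yes p~b = here (inj₂ (linked no-short (neg-sym P ab) pq p~b))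
    ... | no p≁a  | no p≁b  = contradiction (p , q , pq , p≁a , p≁b) none
    template : Template 2 (lookup (Vec.map (var P) (a ∷ b ∷ []))) ix-1 es-1
    template = skeleton P irr neg-joined ix-1 es-1 [] (Vec.map (var P) (a ∷ b ∷ [])) (a ∷ b ∷ [])
      (distinct₂ (neg-distinct P ab)) (λ { 0F → refl ; 1F → refl }) [] (ab ∷ []) complete
  ...     | yes (c , d , cd , c≁a , c≁b) = TwoEdges.conclude template (functional-one-way a b) (functional-one-way c d)
    where
    unique : Unique (Vec.map (var P) (a ∷ b ∷ c ∷ d ∷ []))
    unique = distinct₄ (neg-distinct P ab) (c≁a ∘ sym)
      (λ a~d → c≁b (cong (var P) (proj₂ (linked no-short ab (neg-sym P cd) (sym a~d)))))
      (c≁b ∘ sym)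
      (λ b~d → c≁a (cong (var P) (proj₂ (linked no-short (neg-sym P ab) (neg-sym P cd) (sym b~d)))))
      (neg-distinct P cd)
    complete : ∀ {p q} → Neg P p q → Any (Joins p q) ((a , b) ∷ (c , d) ∷ [])
    complete {p} pq = case locate unique p of λ where
      (inj₁ p~a)               → here (inj₁ (linked no-short ab pq p~a))
      (inj₂ (inj₁ p~b))        → here (inj₂ (linked no-short (neg-sym P ab) pq p~b))
      (inj₂ (inj₂ (inj₁ p~c))) → there (here (inj₁ (linked no-short cd pq p~c)))
      (inj₂ (inj₂ (inj₂ p~d))) → there (here (inj₂ (linked no-short (neg-sym P cd) pq p~d)))
    template : Template 4 (lookup (Vec.map (var P) (a ∷ b ∷ c ∷ d ∷ []))) ix-2 es-2
    template = skeleton P irr neg-joined ix-2 es-2 [] (Vec.map (var P) (a ∷ b ∷ c ∷ d ∷ [])) (a ∷ b ∷ c ∷ d ∷ [])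
      unique (λ { 0F → refl ; 1F → refl ; 2F → refl ; 3F → refl }) [] (ab ∷ cd ∷ []) complete

proposition2 : (m k : ℕ) (P : Pattern (Fin m) (Fin k)) →
    Monotone P → Irreducible P → SACSolvable P →
    P occursIn Q1 ⊎ P occursIn Q2 ⊎
    P occursIn R1 ⊎ P occursIn R2 ⊎ P occursIn R3 ⊎ P occursIn R4 ⊎
    P occursIn R5 ⊎ P occursIn R6 ⊎ P occursIn R7 ⊎ P occursIn R8 ⊎
    P occursIn R9 ⊎ P occursIn R10
proposition2 m k P monotone irr solvable = Main.conclusion P monotone irr solvable
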